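{- Let $T$ be a tree with $\sigma(T)=\tau_{\mathrm{ind}}(T)$. For every $\delta>0$ there exist $\varepsilon>0$ and $n_0$ such that for all $n\ge n_0$ the following holds: if $\mathcal{H}$ is an $n$-vertex $3$-graph containing no copy of $T^3$ with $$|\mathcal{H}|\ge\left(\frac{\sigma(T)-1}{2}-\varepsilon\right)n^2,$$ then $\mathcal{H}$ is $\delta$-close to $\mathcal{S}(n,\sigma(T)-1)$.
   Context: For a graph $F$, $|F|$ is its number of edges and $F-I$ the subgraph induced on $V(F)\setminus I$. The crosscut number is $\sigma(F)=\min\{|I|+|F-I| : I \text{ independent in } F\}$. For bipartite $F$, $\tau_{\mathrm{ind}}(F)$ is the minimum size of $S\subseteq V(F)$ with $|S\cap e|=1$ for every edge $e$. The expansion $T^3$ of a graph $T$ is the $3$-graph obtained by adding to each edge a new vertex, distinct edges receiving distinct new vertices. For a $3$-graph $\mathcal{H}$ and $L\subseteq V(\mathcal{H})$, $\mathcal{H}-L$ is the set of edges of $\mathcal{H}$ disjoint from $L$, and $d_{\mathcal{H}}(v)$ is the number of edges containing $v$. For $n\ge t\ge 0$, $\mathcal{S}(n,t)=\{e\in\binom{[n]}{3}: |e\cap[t]|\ge1\}$. An $n$-vertex $3$-graph $\mathcal{H}$ is $\delta$-close to $\mathcal{S}(n,t)$ if there exists $L\subseteq V(\mathcal{H})$ with $|L|=t$ such that $|\mathcal{H}-L|\le\delta n^2$ and $d_{\mathcal{H}}(v)\ge(1/2-\delta)n^2$ for all $v\in L$. -}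

module Defs where

open import Data.Fin.Base using (Fin)
open import Data.Fin.Properties using (any?; _≟_)
open import Data.Fin.Subset
  using (Subset; inside; outside; _∈_; _⊆_; _∩_; _∪_; ⁅_⁆; ∣_∣)
open import Data.Fin.Subset.Properties using (_∈?_; nonempty?; ∣⁅x⁆∣≡1; x∈⁅x⁆; x∈⁅y⁆⇒x≡y)
open import Data.Integer.Base using (+_)
open import Data.List.Base as List using (List; _∷_; [_]; length; filter)
open import Data.List.Membership.Propositional using () renaming (_∈_ to _∈ˡ_)
open import Data.List.Membership.Propositional.Properties using (∈-lookup)
open import Data.List.Relation.Unary.All as All using (All)
import Data.List.Relation.Unary.All.Properties as All
open import Data.List.Relation.Unary.Linked using (Linked)
open import Data.List.Relation.Unary.Unique.Propositional using (Unique)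
import Data.List.Relation.Unary.Unique.Propositional.Properties as Unique
open import Data.Nat.Base as ℕ using (ℕ; suc; NonZero)
open import Data.Product.Base using (∃-syntax; _×_)
open import Data.Rational.Base as ℚ using (ℚ; ½; _/_)
open import Data.Vec.Base as Vec using ([]; _∷_; tabulate)
open import Data.Vec.Properties using (++-injectiveʳ)
open import Function.Definitions using (Injective)
open import Relation.Binary.Construct.Closure.ReflexiveTransitive using (Star)
open import Relation.Binary.PropositionalEquality.Core
  using (_≡_; refl; trans; subst; cong; cong₂)
open import Relation.Nullary using (¬_; ¬?; does)
open import Relation.Nullary.Decidable using (_×-dec_)

-- The list represents the edge set; by uniqueness its length is the
-- number of edges, and the order of the list plays no role.
record Hypergraph (r n : ℕ) : Set where
  field
    edges         : List (Subset n)
    edges-unique  : Unique edges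
    edges-uniform : All (λ e → ∣ e ∣ ≡ r) edges

open Hypergraph public

Graph 3-Graph : ℕ → Set
Graph   = Hypergraph 2
3-Graph = Hypergraph 3

private
  variable
    k m n r : ℕ

size : Hypergraph r n → ℕ
size H = length (edges H)

infixl 6 _∖_

-- The edges disjoint from L.  For a graph F these are exactly the edges
-- of the subgraph induced on V(F) ∖ L.
_∖_ : Hypergraph r n → Subset n → List (Subset n)
H ∖ L = filter (λ e → ¬? (nonempty? (e ∩ L))) (edges H)

degree : Hypergraph r n → Fin n → ℕ
degree H v = length (filter (v ∈?_) (edges H))

image : (Fin m → Fin n) → Subset m → Subset n
image f p = tabulate (λ y → does (any? (λ x → (x ∈? p) ×-dec (f x ≟ y))))

-- H contains a copy (not necessarily induced) of G.
Contains : Hypergraph r n → Hypergraph r m → Set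
Contains {n = n} {m = m} H G =
  ∃[ f ] Injective {A = Fin m} {B = Fin n} _≡_ _≡_ f ×
         (∀ {e} → e ∈ˡ edges G → image f e ∈ˡ edges H)

-- An edge ⁅ u ⁆ ∪ ⁅ v ⁆ has two elements, so Adjacent F u v forces u ≢ v.
Adjacent : Graph n → Fin n → Fin n → Set
Adjacent F u v = (⁅ u ⁆ ∪ ⁅ v ⁆) ∈ˡ edges F

Connected : Graph n → Set
Connected F = ∀ u v → Star (Adjacent F) u v

-- The distinct vertices v ∷ vs, at least three of them, traversed in order
-- and then back to v.
IsCycle : Graph n → Fin n → List (Fin n) → Set
IsCycle F v vs =
  2 ℕ.≤ length vs × Unique (v ∷ vs) × Linked (Adjacent F) (v ∷ vs List.++ [ v ])

record IsTree (T : Graph n) : Set where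
  field
    nonempty  : NonZero n
    connected : Connected T
    acyclic   : ∀ v vs → ¬ IsCycle T v vs

IsMinimum : (ℕ → Set) → ℕ → Set
IsMinimum P k = P k × (∀ j → P j → k ℕ.≤ j)

Independent : Graph n → Subset n → Set
Independent F I = ∀ {e} → e ∈ˡ edges F → ¬ (e ⊆ I)

-- σ(F) = s
IsCrosscutNumber : Graph n → ℕ → Set
IsCrosscutNumber F =
  IsMinimum (λ k → ∃[ I ] Independent F I × k ≡ ∣ I ∣ ℕ.+ length (F ∖ I))

-- τ_ind(F) = s.  No s satisfies this unless F is bipartite.
IsTauInd : Graph n → ℕ → Set
IsTauInd F =
  IsMinimum (λ k → ∃[ S ] (∀ {e} → e ∈ˡ edges F → ∣ S ∩ e ∣ ≡ 1) × k ≡ ∣ S ∣)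

∣p++q∣≡∣p∣+∣q∣ : (p : Subset m) (q : Subset k) →
                 ∣ p Vec.++ q ∣ ≡ ∣ p ∣ ℕ.+ ∣ q ∣
∣p++q∣≡∣p∣+∣q∣ []            q = refl
∣p++q∣≡∣p∣+∣q∣ (inside  ∷ p) q = cong suc (∣p++q∣≡∣p∣+∣q∣ p q)
∣p++q∣≡∣p∣+∣q∣ (outside ∷ p) q = ∣p++q∣≡∣p∣+∣q∣ p q

⁅⁆-injective : {i j : Fin n} → ⁅ i ⁆ ≡ ⁅ j ⁆ → i ≡ j
⁅⁆-injective {i = i} {j} eq = x∈⁅y⁆⇒x≡y j (subst (i ∈_) eq (x∈⁅x⁆ i))

-- T³ has vertex set V(T) ⊎ E(T): the first m vertices are those of T, and
-- the i-th of the remaining ones is the new vertex of the i-th edge of T.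
expansion : (T : Graph m) → 3-Graph (m ℕ.+ size T)
expansion {m} T = record
  { edges         = List.tabulate expand
  ; edges-unique  = Unique.tabulate⁺ λ {i} {j} eq →
      ⁅⁆-injective (++-injectiveʳ (List.lookup (edges T) i) (List.lookup (edges T) j) eq)
  ; edges-uniform = All.tabulate⁺ λ i →
      trans (∣p++q∣≡∣p∣+∣q∣ (List.lookup (edges T) i) ⁅ i ⁆)
            (cong₂ ℕ._+_ (All.lookup (edges-uniform T) (∈-lookup i)) (∣⁅x⁆∣≡1 i))
  }
  where
  expand : Fin (size T) → Subset (m ℕ.+ size T)
  expand i = List.lookup (edges T) i Vec.++ ⁅ i ⁆

fromℕ : ℕ → ℚ
fromℕ n = + n / 1

-- H is δ-close to 𝒮(n,t); 𝒮(n,t) enters only through n and t.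
Close : ℚ → (t : ℕ) → 3-Graph n → Set
Close {n} δ t H =
  ∃[ L ] ∣ L ∣ ≡ t ×
         fromℕ (length (H ∖ L)) ℚ.≤ δ ℚ.* fromℕ (n ℕ.^ 2) ×
         (∀ {v} → v ∈ L → (½ ℚ.- δ) ℚ.* fromℕ (n ℕ.^ 2) ℚ.≤ fromℕ (degree H v))

{-# OPTIONS --safe #-}
-- Let S be a transversal of T, ∣S∣ = t + 1, and let H be free of T³.
--
-- If every vertex in a nonempty set A had a large matching in its link within
-- A, then T³ could be embedded greedily, edge by edge, since each tree is grown
-- from a vertex by adding one edge at a time.  Hence the vertices of H can be
-- ordered so that the link of each vertex, within the later ones, has a cover
-- of bounded size.  Call a a thick neighbour of v if the pair has codegree at
-- least n/g.  All but O(n²/g) edges have the form {v, a, y} with v the first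
-- vertex and a a thick neighbour of v.
--
-- Only boundedly many vertices have t + 1 thick neighbours: otherwise Ramsey's
-- theorem gives many of them whose tuples of thick neighbours form a sunflower,
-- an averaging argument replaces the coordinates outside the kernel by common
-- neighbours, and the expansion of a large complete bipartite graph appears.
-- So ∣H∣ ≤ (t/2 + o(1)) n², and near equality forces almost every vertex v to be
-- typical: it has exactly t thick neighbours and spans an edge with each of
-- them and almost every later vertex.
--
-- If no t-set were the thick neighbourhood of many typical vertices in a short
-- initial segment, there would be a long chain of typical vertices with
-- different neighbourhoods N(v), in which {v, a, u} is an edge for all v < u and
-- a ∈ N(v).  After passing to a sunflower, T³ embeds: S is coloured by the t
-- coordinates so that only two vertices q₀, q₁ share a colour, of a nonconstant
-- coordinate; as T has no 4-cycle, only one vertex is adjacent to both, and it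
-- goes to the end of the chain.  Hence some t-set L is a popular neighbourhood,
-- and then every element of L is a thick neighbour of almost every later vertex.
-- So L is the thick neighbourhood of almost all vertices.
module Submission where

open import Data.Bool.Base using (Bool; true; false)
open import Data.Bool.Properties as Bool using ()
open import Data.Empty using (⊥; ⊥-elim)
open import Data.Fin.Base as Fin using (Fin; zero; suc)
open import Data.Fin.Properties using (_≟_)
open import Data.Fin.Subset using (Subset; inside; outside; ⁅_⁆; _∪_; _∩_; ∣_∣) renaming (_∈_ to _∈ₛ_; _∉_ to _∉ₛ_; _⊆_ to _⊆ₛ_; ⊥ to ∅)
open import Data.Fin.Subset.Properties using (x∈⁅x⁆; x∈⁅y⁆⇒x≡y; x∈p∪q⁺; x∈p∪q⁻; x∈p∩q⁺; x∈p∩q⁻; ∪-comm; ∪-assoc; ⊆-antisym; ∉⊥; _⊆?_; nonempty?) renaming (_∈?_ to _∈ₛ?_)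
open import Data.List.Base using (List; []; _∷_; _++_; map; filter; length; lookup; concatMap; allFin; take; drop)
open import Data.List.Membership.Propositional using (_∈_; _∉_; find; lose)
open import Data.List.Membership.Propositional.Properties using (∈-++⁺ˡ; ∈-++⁺ʳ; ∈-++⁻; ∈-filter⁺; ∈-filter⁻; ∈-∃++; ∈-map⁺; ∈-map⁻; ∈-lookup; ∈-allFin; ∈-concatMap⁺; ∈-tabulate⁻)
open import Data.List.Properties using (length-++; length-map; length-tabulate; take++drop≡id; length-take)
import Data.List.Relation.Binary.Sublist.Propositional as Sublist
open import Data.List.Relation.Binary.Sublist.Propositional using () renaming (_⊆_ to _⊑_; [] to []ˢ; _∷_ to _∷ˢ_; _∷ʳ_ to _∷ʳˢ_)
import Data.List.Relation.Binary.Sublist.Propositional.Properties as Sublist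
open import Data.List.Relation.Binary.Subset.Propositional using (_⊆_)
open import Data.List.Relation.Unary.All as All using (All; []; _∷_)
import Data.List.Relation.Unary.All.Properties as All
open import Data.List.Relation.Unary.AllPairs as AllPairs using (AllPairs; []; _∷_)
import Data.List.Relation.Unary.AllPairs.Properties as AllPairsₚ
open import Data.List.Relation.Unary.Any as Any using (Any; here; there; any?)
open import Data.List.Relation.Unary.Linked using (Linked; []; [-]; _∷_)
open import Data.List.Relation.Unary.Unique.Propositional using (Unique)
open import Data.List.Relation.Unary.Unique.Propositional.Properties as Unique using (Unique[x∷xs]⇒x∉xs)
open import Data.Nat.Base using (ℕ; zero; suc; _+_; _*_; _^_; _≤_; _<_; z≤n; s≤s; s≤s⁻¹; NonZero; >-nonZero; >-nonZero⁻¹)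
open import Data.Nat.ListAction using (sum)
open import Data.Nat.Properties as ℕ hiding (_≟_)
open import Data.Nat.Tactic.RingSolver using (solve-∀)
open import Data.Product.Base using (Σ; ∃-syntax; _×_; _,_; proj₁; proj₂)
open import Data.Sum.Base using (_⊎_; inj₁; inj₂; [_,_]′)
open import Data.Sum.Properties using (inj₁-injective; inj₂-injective) renaming (≡-dec to ⊎-≡-dec)
open import Data.Vec.Base as Vec using ([]; _∷_)
open import Data.Vec.Properties as Vec using ()
open import Defs
open import Function.Base using (_∘_; id; case_of_)
open import Relation.Binary.Construct.Closure.ReflexiveTransitive using (Star; _◅_) renaming (ε to stop)
open import Relation.Binary.Definitions using (DecidableEquality)
open import Relation.Binary.PropositionalEquality using (_≡_; _≢_; refl; sym; trans; cong; cong₂; subst; subst₂)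
open import Relation.Nullary using (¬_; Dec; yes; no; ¬?; contradiction)
open import Relation.Nullary.Decidable as Dec using (does; _×-dec_)
open import Data.Integer.Base as ℤ using (+[1+_])
import Data.Integer.Properties as ℤ
open import Data.Nat.Base as ℕ using (_∸_)
open import Data.Rational.Base as ℚ using (ℚ; mkℚ; 0ℚ; 1ℚ; ½; *≤*)
open import Data.Rational.Literals using (fromℤ)
import Data.Rational.Properties as ℚ
import Data.Rational.Solver as ℚ
import Data.Rational.Unnormalised.Base as ℚᵘ
import Data.Rational.Unnormalised.Properties as ℚᵘ
import Data.Nat.Coprimality as Coprimality

-- The factor 1/2 comes from the ordering: a vertex with at most t thick neighbours is, up to a thin
-- remainder, the first vertex of at most t edges per later vertex, and the numbers of later
-- vertices add up to about n²/2. The obstacle is that typical vertices have t thick neighbours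
-- while S has t + 1 members. In the chain, a member of S with a nonconstant colour i sits on some
-- v_b, its ordinary neighbours in T on earlier v_a, and the i-th thick neighbour of v_a is the
-- expansion vertex of that edge. A common neighbour of q₀ and q₁ placed early would have to use the
-- same thick neighbour for both edges. Placed last, it lets each edge use the tuple of q₀ or q₁
-- instead. A constant colour cannot be shared, because its member of S is placed on the kernel
-- vertex itself. A popular L spreads by double counting: a pair of u and some a in L that is not
-- thick has too small a codegree for u to form an edge with a and half of the popular vertices
-- before it, yet each of these forms it with almost every later u.

private
  variable
    A B : Set
    xs ys : List A

-- Counting in lists

⊑-length : {xs ys : List A} → xs ⊑ ys → length xs ≤ length ys
⊑-length = Sublist.length-mono-≤

⊑⇒⊆ : {xs ys : List A} → xs ⊑ ys → xs ⊆ ys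
⊑⇒⊆ p = Sublist.lookup p

AllPairs-⊑ : {R : A → A → Set} {xs ys : List A} → xs ⊑ ys → AllPairs R ys → AllPairs R xs
AllPairs-⊑ []ˢ          []         = []
AllPairs-⊑ (y ∷ʳˢ s)    (_ ∷ ps)   = AllPairs-⊑ s ps
AllPairs-⊑ (refl ∷ˢ s)  (p ∷ ps)   = All.tabulate (λ i → All.lookup p (⊑⇒⊆ s i)) ∷ AllPairs-⊑ s ps

AllPairs-lookup : {R : A → A → Set} {xs : List A} → AllPairs R xs →
                  ∀ {i j} → i Fin.< j → R (lookup xs i) (lookup xs j)
AllPairs-lookup (p ∷ ps) {zero}  {suc j} _         = All.lookup p (∈-lookup j)
AllPairs-lookup (p ∷ ps) {suc i} {suc j} (s≤s i<j) = AllPairs-lookup ps i<j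

lookup-injective : {xs : List A} → Unique xs → ∀ i j → lookup xs i ≡ lookup xs j → i ≡ j
lookup-injective (_ ∷ _) zero    zero    _  = refl
lookup-injective (p ∷ _) zero    (suc j) eq = contradiction eq (All.lookup p (∈-lookup j))
lookup-injective (p ∷ _) (suc i) zero    eq = contradiction (sym eq) (All.lookup p (∈-lookup i))
lookup-injective (_ ∷ u) (suc i) (suc j) eq = cong suc (lookup-injective u i j eq)

Unique-⊆-length : {xs ys : List A} → Unique xs → xs ⊆ ys → length xs ≤ length ys
Unique-⊆-length {xs = []}     _        _  = z≤n
Unique-⊆-length {xs = x ∷ xs} (x∉ ∷ u) sub with ∈-∃++ (sub (here refl))
... | as , bs , refl = begin
  suc (length xs)              ≤⟨ s≤s (Unique-⊆-length u sub′) ⟩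
  suc (length (as ++ bs))      ≡⟨ cong suc (length-++ as) ⟩
  suc (length as + length bs)  ≡⟨ +-suc (length as) (length bs) ⟨
  length as + length (x ∷ bs)  ≡⟨ length-++ as ⟨
  length (as ++ x ∷ bs)        ∎
  where
  open ≤-Reasoning
  sub′ : xs ⊆ (as ++ bs)
  sub′ {z} z∈ with ∈-++⁻ as (sub (there z∈))
  ... | inj₁ p           = ∈-++⁺ˡ p
  ... | inj₂ (here refl) = contradiction refl (All.lookup x∉ z∈)
  ... | inj₂ (there p)   = ∈-++⁺ʳ as p

count : {P : A → Set} → (∀ x → Dec (P x)) → List A → ℕ
count P? xs = length (filter P? xs)

module _ {P Q : A → Set} (P? : ∀ x → Dec (P x)) (Q? : ∀ x → Dec (Q x)) where

  count-mono : ∀ xs → (∀ {x} → x ∈ xs → P x → Q x) → count P? xs ≤ count Q? xs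
  count-mono []       _ = z≤n
  count-mono (x ∷ xs) f with P? x | Q? x | count-mono xs (f ∘ there)
  ... | yes p | yes q | ih = s≤s ih
  ... | yes p | no ¬q | ih = contradiction (f (here refl) p) ¬q
  ... | no ¬p | yes q | ih = m≤n⇒m≤1+n ih
  ... | no ¬p | no ¬q | ih = ih

  count-⊎ : {R : A → Set} (R? : ∀ x → Dec (R x)) → ∀ xs → (∀ {x} → x ∈ xs → R x → P x ⊎ Q x) →
            count R? xs ≤ count P? xs + count Q? xs
  count-⊎ R? []       _ = z≤n
  count-⊎ R? (x ∷ xs) f with R? x | P? x | Q? x | count-⊎ R? xs (f ∘ there)
  ... | yes r | yes p | yes q | ih = s≤s (≤-trans ih (+-monoʳ-≤ (count P? xs) (n≤1+n _)))
  ... | no ¬r | yes p | yes q | ih = m≤n⇒m≤1+n (≤-trans ih (+-monoʳ-≤ (count P? xs) (n≤1+n _)))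
  ... | yes r | yes p | no ¬q | ih = s≤s ih
  ... | yes r | no ¬p | yes q | ih = ≤-trans (s≤s ih) (≤-reflexive (sym (+-suc (count P? xs) _)))
  ... | yes r | no ¬p | no ¬q | ih = contradiction (f (here refl) r) [ ¬p , ¬q ]′
  ... | no ¬r | yes p | no ¬q | ih = m≤n⇒m≤1+n ih
  ... | no ¬r | no ¬p | yes q | ih = ≤-trans (m≤n⇒m≤1+n ih) (≤-reflexive (sym (+-suc (count P? xs) _)))
  ... | no ¬r | no ¬p | no ¬q | ih = ih

count-⊑ : {P : A → Set} (P? : ∀ x → Dec (P x)) {xs ys : List A} → xs ⊑ ys → count P? xs ≤ count P? ys
count-⊑ P? []ˢ = z≤n
count-⊑ P? (y ∷ʳˢ s) with P? y
... | yes _ = m≤n⇒m≤1+n (count-⊑ P? s)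
... | no _  = count-⊑ P? s
count-⊑ P? (_∷ˢ_ {x} refl s) with P? x
... | yes _ = s≤s (count-⊑ P? s)
... | no _  = count-⊑ P? s

count-¬ : {P : A → Set} (P? : ∀ x → Dec (P x)) → ∀ xs →
          count P? xs + count (¬? ∘ P?) xs ≡ length xs
count-¬ P? [] = refl
count-¬ P? (x ∷ xs) with P? x | count-¬ P? xs
... | yes _ | ih = cong suc ih
... | no  _ | ih = trans (+-suc _ _) (cong suc ih)

count-⊆ : {P : A → Set} (P? : ∀ x → Dec (P x)) {xs ys : List A} →
          Unique xs → xs ⊆ ys → count P? xs ≤ count P? ys
count-⊆ P? u sub = Unique-⊆-length (Unique.filter⁺ P? u) λ x∈ →
  let p , q = ∈-filter⁻ P? x∈ in ∈-filter⁺ P? (sub p) q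

count-++ : {P : A → Set} (P? : ∀ x → Dec (P x)) (xs ys : List A) →
           count P? (xs ++ ys) ≡ count P? xs + count P? ys
count-++ P? []       ys = refl
count-++ P? (x ∷ xs) ys with P? x
... | yes _ = cong suc (count-++ P? xs ys)
... | no  _ = count-++ P? xs ys

-- Finite sums and double counting

∑ : List A → (A → ℕ) → ℕ
∑ xs f = sum (map f xs)

∑-mono : {f g : A → ℕ} (xs : List A) → (∀ {x} → x ∈ xs → f x ≤ g x) → ∑ xs f ≤ ∑ xs g
∑-mono []       _ = z≤n
∑-mono (x ∷ xs) h = +-mono-≤ (h (here refl)) (∑-mono xs (h ∘ there))

∑-const : ∀ (xs : List A) c → ∑ xs (λ _ → c) ≡ length xs * c
∑-const []       c = refl
∑-const (x ∷ xs) c = cong (c +_) (∑-const xs c)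

∑-+ : {f g : A → ℕ} (xs : List A) → ∑ xs (λ x → f x + g x) ≡ ∑ xs f + ∑ xs g
∑-+ []       = refl
∑-+ {f = f} {g} (x ∷ xs) = trans (cong (f x + g x +_) (∑-+ xs)) (lemma (f x) (g x) _ _)
  where
  lemma : ∀ a b c d → (a + b) + (c + d) ≡ (a + c) + (b + d)
  lemma = solve-∀

∑-* : {f : A → ℕ} (k : ℕ) (xs : List A) → ∑ xs (λ x → k * f x) ≡ k * ∑ xs f
∑-* k []       = sym (*-zeroʳ k)
∑-* {f = f} k (x ∷ xs) = trans (cong (k * f x +_) (∑-* k xs)) (sym (*-distribˡ-+ k (f x) _))

∑≤ : {f : A → ℕ} (xs : List A) {c : ℕ} → (∀ {x} → x ∈ xs → f x ≤ c) → ∑ xs f ≤ length xs * c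
∑≤ xs {c} h = ≤-trans (∑-mono xs h) (≤-reflexive (∑-const xs c))

∑≥ : {f : A → ℕ} (xs : List A) {c : ℕ} → (∀ {x} → x ∈ xs → c ≤ f x) → length xs * c ≤ ∑ xs f
∑≥ xs {c} h = ≤-trans (≤-reflexive (sym (∑-const xs c))) (∑-mono xs h)

length-concatMap : (f : A → List B) (xs : List A) → length (concatMap f xs) ≡ ∑ xs (length ∘ f)
length-concatMap f []       = refl
length-concatMap f (x ∷ xs) = trans (length-++ (f x)) (cong (length (f x) +_) (length-concatMap f xs))

∑-swap : {f : A → B → ℕ} (xs : List A) (ys : List B) →
         ∑ xs (λ x → ∑ ys (f x)) ≡ ∑ ys (λ y → ∑ xs (λ x → f x y))
∑-swap []       ys = sym (trans (∑-const ys 0) (*-zeroʳ (length ys)))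
∑-swap {f = f} (x ∷ xs) ys = trans (cong (∑ ys (f x) +_) (∑-swap xs ys)) (sym (∑-+ ys))

𝟙 : {P : Set} → Dec P → ℕ
𝟙 (yes _) = 1
𝟙 (no _)  = 0

count≡∑ : {P : A → Set} (P? : ∀ x → Dec (P x)) (xs : List A) → count P? xs ≡ ∑ xs (𝟙 ∘ P?)
count≡∑ P? [] = refl
count≡∑ P? (x ∷ xs) with P? x
... | yes _ = cong suc (count≡∑ P? xs)
... | no _  = count≡∑ P? xs

double-count : {R : A → B → Set} (R? : ∀ x y → Dec (R x y)) (xs : List A) (ys : List B) →
               ∑ xs (λ x → count (R? x) ys) ≡ ∑ ys (λ y → count (λ x → R? x y) xs)
double-count R? xs ys = trans (∑-cong xs (λ x → count≡∑ (R? x) ys))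
  (trans (∑-swap xs ys) (sym (∑-cong ys (λ y → count≡∑ (λ x → R? x y) xs))))
  where
  ∑-cong : {C : Set} {f g : C → ℕ} (zs : List C) → (∀ z → f z ≡ g z) → ∑ zs f ≡ ∑ zs g
  ∑-cong []       h = refl
  ∑-cong (z ∷ zs) h = cong₂ _+_ (h z) (∑-cong zs h)

module _ (_≟_ : DecidableEquality A) where

  open import Data.List.Membership.DecPropositional _≟_ using (_∈?_)

  count-∉ : ∀ {ys : List A} (us : List A) → Unique ys →
            length ys ≤ count (λ y → ¬? (y ∈? us)) ys + length us
  count-∉ {ys} us u = begin
    length ys                                              ≡⟨ count-¬ (λ y → y ∈? us) ys ⟨
    count (_∈? us) ys + count (λ y → ¬? (y ∈? us)) ys      ≡⟨ +-comm (count (_∈? us) ys) _ ⟩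
    count (λ y → ¬? (y ∈? us)) ys + count (_∈? us) ys      ≤⟨ +-monoʳ-≤ _ (Unique-⊆-length (Unique.filter⁺ (_∈? us) u) (λ z∈ → proj₂ (∈-filter⁻ (_∈? us) {xs = ys} z∈))) ⟩
    count (λ y → ¬? (y ∈? us)) ys + length us              ∎
    where open ≤-Reasoning

  fresh : ∀ {ys : List A} (us : List A) → Unique ys → length us < length ys → ∃[ y ] y ∈ ys × y ∉ us
  fresh {ys} us u lt with any? (λ y → ¬? (y ∈? us)) ys
  ... | yes p = let y , y∈ , y∉ = Data.List.Membership.Propositional.find p in y , y∈ , y∉
    where import Data.List.Membership.Propositional
  ... | no ¬p = contradiction (Unique-⊆-length u λ {z} z∈ → dec z (λ z∉ → ¬p (Any.map (λ { refl → z∉ }) z∈))) (<⇒≱ lt)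
    where
    dec : ∀ z → ¬ z ∉ us → z ∈ us
    dec z ¬¬p with z ∈? us
    ... | yes p = p
    ... | no q  = contradiction q ¬¬p

-- Ramsey's theorem for pairs of positions in a list

*-pos : ∀ {k l} → 0 < k → 0 < l → 0 < k * l
*-pos = *-mono-< {x = 0} {u = 0}

ramseyNumber : ℕ → ℕ → ℕ
ramseyNumber zero    q       = 0
ramseyNumber (suc p) zero    = 0
ramseyNumber (suc p) (suc q) = suc (ramseyNumber p (suc q) + ramseyNumber (suc p) q)

m+n≤o+p⇒m≤o⊎n≤p : ∀ {m n o p} → m + n ≤ o + p → m ≤ o ⊎ n ≤ p
m+n≤o+p⇒m≤o⊎n≤p {m} {n} {o} {p} le with m ≤? o | n ≤? p
... | yes m≤o | _       = inj₁ m≤o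
... | no  _   | yes n≤p = inj₂ n≤p
... | no  m≰o | no n≰p  = contradiction le (<⇒≱ (+-mono-< (≰⇒> m≰o) (≰⇒> n≰p)))

module _ {R : A → A → Set} (R? : ∀ x y → Dec (R x y)) where

  -- The usual recursion on the first element, which splits the later ones into those related to it
  -- and those not. `R` need not be symmetric: pairs are compared in list order only, which lets
  -- `sunflower` test the pattern `f i ≡ g j` with distinct `i` and `j`.
  ramsey : ∀ p q (xs : List A) → ramseyNumber p q ≤ length xs →
           (∃[ ys ] ys ⊑ xs × p ≤ length ys × AllPairs R ys) ⊎
           (∃[ ys ] ys ⊑ xs × q ≤ length ys × AllPairs (λ x y → ¬ R x y) ys)
  ramsey zero    q       xs       _  = inj₁ ([] , Sublist.minimum xs , z≤n , [])
  ramsey (suc p) zero    xs       _  = inj₂ ([] , Sublist.minimum xs , z≤n , [])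
  ramsey (suc p) (suc q) (x ∷ xs) (s≤s le)
    with m+n≤o+p⇒m≤o⊎n≤p (≤-trans le (≤-reflexive (sym (count-¬ (R? x) xs))))
  ... | inj₁ le₁ with ramsey p (suc q) (filter (R? x) xs) le₁
  ...   | inj₁ (ys , s , l , ap) = inj₁ (x ∷ ys , refl ∷ˢ Sublist.⊆-trans s (Sublist.filter-⊆ (R? x) xs) , s≤s l ,
            All.tabulate (λ i → proj₂ (∈-filter⁻ (R? x) {xs = xs} (⊑⇒⊆ s i))) ∷ ap)
  ...   | inj₂ (ys , s , l , ap) = inj₂ (ys , x ∷ʳˢ Sublist.⊆-trans s (Sublist.filter-⊆ (R? x) xs) , l , ap)
  ramsey (suc p) (suc q) (x ∷ xs) (s≤s le)
      | inj₂ le₂ with ramsey (suc p) q (filter (¬? ∘ R? x) xs) le₂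
  ...   | inj₁ (ys , s , l , ap) = inj₁ (ys , x ∷ʳˢ Sublist.⊆-trans s (Sublist.filter-⊆ (¬? ∘ R? x) xs) , l , ap)
  ...   | inj₂ (ys , s , l , ap) = inj₂ (x ∷ ys , refl ∷ˢ Sublist.⊆-trans s (Sublist.filter-⊆ (¬? ∘ R? x) xs) , s≤s l ,
            All.tabulate (λ i → proj₂ (∈-filter⁻ (¬? ∘ R? x) {xs = xs} (⊑⇒⊆ s i))) ∷ ap)

-- Simultaneous Ramsey arguments and sunflowers of tuples

Homogeneous : (A → A → Set) → List A → Set
Homogeneous R xs = AllPairs R xs ⊎ AllPairs (λ x y → ¬ R x y) xs

Homogeneous-⊑ : {R : A → A → Set} {xs ys : List A} → xs ⊑ ys → Homogeneous R ys → Homogeneous R xs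
Homogeneous-⊑ s (inj₁ p) = inj₁ (AllPairs-⊑ s p)
Homogeneous-⊑ s (inj₂ p) = inj₂ (AllPairs-⊑ s p)

familyRamseyNumber : List B → ℕ → ℕ
familyRamseyNumber []       k = k
familyRamseyNumber (_ ∷ is) k = ramseyNumber (familyRamseyNumber is k) (familyRamseyNumber is k)

-- The relations are treated one after another, since homogeneity for an earlier one survives in
-- every sublist.
familyRamsey : {R : B → A → A → Set} (R? : ∀ i x y → Dec (R i x y)) (is : List B) (k : ℕ) (xs : List A) →
               familyRamseyNumber is k ≤ length xs →
               ∃[ ys ] ys ⊑ xs × k ≤ length ys × All (λ i → Homogeneous (R i) ys) is
familyRamsey R? []       k xs le = xs , Sublist.⊆-refl , le , []
familyRamsey {R = R} R? (i ∷ is) k xs le = [ (λ (ys , s , l , h) → go s l (inj₁ h)) , (λ (ys , s , l , h) → go s l (inj₂ h)) ]′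
  (ramsey (R? i) (familyRamseyNumber is k) (familyRamseyNumber is k) xs le)
  where
  go : ∀ {ys} → ys ⊑ xs → familyRamseyNumber is k ≤ length ys → Homogeneous (R i) ys →
       ∃[ ys ] ys ⊑ xs × k ≤ length ys × All (λ i → Homogeneous (R i) ys) (i ∷ is)
  go {ys} s l h with familyRamsey R? is k ys l
  ... | zs , s′ , l′ , hs = zs , Sublist.⊆-trans s′ s , l′ , Homogeneous-⊑ s′ h ∷ hs

-- The sets are given as tuples, so the kernel is recorded by the coordinates that are constant;
-- `disjoint` says that two tuples share nothing else, not even at different coordinates.
record Sunflower {k : ℕ} (fs : List (Fin k → A)) : Set where
  field
    const       : Fin k → Bool
    const-equal : AllPairs (λ f g → ∀ i → const i ≡ true → f i ≡ g i) fs
    disjoint    : AllPairs (λ f g → ∀ i j → f i ≡ g j → i ≡ j × const i ≡ true) fs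

pairs : ∀ k → List (Fin k × Fin k)
pairs k = Data.List.Base.cartesianProduct (allFin k) (allFin k)
  where import Data.List.Base

abstract
  sunflowerNumber : ℕ → ℕ → ℕ
  -- The additional 3 provides three tuples to compare even when `p` is small.
  sunflowerNumber k p = familyRamseyNumber (pairs k) (3 + p)

  sunflowerNumber-unfold : ∀ k p → familyRamseyNumber (pairs k) (3 + p) ≤ sunflowerNumber k p
  sunflowerNumber-unfold k p = ≤-refl

AllPairs-All : {I : Set} {R : I → A → A → Set} {xs : List A} → (∀ i → AllPairs (R i) xs) →
               AllPairs (λ x y → ∀ i → R i x y) xs
AllPairs-All {xs = []}     _ = []
AllPairs-All {xs = x ∷ xs} h = All.tabulate (λ y∈ i → All.lookup (AllPairs.head (h i)) y∈) ∷ AllPairs-All (AllPairs.tail ∘ h)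

-- If the pattern f i ≡ g j holds throughout, then comparing three tuples
-- shows that i = j.
sunflower : DecidableEquality A → ∀ {k} p (fs : List (Fin k → A)) →
            All (λ f → ∀ {i j} → f i ≡ f j → i ≡ j) fs → sunflowerNumber k p ≤ length fs →
            ∃[ gs ] gs ⊑ fs × p ≤ length gs × Sunflower gs
sunflower {A} _≟_ {k} p fs inj le
  with familyRamsey {R = λ (i , j) f g → f i ≡ g j} (λ (i , j) f g → f i ≟ g j) (pairs k) (3 + p) fs (≤-trans (sunflowerNumber-unfold k p) le)
... | gs , s , l , homs = gs , s , ≤-trans (m≤n+m p 3) l , record
  { const       = const
  ; const-equal = AllPairs-All const-equal
  ; disjoint    = AllPairs-All (λ i → AllPairs-All (disjoint i))
  }
  where
  open import Data.List.Membership.Propositional.Properties using (∈-cartesianProduct⁺)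
  Pattern : Fin k → Fin k → (Fin k → A) → (Fin k → A) → Set
  Pattern i j f g = f i ≡ g j
  hom : ∀ i j → Homogeneous (Pattern i j) gs
  hom i j = All.lookup homs (∈-cartesianProduct⁺ (∈-allFin i) (∈-allFin j))
  const : Fin k → Bool
  const i = [ (λ _ → true) , (λ _ → false) ]′ (hom i i)
  const-equal : ∀ i → AllPairs (λ f g → const i ≡ true → f i ≡ g i) gs
  const-equal i with hom i i
  ... | inj₁ h = AllPairs.map (λ e _ → e) h
  ... | inj₂ h = AllPairs.map (λ _ ()) h
  three : ∀ {i j} (hs : List (Fin k → A)) → 3 ≤ length hs → All (λ f → ∀ {i j} → f i ≡ f j → i ≡ j) hs →
          AllPairs (Pattern i j) hs → i ≡ j
  -- Here `g i ≡ h j ≡ f i ≡ g j`, and `g` is injective.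
  three (f ∷ g ∷ h ∷ _) _ (_ ∷ gi ∷ _) ((fg ∷ fh ∷ _) ∷ (gh ∷ _) ∷ _) = gi (trans gh (trans (sym fh) fg))
  three (_ ∷ _ ∷ []) (s≤s (s≤s ()))
  three (_ ∷ []) (s≤s ())
  disjoint : ∀ i j → AllPairs (λ f g → f i ≡ g j → i ≡ j × const i ≡ true) gs
  disjoint i j with hom i j in eq
  ... | inj₂ h = AllPairs.map (λ ¬e e → contradiction e ¬e) h
  ... | inj₁ h with refl ← three gs (≤-trans (m≤m+n 3 p) l) (Sublist.All-resp-⊆ s inj) h
    = AllPairs.map (λ _ _ → refl , cong [ (λ _ → true) , (λ _ → false) ]′ eq) h

private
  variable
    k m n r : ℕ
    I V : Set

-- Finite subsets as lists

elements : Subset n → List (Fin n)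
elements []            = []
elements (inside  ∷ p) = zero ∷ map suc (elements p)
elements (outside ∷ p) = map suc (elements p)

length-elements : (p : Subset n) → length (elements p) ≡ ∣ p ∣
length-elements []            = refl
length-elements (inside  ∷ p) = cong suc (trans (length-map suc (elements p)) (length-elements p))
length-elements (outside ∷ p) = trans (length-map suc (elements p)) (length-elements p)

∈-elements⁺ : {p : Subset n} {x : Fin n} → x ∈ₛ p → x ∈ elements p
∈-elements⁺ Vec.here = here refl
∈-elements⁺ {p = inside  ∷ p} (Vec.there x∈) = there (∈-map⁺ suc (∈-elements⁺ x∈))
∈-elements⁺ {p = outside ∷ p} (Vec.there x∈) = ∈-map⁺ suc (∈-elements⁺ x∈)

∈-elements⁻ : (p : Subset n) {x : Fin n} → x ∈ elements p → x ∈ₛ p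
∈-elements⁻ (inside  ∷ p) (here refl) = Vec.here
∈-elements⁻ (inside  ∷ p) (there x∈) with _ , y∈ , refl ← ∈-map⁻ suc x∈ = Vec.there (∈-elements⁻ p y∈)
∈-elements⁻ (outside ∷ p) x∈ with _ , y∈ , refl ← ∈-map⁻ suc x∈ = Vec.there (∈-elements⁻ p y∈)

elements-Unique : (p : Subset n) → Unique (elements p)
elements-Unique []            = []
elements-Unique (inside  ∷ p) =
  All.tabulate (λ y∈ eq → case ∈-map⁻ suc y∈ of λ { (_ , _ , refl) → case eq of λ () })
  ∷ Unique.map⁺ (λ { refl → refl }) (elements-Unique p)
elements-Unique (outside ∷ p) = Unique.map⁺ (λ { refl → refl }) (elements-Unique p)

fromList : List (Fin n) → Subset n
fromList []       = ∅
fromList (x ∷ xs) = ⁅ x ⁆ ∪ fromList xs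

∈-fromList⁺ : {x : Fin n} {xs : List (Fin n)} → x ∈ xs → x ∈ₛ fromList xs
∈-fromList⁺ {x = x} (here refl) = x∈p∪q⁺ (inj₁ (x∈⁅x⁆ x))
∈-fromList⁺ (there x∈)          = x∈p∪q⁺ (inj₂ (∈-fromList⁺ x∈))

∈-fromList⁻ : {x : Fin n} (xs : List (Fin n)) → x ∈ₛ fromList xs → x ∈ xs
∈-fromList⁻ []       x∈ = contradiction x∈ ∉⊥
∈-fromList⁻ (y ∷ ys) x∈ with x∈p∪q⁻ ⁅ y ⁆ (fromList ys) x∈
... | inj₁ p = here (x∈⁅y⁆⇒x≡y y p)
... | inj₂ p = there (∈-fromList⁻ ys p)

∣fromList∣ : {xs : List (Fin n)} → Unique xs → ∣ fromList xs ∣ ≡ length xs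
∣fromList∣ {xs = xs} u = trans (sym (length-elements (fromList xs))) (≤-antisym
  (Unique-⊆-length (elements-Unique (fromList xs)) (∈-fromList⁻ xs ∘ ∈-elements⁻ (fromList xs)))
  (Unique-⊆-length u (∈-elements⁺ ∘ ∈-fromList⁺)))

pair : Fin n → Fin n → Subset n
pair x y = ⁅ x ⁆ ∪ ⁅ y ⁆

triple : Fin n → Fin n → Fin n → Subset n
triple x y z = ⁅ x ⁆ ∪ pair y z

pair-comm : (x y : Fin n) → pair x y ≡ pair y x
pair-comm x y = ∪-comm ⁅ x ⁆ ⁅ y ⁆

∈-pair⁻ : {x y z : Fin n} → z ∈ₛ pair x y → z ≡ x ⊎ z ≡ y
∈-pair⁻ {x = x} {y} z∈ with x∈p∪q⁻ ⁅ x ⁆ ⁅ y ⁆ z∈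
... | inj₁ p = inj₁ (x∈⁅y⁆⇒x≡y x p)
... | inj₂ p = inj₂ (x∈⁅y⁆⇒x≡y y p)

∈-pairˡ : (x y : Fin n) → x ∈ₛ pair x y
∈-pairˡ x y = x∈p∪q⁺ (inj₁ (x∈⁅x⁆ x))

∈-pairʳ : (x y : Fin n) → y ∈ₛ pair x y
∈-pairʳ x y = x∈p∪q⁺ (inj₂ (x∈⁅x⁆ y))

∈-triple⁻ : {x y z u : Fin n} → u ∈ₛ triple x y z → u ∈ x ∷ y ∷ z ∷ []
∈-triple⁻ {x = x} {y} {z} u∈ with x∈p∪q⁻ ⁅ x ⁆ (pair y z) u∈
... | inj₁ p = here (x∈⁅y⁆⇒x≡y x p)
... | inj₂ p with ∈-pair⁻ p
...   | inj₁ q = there (here q)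
...   | inj₂ q = there (there (here q))

∈-triple⁺ : {x y z u : Fin n} → u ∈ x ∷ y ∷ z ∷ [] → u ∈ₛ triple x y z
∈-triple⁺ {x = x} (here refl)                  = x∈p∪q⁺ (inj₁ (x∈⁅x⁆ x))
∈-triple⁺ {y = y} (there (here refl))          = x∈p∪q⁺ (inj₂ (∈-pairˡ y _))
∈-triple⁺ {z = z} (there (there (here refl)))  = x∈p∪q⁺ (inj₂ (∈-pairʳ _ z))

∣e∣≡3⇒triple : (e : Subset n) → ∣ e ∣ ≡ 3 → ∃[ x ] ∃[ y ] ∃[ z ] e ≡ triple x y z
∣e∣≡3⇒triple e eq = go (elements e) refl (trans (length-elements e) eq)
  where
  go : ∀ xs → elements e ≡ xs → length xs ≡ 3 → ∃[ x ] ∃[ y ] ∃[ z ] e ≡ triple x y z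
  go (x ∷ y ∷ z ∷ []) el _ = x , y , z , ⊆-antisym
    (λ u∈ → ∈-triple⁺ (subst (_ ∈_) el (∈-elements⁺ u∈)))
    (λ u∈ → ∈-elements⁻ e (subst (_ ∈_) (sym el) (∈-triple⁻ u∈)))

∣e∣≡2⇒pair : (e : Subset n) → ∣ e ∣ ≡ 2 → ∃[ x ] ∃[ y ] x ≢ y × e ≡ pair x y
∣e∣≡2⇒pair e eq = go (elements e) refl (trans (length-elements e) eq) (elements-Unique e)
  where
  go : ∀ xs → elements e ≡ xs → length xs ≡ 2 → Unique xs → ∃[ x ] ∃[ y ] x ≢ y × e ≡ pair x y
  go (x ∷ y ∷ []) el _ ((x≢y ∷ []) ∷ _) = x , y , x≢y , ⊆-antisym
    (λ u∈ → to (subst (_ ∈_) el (∈-elements⁺ u∈)))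
    (λ u∈ → ∈-elements⁻ e (subst (_ ∈_) (sym el) (from (∈-pair⁻ u∈))))
    where
    to : ∀ {u} → u ∈ x ∷ y ∷ [] → u ∈ₛ pair x y
    to (here refl)         = ∈-pairˡ x y
    to (there (here refl)) = ∈-pairʳ x y
    from : ∀ {u} → u ≡ x ⊎ u ≡ y → u ∈ x ∷ y ∷ []
    from (inj₁ refl) = here refl
    from (inj₂ refl) = there (here refl)

∣pair∣≡2⇒≢ : {x y : Fin n} → ∣ pair x y ∣ ≡ 2 → x ≢ y
∣pair∣≡2⇒≢ {x = x} eq refl = contradiction
  (Unique-⊆-length {ys = x ∷ []} (elements-Unique (pair x x))
    (λ u∈ → here ([ id , id ]′ (∈-pair⁻ (∈-elements⁻ (pair x x) u∈)))))
  (<⇒≱ (≤-reflexive (sym (trans (length-elements (pair x x)) eq))))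

transversal-edge : (S e : Subset n) → ∣ e ∣ ≡ 2 → ∣ S ∩ e ∣ ≡ 1 →
                   ∃[ p ] ∃[ x ] p ∈ₛ S × x ∉ₛ S × e ≡ pair p x
transversal-edge S e e≡2 eq with ∣e∣≡2⇒pair e e≡2
... | x , y , x≢y , refl with x ∈ₛ? S | y ∈ₛ? S
...   | yes x∈ | no y∉  = x , y , x∈ , y∉ , refl
...   | no x∉  | yes y∈ = y , x , y∈ , x∉ , pair-comm x y
...   | yes x∈ | yes y∈ = contradiction (Unique-⊆-length {xs = x ∷ y ∷ []} ((x≢y ∷ []) ∷ [] ∷ []) (∈-elements⁺ ∘ sub))
                            (<⇒≱ (s≤s (≤-reflexive (trans (length-elements (S ∩ pair x y)) eq))))
  where
  sub : ∀ {u} → u ∈ x ∷ y ∷ [] → u ∈ₛ S ∩ pair x y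
  sub (here refl)         = x∈p∩q⁺ (x∈ , ∈-pairˡ x y)
  sub (there (here refl)) = x∈p∩q⁺ (y∈ , ∈-pairʳ x y)
...   | no x∉  | no y∉  = contradiction (Unique-⊆-length {ys = []} (elements-Unique (S ∩ pair x y)) (⊥-elim ∘ sub ∘ ∈-elements⁻ (S ∩ pair x y)))
                            (<⇒≱ (≤-reflexive (sym (trans (length-elements (S ∩ pair x y)) eq))))
  where
  sub : ∀ {u} → u ∈ₛ S ∩ pair x y → ⊥
  sub u∈ with x∈p∩q⁻ S (pair x y) u∈
  ... | u∈S , u∈e with ∈-pair⁻ u∈e
  ...   | inj₁ refl = x∉ u∈S
  ...   | inj₂ refl = y∉ u∈S

_≟ₛ_ : DecidableEquality (Subset n)
_≟ₛ_ = Vec.≡-dec Bool._≟_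

-- Edges as triples and copies of an expansion

module _ (H : 3-Graph n) where

  Edge : Fin n → Fin n → Fin n → Set
  Edge x y z = triple x y z ∈ edges H

  Edge? : ∀ x y z → Dec (Edge x y z)
  Edge? x y z = triple x y z ∈ˡ? edges H
    where open import Data.List.Membership.DecPropositional _≟ₛ_ using () renaming (_∈?_ to _∈ˡ?_)

module _ {H : 3-Graph n} where

  Edge-swapˡ : ∀ {x y z} → Edge H x y z → Edge H y x z
  Edge-swapˡ {x} {y} {z} = subst (_∈ edges H) (trans (sym (∪-assoc ⁅ x ⁆ ⁅ y ⁆ ⁅ z ⁆))
    (trans (cong (_∪ ⁅ z ⁆) (pair-comm x y)) (∪-assoc ⁅ y ⁆ ⁅ x ⁆ ⁅ z ⁆)))

  Edge-swapʳ : ∀ {x y z} → Edge H x y z → Edge H x z y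
  Edge-swapʳ {x} {y} {z} = subst (λ p → (⁅ x ⁆ ∪ p) ∈ edges H) (pair-comm y z)

  Edge-≢ : ∀ {x y z} → Edge H x y z → x ≢ y
  Edge-≢ {x} {_} {z} e refl = contradiction
    (Unique-⊆-length {ys = x ∷ z ∷ []} (elements-Unique (triple x x z)) (sub ∘ ∈-triple⁻ ∘ ∈-elements⁻ (triple x x z)))
    (<⇒≱ (≤-reflexive (sym (trans (length-elements (triple x x z)) (All.lookup (edges-uniform H) e)))))
    where
    sub : ∀ {u} → u ∈ x ∷ x ∷ z ∷ [] → u ∈ x ∷ z ∷ []
    sub (here refl) = here refl
    sub (there p)   = p

∈-image⁺ : (f : Fin m → Fin n) {p : Subset m} {x : Fin m} → x ∈ₛ p → f x ∈ₛ image f p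
∈-image⁺ {m = m} f {p} {x} x∈ = Vec.lookup⇒[]= (f x) _ (trans (Vec.lookup∘tabulate _ (f x))
  (Dec.dec-true (Data.Fin.Properties.any? (λ z → (z ∈ₛ? p) ×-dec (f z ≟ f x))) (x , x∈ , refl)))
  where import Data.Fin.Properties

∈-image⁻ : (f : Fin m → Fin n) {p : Subset m} {y : Fin n} → y ∈ₛ image f p → ∃[ x ] x ∈ₛ p × f x ≡ y
∈-image⁻ f {p} {y} y∈ = go (Data.Fin.Properties.any? (λ z → (z ∈ₛ? p) ×-dec (f z ≟ y)))
  (trans (sym (Vec.lookup∘tabulate _ y)) (Vec.[]=⇒lookup y∈))
  where
  import Data.Fin.Properties
  go : {P : Set} (d : Dec P) → does d ≡ true → P
  go (yes p) _ = p

module _ {T : Graph m} {H : 3-Graph n} where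

  -- The concatenated vertex set of `expansion T` is unfolded only here; every copy is produced from
  -- a map of the vertices and a map of the edges with disjoint images.
  contains-expansion : (f : Fin m → Fin n) (w : Fin (size T) → Fin n) →
    (∀ {u v} → f u ≡ f v → u ≡ v) → (∀ {d e} → w d ≡ w e → d ≡ e) → (∀ u e → f u ≢ w e) →
    (∀ e → ∃[ u ] ∃[ v ] lookup (edges T) e ≡ pair u v × Edge H (f u) (f v) (w e)) →
    Contains H (expansion T)
  contains-expansion f w f-inj w-inj f≢w edge = g , g-inj , g-edge
    where
    g : Fin (m + size T) → Fin n
    g = [ f , w ]′ ∘ Fin.splitAt m
    open import Data.Fin.Properties using (splitAt-↑ˡ; splitAt-↑ʳ; splitAt⁻¹-↑ˡ; splitAt⁻¹-↑ʳ)
    g-inj : ∀ {i j} → g i ≡ g j → i ≡ j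
    g-inj {i} {j} eq with Fin.splitAt m i in p | Fin.splitAt m j in q
    ... | inj₁ a | inj₁ b = trans (sym (splitAt⁻¹-↑ˡ p)) (trans (cong (Fin._↑ˡ size T) (f-inj eq)) (splitAt⁻¹-↑ˡ q))
    ... | inj₁ a | inj₂ b = contradiction eq (f≢w a b)
    ... | inj₂ a | inj₁ b = contradiction (sym eq) (f≢w b a)
    ... | inj₂ a | inj₂ b = trans (sym (splitAt⁻¹-↑ʳ p)) (trans (cong (m Fin.↑ʳ_) (w-inj eq)) (splitAt⁻¹-↑ʳ q))
    g-edge : ∀ {e} → e ∈ edges (expansion T) → image g e ∈ edges H
    g-edge e∈ with i , refl ← ∈-tabulate⁻ e∈ with edge i
    ... | u , v , eq , h = subst (_∈ edges H) (⊆-antisym to from) h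
      where
      E = lookup (edges T) i
      old : ∀ {z} → z ∈ₛ E → f z ∈ₛ image g (E Vec.++ ⁅ i ⁆)
      old {z} z∈ = subst (_∈ₛ image g (E Vec.++ ⁅ i ⁆)) (cong [ f , w ]′ (splitAt-↑ˡ m z (size T)))
        (∈-image⁺ g (Vec.lookup⇒[]= _ _ (trans (Vec.lookup-++ˡ E ⁅ i ⁆ z) (Vec.[]=⇒lookup z∈))))
      new : w i ∈ₛ image g (E Vec.++ ⁅ i ⁆)
      new = subst (_∈ₛ image g (E Vec.++ ⁅ i ⁆)) (cong [ f , w ]′ (splitAt-↑ʳ m (size T) i))
        (∈-image⁺ g (Vec.lookup⇒[]= _ _ (trans (Vec.lookup-++ʳ E ⁅ i ⁆ i) (Vec.[]=⇒lookup (x∈⁅x⁆ i)))))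
      to′ : ∀ {y} → y ∈ f u ∷ f v ∷ w i ∷ [] → y ∈ₛ image g (E Vec.++ ⁅ i ⁆)
      to′ (here refl)                 = old (subst (u ∈ₛ_) (sym eq) (∈-pairˡ u v))
      to′ (there (here refl))         = old (subst (v ∈ₛ_) (sym eq) (∈-pairʳ u v))
      to′ (there (there (here refl))) = new
      to : ∀ {y} → y ∈ₛ triple (f u) (f v) (w i) → y ∈ₛ image g (E Vec.++ ⁅ i ⁆)
      to y∈ = to′ (∈-triple⁻ y∈)
      from : ∀ {y} → y ∈ₛ image g (E Vec.++ ⁅ i ⁆) → y ∈ₛ triple (f u) (f v) (w i)
      from y∈ with ∈-image⁻ g y∈
      ... | z , z∈ , refl with Fin.splitAt m z in p
      ...   | inj₁ a with refl ← splitAt⁻¹-↑ˡ p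
                with ∈-pair⁻ (subst (a ∈ₛ_) eq (Vec.lookup⇒[]= a E (trans (sym (Vec.lookup-++ˡ E ⁅ i ⁆ a)) (Vec.[]=⇒lookup z∈))))
      ...     | inj₁ refl = ∈-triple⁺ (here refl)
      ...     | inj₂ refl = ∈-triple⁺ (there (here refl))
      from y∈ | z , z∈ , refl | inj₂ b with refl ← splitAt⁻¹-↑ʳ p
        with refl ← x∈⁅y⁆⇒x≡y i (Vec.lookup⇒[]= b ⁅ i ⁆ (trans (sym (Vec.lookup-++ʳ E ⁅ i ⁆ b)) (Vec.[]=⇒lookup z∈)))
        = ∈-triple⁺ (there (there (here refl)))

-- Greedy choice of distinct vertices

-- A partial injection is a total function together with the list of arguments at which its values
-- count.
InjectiveOn : (I → V) → List I → Set
InjectiveOn f ks = ∀ {i j} → i ∈ ks → j ∈ ks → f i ≡ f j → i ≡ j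

module _ (_≟ᴵ_ : DecidableEquality I) where

  extend : (f : I → V) {ks : List I} → InjectiveOn f ks → ∀ k (y : V) → k ∉ ks → y ∉ map f ks →
           ∃[ g ] g k ≡ y × (∀ {i} → i ∈ ks → g i ≡ f i) × InjectiveOn g (k ∷ ks)
  extend {V} f {ks} inj k y k∉ y∉ = g , g-new , g-old , g-inj
    where
    pick : ∀ i → Dec (i ≡ k) → V
    pick i (yes _) = y
    pick i (no _)  = f i
    g : I → V
    g i = pick i (i ≟ᴵ k)
    g-new : g k ≡ y
    g-new with k ≟ᴵ k
    ... | yes _ = refl
    ... | no ¬p = contradiction refl ¬p
    g-old : ∀ {i} → i ∈ ks → g i ≡ f i
    g-old {i} i∈ with i ≟ᴵ k
    ... | yes refl = contradiction i∈ k∉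
    ... | no _     = refl
    g-inj : InjectiveOn g (k ∷ ks)
    g-inj (here refl) (here refl) _  = refl
    g-inj (here refl) (there j∈)  eq = contradiction (subst (_∈ map f ks) (trans (sym (g-old j∈)) (trans (sym eq) g-new)) (∈-map⁺ f j∈)) y∉
    g-inj (there i∈)  (here refl) eq = contradiction (subst (_∈ map f ks) (trans (sym (g-old i∈)) (trans eq g-new)) (∈-map⁺ f i∈)) y∉
    g-inj (there i∈)  (there j∈)  eq = inj i∈ j∈ (trans (sym (g-old i∈)) (trans eq (g-old j∈)))

Unique-Fin-length : {ks : List (Fin k)} → Unique ks → length ks ≤ k
Unique-Fin-length {k} {ks} u = ≤-trans (Unique-⊆-length u (λ {x} _ → ∈-allFin x)) (≤-reflexive (length-tabulate id))

∉⇒Unique-∷ : {k : I} {ks : List I} → k ∉ ks → Unique ks → Unique (k ∷ ks)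
∉⇒Unique-∷ {k = k} k∉ u = All.tabulate (λ {j} j∈ eq → k∉ (subst (_∈ _) (sym eq) j∈)) ∷ u

-- Greedy choice of representatives: when `i` is treated, the forbidden values are `us` and those
-- chosen for fewer than `k` other indices, so `length us + k` candidates are enough. The values of
-- `w` on `ks` are prescribed in advance.
complete : (us : List (Fin n)) (cand : Fin k → List (Fin n)) →
  ∀ is (w : Fin k → Fin n) (ks : List (Fin k)) → Unique ks → InjectiveOn w ks → (∀ {i} → i ∈ ks → w i ∉ us) →
  (∀ i → i ∉ ks → Unique (cand i) × length us + k ≤ length (cand i)) →
  ∃[ v ] ∃[ ls ] Unique ls × is ⊆ ls × ks ⊆ ls × InjectiveOn v ls × (∀ {i} → i ∈ ls → v i ∉ us) ×
    (∀ {i} → i ∈ ks → v i ≡ w i) × (∀ {i} → i ∈ ls → i ∉ ks → v i ∈ cand i)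
complete us cand []       w ks uks inj out c = w , ks , uks , (λ ()) , id , inj , out , (λ _ → refl) , contradiction
complete us cand (i ∷ is) w ks uks inj out c
  with complete us cand is w ks uks inj out c
... | v , ls , uls , is⊆ , ks⊆ , inj′ , out′ , same , new with any? (i ≟_) ls
...   | yes i∈ = v , ls , uls , (λ { (here refl) → i∈ ; (there p) → is⊆ p }) , ks⊆ , inj′ , out′ , same , new
...   | no i∉ with c i (i∉ ∘ ks⊆)
...     | ucand , le with fresh _≟_ (us ++ map v ls) ucand (≤-trans (≤-trans (≤-reflexive len)
                            (+-monoʳ-≤ (length us) (Unique-Fin-length (∉⇒Unique-∷ i∉ uls)))) le)
  where
  len : suc (length (us ++ map v ls)) ≡ length us + suc (length ls)
  len = trans (cong suc (trans (length-++ us) (cong (length us +_) (length-map v ls)))) (sym (+-suc (length us) (length ls)))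
...       | y , y∈ , y∉ with extend _≟_ v inj′ i y i∉ (y∉ ∘ ∈-++⁺ʳ us)
...         | v′ , eq , old , inj″ = v′ , i ∷ ls , ∉⇒Unique-∷ i∉ uls ,
  (λ { (here refl) → here refl ; (there p) → there (is⊆ p) }) , there ∘ ks⊆ , inj″ ,
  (λ { (here refl) → subst (_∉ us) (sym eq) (y∉ ∘ ∈-++⁺ˡ) ; (there p) → subst (_∉ us) (sym (old p)) (out′ p) }) ,
  (λ p → trans (old (ks⊆ p)) (same p)) ,
  (λ { (here refl) _ → subst (_∈ cand _) (sym eq) y∈ ; (there p) q → subst (_∈ cand _) (sym (old p)) (new p q) })

-- Growing a tree one edge at a time

module _ {m : ℕ} (T : Graph m) where

  Item : Set
  Item = Fin m ⊎ Fin (size T)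

  -- The vertices and edges of a subtree, newest first. Each step attaches a leaf, so induction on
  -- `Grown` is the induction over trees that the embedding needs.
  data Grown : List Item → Set where
    root : ∀ r → Grown (inj₁ r ∷ [])
    grow : ∀ {ks u v e} → Grown ks → inj₁ u ∈ ks → inj₁ v ∉ ks → inj₂ e ∉ ks →
           lookup (edges T) e ≡ pair u v → Grown (inj₂ e ∷ inj₁ v ∷ ks)

  edge-index : ∀ {u v} → Adjacent T u v → ∃[ e ] lookup (edges T) e ≡ pair u v
  edge-index a = Any.index a , sym (Data.List.Relation.Unary.Any.Properties.lookup-index a)
    where import Data.List.Relation.Unary.Any.Properties

  lookup-edges-injective : ∀ {d e} → lookup (edges T) d ≡ lookup (edges T) e → d ≡ e
  lookup-edges-injective = lookup-injective (edges-unique T) _ _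

  lookup-adjacent : ∀ {e u v} → lookup (edges T) e ≡ pair u v → Adjacent T u v
  lookup-adjacent {e} eq = subst (_∈ edges T) eq (∈-lookup e)

  Adjacent-sym : ∀ {u v} → Adjacent T u v → Adjacent T v u
  Adjacent-sym {u} {v} = subst (_∈ edges T) (pair-comm u v)

  Adjacent-≢ : ∀ {u v} → Adjacent T u v → u ≢ v
  Adjacent-≢ a = ∣pair∣≡2⇒≢ (All.lookup (edges-uniform T) a)

  Grown-endpoint : ∀ {ks} → Grown ks → ∀ {e u} → inj₂ e ∈ ks → u ∈ₛ lookup (edges T) e → inj₁ u ∈ ks
  Grown-endpoint (root r) (here ())
  Grown-endpoint (grow {u = a} {v = b} g a∈ _ _ eq) (here refl) u∈ with ∈-pair⁻ (subst (_ ∈ₛ_) eq u∈)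
  ... | inj₁ refl = there (there a∈)
  ... | inj₂ refl = there (here refl)
  Grown-endpoint (grow g _ _ _ _) (there (there e∈)) u∈ = there (there (Grown-endpoint g e∈ u∈))

  Grown-Unique : ∀ {ks} → Grown ks → Unique ks
  Grown-Unique (root r) = [] ∷ []
  Grown-Unique (grow g _ v∉ e∉ _) = ∉⇒Unique-∷ (λ { (there p) → e∉ p }) (∉⇒Unique-∷ v∉ (Grown-Unique g))

  Grown-snoc : ∀ {ks u v} → Grown ks → inj₁ u ∈ ks → inj₁ v ∉ ks → Adjacent T u v →
               ∃[ ls ] Grown ls × ks ⊆ ls × inj₁ v ∈ ls
  Grown-snoc {u = u} {v} g u∈ v∉ a with edge-index a
  ... | e , eq = _ , grow g u∈ v∉ (λ e∈ → v∉ (Grown-endpoint g e∈ (subst (v ∈ₛ_) (sym eq) (∈-pairʳ u v)))) eq ,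
    there ∘ there , there (here refl)

  item? : (i : Item) (ks : List Item) → Dec (i ∈ ks)
  item? i ks = any? (⊎-≡-dec _≟_ _≟_ i) ks

  Grown-reach : ∀ {ks u v} → Grown ks → inj₁ u ∈ ks → Star (Adjacent T) u v →
                ∃[ ls ] Grown ls × ks ⊆ ls × inj₁ v ∈ ls
  Grown-reach g u∈ stop = _ , g , id , u∈
  Grown-reach {ks} g u∈ (_◅_ {j = w} a as) with item? (inj₁ w) ks
  ... | yes w∈ = Grown-reach g w∈ as
  ... | no w∉ with Grown-snoc g u∈ w∉ a
  ...   | ls , g′ , sub , w∈ with Grown-reach g′ w∈ as
  ...     | ls′ , g″ , sub′ , v∈ = ls′ , g″ , sub′ ∘ sub , v∈

  -- That vs ends at v is encoded by its effect: the path prolongs every walk from v.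
  Path : List Item → Fin m → Fin m → Set
  Path ks u v = ∃[ vs ] Unique (u ∷ vs) × (∀ {x} → x ∈ u ∷ vs → inj₁ x ∈ ks) × (u ≡ v ⊎ 1 ≤ length vs) ×
                        (∀ zs → Linked (Adjacent T) (v ∷ zs) → Linked (Adjacent T) (u ∷ vs ++ zs))

  Grown-path : ∀ {ks} → Grown ks → ∀ {u v} → inj₁ u ∈ ks → inj₁ v ∈ ks → Path ks u v
  Grown-path (root r) (here refl) (here refl) = [] , [] ∷ [] , (λ { (here refl) → here refl }) , inj₁ refl , λ _ → id
  Grown-path (root r) (there ())
  Grown-path (root r) (here _) (there ())
  Grown-path (grow g a∈ b∉ _ eq) (there (here refl)) (there (here refl)) =
    [] , [] ∷ [] , (λ { (here refl) → there (here refl) }) , inj₁ refl , λ _ → id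
  Grown-path (grow {u = a} g a∈ b∉ _ eq) (there (here refl)) (there (there v∈)) with Grown-path g a∈ v∈
  ... | vs , u , sub , _ , link = a ∷ vs , ∉⇒Unique-∷ (λ p → b∉ (sub p)) u ,
    (λ { (here refl) → there (here refl) ; (there p) → there (there (sub p)) }) , inj₂ (s≤s z≤n) ,
    λ zs l → Adjacent-sym (lookup-adjacent eq) ∷ link zs l
  Grown-path (grow {u = a} {v = b} g a∈ b∉ _ eq) {u} (there (there u∈)) (there (here refl)) with Grown-path g u∈ a∈
  ... | vs , uq , sub , _ , link = vs ++ b ∷ [] ,
    Unique.++⁺ uq ([] ∷ []) (λ { (p , here refl) → b∉ (sub p) }) , sub′ , inj₂ (≤-trans (m≤n+m 1 (length vs)) (≤-reflexive (sym (length-++ vs)))) ,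
    λ zs l → subst (λ ws → Linked (Adjacent T) (u ∷ ws)) (sym (Data.List.Properties.++-assoc vs (b ∷ []) zs)) (link (b ∷ zs) (lookup-adjacent eq ∷ l))
    where
    import Data.List.Properties
    sub′ : ∀ {x} → x ∈ u ∷ vs ++ b ∷ [] → inj₁ x ∈ _
    sub′ p with ∈-++⁻ (u ∷ vs) p
    ... | inj₁ q           = there (there (sub q))
    ... | inj₂ (here refl) = there (here refl)
  Grown-path (grow g _ _ _ _) (there (there u∈)) (there (there v∈)) with Grown-path g u∈ v∈
  ... | vs , uq , sub , ne , link = vs , uq , there ∘ there ∘ sub , ne , link

  module _ (tree : IsTree T) where

    open IsTree tree

    -- Otherwise the edge would close a cycle: if it joins the newest leaf, attached at `a`, to some
    -- `u ≢ a`, then the path from `a` to `u` among the older vertices completes it.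
    Grown-closed : ∀ {ks} → Grown ks → ∀ {e u v} → lookup (edges T) e ≡ pair u v →
                   inj₁ u ∈ ks → inj₁ v ∈ ks → inj₂ e ∈ ks
    Grown-closed (root r) eq (here refl) (here refl) = contradiction refl (Adjacent-≢ (lookup-adjacent eq))
    Grown-closed (grow g a∈ b∉ e∉ eq₀) eq (there (here refl)) (there (here refl)) = contradiction refl (Adjacent-≢ (lookup-adjacent eq))
    Grown-closed (grow g a∈ b∉ e∉ eq₀) eq (there (there u∈)) (there (there v∈)) = there (there (Grown-closed g eq u∈ v∈))
    Grown-closed (grow {ks} {a} {b} {d} g a∈ b∉ e∉ eq₀) {e} {u} eq (there (there u∈)) (there (here refl)) with a ≟ u
    ... | yes refl = here (cong inj₂ (lookup-edges-injective (trans eq (sym eq₀))))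
    ... | no a≢u with Grown-path g a∈ u∈
    ...   | vs , uq , sub , inj₁ a≡u , link = contradiction a≡u a≢u
    -- As `a ≢ u`, the path has a further vertex, so with `a` there are the two vertices besides `b`
    -- that a cycle requires.
    ...   | vs , uq , sub , inj₂ ne , link = contradiction
      (s≤s ne , ∉⇒Unique-∷ (λ p → b∉ (sub p)) uq ,
       Adjacent-sym (lookup-adjacent eq₀) ∷ link (b ∷ []) (lookup-adjacent eq ∷ [-]))
      (acyclic b (a ∷ vs))
    Grown-closed (grow {ks} {a} {b} {d} g a∈ b∉ e∉ eq₀) {e} {v = v} eq (there (here refl)) (there (there v∈)) =
      Grown-closed (grow g a∈ b∉ e∉ eq₀) (trans eq (pair-comm b v)) (there (there v∈)) (there (here refl))

    Grown-vertices : Fin m → ∀ us → ∃[ ks ] Grown ks × (∃[ r ] inj₁ r ∈ ks) × (∀ {u} → u ∈ us → inj₁ u ∈ ks)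
    Grown-vertices r []       = _ , root r , (r , here refl) , λ ()
    Grown-vertices r (u ∷ us) with Grown-vertices r us
    ... | ks , g , (s , s∈) , all with Grown-reach g s∈ (connected s u)
    ...   | ls , g′ , sub , u∈ = ls , g′ , (s , sub s∈) , λ { (here refl) → u∈ ; (there p) → sub (all p) }

    -- Walks from a root reach every vertex; every edge is then present because a grown subtree is
    -- induced.
    tree-Grown : ∃[ ks ] Grown ks × (∀ i → i ∈ ks)
    tree-Grown with Grown-vertices (Fin.fromℕ< (>-nonZero⁻¹ m {{nonempty}})) (allFin m)
    ... | ks , g , _ , all = ks , g , λ where
      (inj₁ u) → all (∈-allFin u)
      (inj₂ e) → let u , v , _ , eq = ∣e∣≡2⇒pair (lookup (edges T) e) (All.lookup (edges-uniform T) (∈-lookup e))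
                 in Grown-closed g eq (all (∈-allFin u)) (all (∈-allFin v))

    -- Two common neighbours `x` and `y` would give the 4-cycle `p`, `x`, `q`, `y`.
    common-neighbour-unique : ∀ {p q x y} → p ≢ q → Adjacent T p x → Adjacent T q x →
                              Adjacent T p y → Adjacent T q y → x ≡ y
    common-neighbour-unique {p} {q} {x} {y} p≢q px qx py qy with x ≟ y
    ... | yes x≡y = x≡y
    ... | no x≢y = contradiction
      (s≤s (s≤s z≤n) ,
       (Adjacent-≢ px ∷ p≢q ∷ Adjacent-≢ py ∷ []) ∷ ((λ e → Adjacent-≢ qx (sym e)) ∷ x≢y ∷ []) ∷ (Adjacent-≢ qy ∷ []) ∷ [] ∷ [] ,
       px ∷ Adjacent-sym qx ∷ qy ∷ Adjacent-sym py ∷ [-])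
      (acyclic p (x ∷ q ∷ y ∷ []))

-- Matchings and covers of links

module _ {n : ℕ} (G : Fin n → Fin n → Set) where

  -- The two indices are the list of covered vertices, in which the edges are consecutive pairs, and
  -- the number of edges.
  data Matching (A : List (Fin n)) : List (Fin n) → ℕ → Set where
    []  : Matching A [] 0
    add : ∀ {us k y z} → Matching A us k → y ∈ A → z ∈ A → G y z → y ∉ us → z ∉ us → y ≢ z →
          Matching A (y ∷ z ∷ us) (suc k)

  Matching-length : ∀ {A us k} → Matching A us k → length us ≡ 2 * k
  Matching-length [] = refl
  Matching-length (add {us} {k} M _ _ _ _ _ _) = trans (cong (2 +_) (Matching-length M)) (sym (*-distribˡ-+ 2 1 k))

  Cover : List (Fin n) → List (Fin n) → Set
  Cover A C = ∀ {y z} → y ∈ A → z ∈ A → G y z → y ∈ C ⊎ z ∈ C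

  -- A vertex meets at most one edge of a matching.
  Matching-avoid : ∀ {A us k} → Matching A us k → ∀ (ws : List (Fin n)) → length ws < k →
                   ∃[ y ] ∃[ z ] y ∈ A × z ∈ A × G y z × y ≢ z × y ∉ ws × z ∉ ws
  Matching-avoid M₀ ws lt = [ id , (λ (hs , u , _ , b , l) → contradiction (Unique-⊆-length u b) (<⇒≱ (subst (length ws <_) (sym l) lt))) ]′ (search M₀)
    where
    _∈ws? : ∀ y → Dec (y ∈ ws)
    y ∈ws? = any? (y ≟_) ws
    search : ∀ {A us k} → Matching A us k → (∃[ y ] ∃[ z ] y ∈ A × z ∈ A × G y z × y ≢ z × y ∉ ws × z ∉ ws) ⊎
             (∃[ hs ] Unique hs × hs ⊆ us × hs ⊆ ws × length hs ≡ k)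
    search [] = inj₂ ([] , [] , (λ ()) , (λ ()) , refl)
    search (add {y = y} {z} M y∈ z∈ g y∉ z∉ y≢z) with search M | y ∈ws? | z ∈ws?
    ... | inj₁ r | _ | _ = inj₁ r
    ... | inj₂ _ | no y∉ws | no z∉ws = inj₁ (y , z , y∈ , z∈ , g , y≢z , y∉ws , z∉ws)
    ... | inj₂ (hs , u , a , b , l) | yes y∈ws | _ = inj₂ (y ∷ hs , ∉⇒Unique-∷ (λ p → y∉ (a p)) u ,
      (λ { (here refl) → here refl ; (there p) → there (there (a p)) }) , (λ { (here refl) → y∈ws ; (there p) → b p }) , cong suc l)
    ... | inj₂ (hs , u , a , b , l) | no _ | yes z∈ws = inj₂ (z ∷ hs , ∉⇒Unique-∷ (λ p → z∉ (a p)) u ,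
      (λ { (here refl) → there (here refl) ; (there p) → there (there (a p)) }) , (λ { (here refl) → z∈ws ; (there p) → b p }) , cong suc l)

  -- The vertices of a matching that cannot be enlarged meet every edge.
  matching-or-cover : (∀ y z → Dec (G y z)) → (∀ {y z} → G y z → y ≢ z) → ∀ (A : List (Fin n)) k →
    (∃[ us ] Matching A us k) ⊎ (∃[ C ] length C ≤ 2 * k × Cover A C)
  matching-or-cover G? G≢ A zero = inj₁ ([] , [])
  matching-or-cover G? G≢ A (suc k) with matching-or-cover G? G≢ A k
  ... | inj₂ (C , le , cov) = inj₂ (C , ≤-trans le (*-monoʳ-≤ 2 (n≤1+n k)) , cov)
  ... | inj₁ (us , M) with any? (λ y → any? (λ z → ¬? (any? (y ≟_) us) ×-dec ¬? (any? (z ≟_) us) ×-dec G? y z) A) A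
  ...   | yes p with y , y∈ , q ← find p with z , z∈ , y∉ , z∉ , g ← find q =
    inj₁ (_ , add M y∈ z∈ g y∉ z∉ (G≢ g))
  matching-or-cover G? G≢ A (suc k) | inj₁ (us , M) | no ¬p =
    inj₂ (us , ≤-trans (≤-reflexive (Matching-length M)) (*-monoʳ-≤ 2 (n≤1+n k)) , cov)
    where
    cov : Cover A us
    cov {y} {z} y∈ z∈ g with any? (y ≟_) us | any? (z ≟_) us
    ... | yes y∈us | _         = inj₁ y∈us
    ... | no _     | yes z∈us  = inj₂ z∈us
    ... | no y∉us  | no z∉us   = contradiction (lose y∈ (lose z∈ (y∉us , z∉us , g))) ¬p

Unique-Item-length : ∀ {m} {T : Graph m} {ks : List (Item T)} → Unique ks → length ks ≤ m + size T
Unique-Item-length {m} {T} {ks} uq = ≤-trans (Unique-⊆-length uq sub) (≤-reflexive (trans (length-++ (map inj₁ (allFin m)))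
  (cong₂ _+_ len₁ len₂)))
  where
  len₁ : length (map {B = Item T} inj₁ (allFin m)) ≡ m
  len₁ = trans (length-map inj₁ (allFin m)) (length-tabulate id)
  len₂ : length (map {B = Item T} inj₂ (allFin (size T))) ≡ size T
  len₂ = trans (length-map inj₂ (allFin (size T))) (length-tabulate id)
  sub : ks ⊆ map inj₁ (allFin m) ++ map inj₂ (allFin (size T))
  sub {inj₁ a} _ = ∈-++⁺ˡ (∈-map⁺ inj₁ (∈-allFin a))
  sub {inj₂ b} _ = ∈-++⁺ʳ _ (∈-map⁺ inj₂ (∈-allFin b))

-- Greedy embedding and the ordering with covered links

module _ {m n : ℕ} {T : Graph m} (tree : IsTree T) {H : 3-Graph n} (A : List (Fin n))
         (rich : ∀ {x} → x ∈ A → ∃[ us ] Matching (Edge H x) A us (suc (m + size T))) where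

  record Embedding (ks : List (Item T)) : Set where
    field
      f      : Item T → Fin n
      f-inj  : InjectiveOn f ks
      f∈A    : ∀ {u} → inj₁ u ∈ ks → f (inj₁ u) ∈ A
      f-edge : ∀ {e} → inj₂ e ∈ ks → ∃[ u ] ∃[ v ] lookup (edges T) e ≡ pair u v × inj₁ u ∈ ks × inj₁ v ∈ ks ×
               Edge H (f (inj₁ u)) (f (inj₁ v)) (f (inj₂ e))

  -- Of the matching edge found in the link of the image of `u`, one end becomes the image of the
  -- new vertex and lies in `A`, where it has a large matching of its own; the other end becomes the
  -- expansion vertex.
  embed : ∀ {r₀} → r₀ ∈ A → ∀ {ks} → Grown T ks → Embedding ks
  embed {r₀} r₀∈ (root r) = record
    { f = λ _ → r₀ ; f-inj = λ { (here refl) (here refl) _ → refl } ; f∈A = λ _ → r₀∈ ; f-edge = λ { (here ()) ; (there ()) } }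
  embed r₀∈ (grow {ks} {u} {v} {e} g u∈ v∉ e∉ eq) with embed r₀∈ g
  ... | φ with rich (Embedding.f∈A φ u∈)
  ...   | _ , M with Matching-avoid (Edge H _) M (map (Embedding.f φ) ks)
                       (s≤s (≤-trans (≤-reflexive (length-map (Embedding.f φ) ks)) (Unique-Item-length {T = T} (Grown-Unique T g))))
  ...     | y , z , y∈ , z∈ , edge , y≢z , y∉ , z∉
    with extend (⊎-≡-dec _≟_ _≟_) (Embedding.f φ) (Embedding.f-inj φ) (inj₁ v) y v∉ y∉
  ...       | f₁ , new₁ , old₁ , inj₁′
    with extend (⊎-≡-dec _≟_ _≟_) f₁ inj₁′ (inj₂ e) z (λ { (there p) → e∉ p }) z∉′
    where
    z∉′ : z ∉ map f₁ (inj₁ v ∷ ks)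
    z∉′ p with ∈-map⁻ f₁ p
    ... | _ , here refl , eq′ = y≢z (sym (trans eq′ new₁))
    ... | _ , there i∈  , eq′ = z∉ (subst (_∈ map (Embedding.f φ) ks) (sym (trans eq′ (old₁ i∈))) (∈-map⁺ (Embedding.f φ) i∈))
  ...         | f₂ , new₂ , old₂ , inj₂′ = record
    { f = f₂ ; f-inj = inj₂′
    ; f∈A = λ { (there (here refl)) → subst (_∈ A) (sym (trans (old₂ (here refl)) new₁)) y∈
              ; (there (there p)) → subst (_∈ A) (sym (old p)) (Embedding.f∈A φ p) }
    ; f-edge = λ where
        (here refl) → u , v , eq , there (there u∈) , there (here refl) ,
          edge′ (sym (old u∈)) (sym (trans (old₂ (here refl)) new₁)) (sym new₂) edge
        (there (there p)) → let a , b , eq′ , a∈ , b∈ , h = Embedding.f-edge φ p in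
          a , b , eq′ , there (there a∈) , there (there b∈) , edge′ (sym (old a∈)) (sym (old b∈)) (sym (old p)) h
    }
    where
    old : ∀ {i} → i ∈ ks → f₂ i ≡ Embedding.f φ i
    old i∈ = trans (old₂ (there i∈)) (old₁ i∈)
    edge′ : ∀ {a b c a′ b′ c′} → a ≡ a′ → b ≡ b′ → c ≡ c′ → Edge H a b c → Edge H a′ b′ c′
    edge′ refl refl refl h = h

  -- Embed the tree greedily: every image has a large matching in its link,
  -- which always offers an edge disjoint from the vertices used so far.
  rich⇒contains : ∀ {r} → r ∈ A → Contains H (expansion T)
  rich⇒contains r∈ with tree-Grown T tree
  ... | ks , g , all = contains-expansion {T = T} {H = H} (f ∘ inj₁) (f ∘ inj₂)
    (λ eq → inj₁-injective (f-inj (all _) (all _) eq)) (λ eq → inj₂-injective (f-inj (all _) (all _) eq))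
    (λ u e eq → case f-inj (all (inj₁ u)) (all (inj₂ e)) eq of λ ())
    (λ e → let u , v , eq , _ , _ , h = f-edge (all (inj₂ e)) in u , v , eq , h)
    where open Embedding (embed r∈ g)

data Peeled {n : ℕ} (H : 3-Graph n) (c : ℕ) : List (Fin n) → Set where
  []   : Peeled H c []
  peel : ∀ {x xs C} → length C ≤ c → Cover (Edge H x) xs C → Peeled H c xs → Peeled H c (x ∷ xs)

module _ {m n : ℕ} {T : Graph m} (tree : IsTree T) {H : 3-Graph n} (T⊄H : ¬ Contains H (expansion T)) where

  -- Twice the matching size that the greedy embedding asks for, by `matching-or-cover`.
  private c = 2 * suc (m + size T)

  poor-vertex : ∀ a A → ∃[ x ] x ∈ a ∷ A × ∃[ C ] length C ≤ c × Cover (Edge H x) (a ∷ A) C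
  poor-vertex a A = go (a ∷ A) id (λ rich → T⊄H (rich⇒contains tree {H = H} (a ∷ A) rich (here refl)))
    where
    go : ∀ B → B ⊆ a ∷ A → ¬ (∀ {x} → x ∈ B → ∃[ us ] Matching (Edge H x) (a ∷ A) us (suc (m + size T))) →
         ∃[ x ] x ∈ a ∷ A × ∃[ C ] length C ≤ c × Cover (Edge H x) (a ∷ A) C
    go []      sub ¬rich = contradiction (λ ()) ¬rich
    go (b ∷ B) sub ¬rich with matching-or-cover (Edge H b) (Edge? H b) (λ h → Edge-≢ {H = H} (Edge-swapʳ {H = H} (Edge-swapˡ {H = H} h))) (a ∷ A) (suc (m + size T))
    ... | inj₂ (C , le , cov) = b , sub (here refl) , C , le , cov
    ... | inj₁ M = go B (sub ∘ there) (λ r → ¬rich λ { (here refl) → M ; (there p) → r p })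

  peeling : ∀ k A → Unique A → length A ≤ k →
            ∃[ xs ] Peeled H c xs × Unique xs × xs ⊆ A × A ⊆ xs
  peeling k       []      _ _  = [] , [] , [] , id , id
  peeling (suc k) (a ∷ A) u le with poor-vertex a A
  ... | x , x∈ , C , C≤ , cov
    with peeling k A′ (Unique.filter⁺ ≢x? u) (s≤s⁻¹ (≤-trans (Unique-⊆-length (∉⇒Unique-∷ x∉ (Unique.filter⁺ ≢x? u)) sub) le))
    where
    ≢x? : ∀ y → Dec (y ≢ x)
    ≢x? y = ¬? (y ≟ x)
    A′ = filter ≢x? (a ∷ A)
    x∉ : x ∉ A′
    x∉ p = proj₂ (∈-filter⁻ ≢x? {xs = a ∷ A} p) refl
    sub : x ∷ A′ ⊆ a ∷ A
    sub (here refl) = x∈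
    sub (there p)   = proj₁ (∈-filter⁻ ≢x? {xs = a ∷ A} p)
  ...   | xs , P , uq , sub , sup = x ∷ xs , peel C≤ (λ y∈ z∈ → cov (old y∈) (old z∈)) P ,
    ∉⇒Unique-∷ (λ p → proj₂ (∈-filter⁻ (λ y → ¬? (y ≟ x)) {xs = a ∷ A} (sub p)) refl) uq ,
    (λ { (here refl) → x∈ ; (there p) → old p }) , sup′
    where
    old : ∀ {y} → y ∈ xs → y ∈ a ∷ A
    old p = proj₁ (∈-filter⁻ (λ y → ¬? (y ≟ x)) {xs = a ∷ A} (sub p))
    sup′ : a ∷ A ⊆ x ∷ xs
    sup′ {y} p with y ≟ x
    ... | yes refl = here refl
    ... | no y≢x   = there (sup (∈-filter⁺ (λ y → ¬? (y ≟ x)) p y≢x))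

-- Embedding the expansion of a tree with a transversal

codegree : ∀ {n} → 3-Graph n → Fin n → Fin n → ℕ
codegree H x y = count (Edge? H x y) (allFin _)

Edge-rotate : ∀ {n} {H : 3-Graph n} {x y z} → Edge H x y z → Edge H z x y
Edge-rotate {H = H} h = Edge-swapˡ {H = H} (Edge-swapʳ {H = H} h)

-- A sunflower again, but as an indexed family and free of the order of the list, so that tuples can
-- be assigned to the vertices of `T`.
record Petals {n K k : ℕ} (P : Fin K → Fin k → Fin n) : Set where
  field
    const       : Fin k → Bool
    const-equal : ∀ {a b i} → const i ≡ true → P a i ≡ P b i
    meet        : ∀ {a b i j} → P a i ≡ P b j → i ≡ j × (a ≡ b ⊎ const i ≡ true)

sunflower-petals : ∀ {n k} {fs : List (Fin k → Fin n)} → All (λ f → ∀ {i j} → f i ≡ f j → i ≡ j) fs →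
                   Sunflower fs → Petals (lookup fs)
sunflower-petals {fs = fs} inj sf = record { const = const ; const-equal = eq ; meet = meet }
  where
  open Sunflower sf
  open import Data.Fin.Properties using () renaming (<-cmp to Fin-<-cmp)
  open import Relation.Binary.Definitions using (tri<; tri≈; tri>)
  eq : ∀ {a b i} → const i ≡ true → lookup fs a i ≡ lookup fs b i
  eq {a} {b} {i} c with Fin-<-cmp a b
  ... | tri< a<b _ _    = AllPairs-lookup const-equal a<b i c
  ... | tri≈ _ refl _   = refl
  ... | tri> _ _ b<a    = sym (AllPairs-lookup const-equal b<a i c)
  meet : ∀ {a b i j} → lookup fs a i ≡ lookup fs b j → i ≡ j × (a ≡ b ⊎ const i ≡ true)
  meet {a} {b} {i} {j} e with Fin-<-cmp a b
  ... | tri< a<b _ _  = let p , q = AllPairs-lookup disjoint a<b i j e in p , inj₂ q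
  ... | tri≈ _ refl _ = All.lookup inj (∈-lookup a) e , inj₁ refl
  ... | tri> _ _ b<a  = let p , q = AllPairs-lookup disjoint b<a j i (sym e) in sym p , inj₂ (subst (λ l → const l ≡ true) p q)

Petals-reindex : ∀ {n K L k} {P : Fin K → Fin k → Fin n} (f : Fin L → Fin K) → (∀ {a b} → f a ≡ f b → a ≡ b) →
                 Petals P → Petals (P ∘ f)
Petals-reindex f f-inj p = record
  { const = const ; const-equal = const-equal
  ; meet = λ e → let q , r = meet e in q , [ inj₁ ∘ f-inj , inj₂ ]′ r }
  where open Petals p

module _ {m n : ℕ} {T : Graph m} {H : 3-Graph n} {S : Subset m}
         (transversal : ∀ {e} → e ∈ edges T → ∣ S ∩ e ∣ ≡ 1) where

  private
    ends : ∀ e → ∃[ p ] ∃[ x ] p ∈ₛ S × x ∉ₛ S × lookup (edges T) e ≡ pair p x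
    ends e = transversal-edge S _ (All.lookup (edges-uniform T) (∈-lookup e)) (transversal (∈-lookup e))

  inner outer : Fin (size T) → Fin m
  inner e = proj₁ (ends e)
  outer e = proj₁ (proj₂ (ends e))

  inner∈ : ∀ e → inner e ∈ₛ S
  inner∈ e = proj₁ (proj₂ (proj₂ (ends e)))

  outer∉ : ∀ e → outer e ∉ₛ S
  outer∉ e = proj₁ (proj₂ (proj₂ (proj₂ (ends e))))

  ends-pair : ∀ e → lookup (edges T) e ≡ pair (inner e) (outer e)
  ends-pair e = proj₂ (proj₂ (proj₂ (proj₂ (ends e))))

  ends-injective : ∀ {d e} → inner d ≡ inner e → outer d ≡ outer e → d ≡ e
  ends-injective {d} {e} p q = lookup-edges-injective T
    (trans (ends-pair d) (trans (cong₂ pair p q) (sym (ends-pair e))))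

  -- The expansion vertex of an unfixed edge has to avoid the `m` images under `g` and fewer than
  -- `size T` other expansion vertices, so a codegree of `m + size T` leaves a choice.
  contains-by-completion : (g : Fin m → Fin n) → (∀ {u v} → g u ≡ g v → u ≡ v) →
    {Fixed : Fin (size T) → Set} (fixed? : ∀ e → Dec (Fixed e)) (w : Fin (size T) → Fin n) →
    (∀ {d e} → Fixed d → Fixed e → w d ≡ w e → d ≡ e) → (∀ {e} → Fixed e → ∀ u → w e ≢ g u) →
    (∀ {e} → Fixed e → Edge H (g (outer e)) (g (inner e)) (w e)) →
    (∀ {e} → ¬ Fixed e → m + size T ≤ codegree H (g (outer e)) (g (inner e))) →
    Contains H (expansion T)
  contains-by-completion g g-inj {Fixed} fixed? w w-inj w≢g edge thick
    with complete (map g (allFin m)) (λ e → filter (Edge? H (g (outer e)) (g (inner e))) (allFin n))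
           (allFin (size T)) w (filter fixed? (allFin (size T)))
           (Unique.filter⁺ fixed? (Unique.allFin⁺ (size T)))
           (λ d∈ e∈ → w-inj (fixed d∈) (fixed e∈))
           (λ e∈ p → let u , _ , eq = ∈-map⁻ g p in w≢g (fixed e∈) u eq)
           (λ e e∉ → Unique.filter⁺ _ (Unique.allFin⁺ n) ,
              ≤-trans (≤-reflexive (cong (_+ size T) (trans (length-map g (allFin m)) (length-tabulate id)))) (thick (unfixed e∉)))
    where
    fixed : ∀ {e} → e ∈ filter fixed? (allFin (size T)) → Fixed e
    fixed p = proj₂ (∈-filter⁻ fixed? {xs = allFin (size T)} p)
    unfixed : ∀ {e} → e ∉ filter fixed? (allFin (size T)) → ¬ Fixed e
    unfixed e∉ f = e∉ (∈-filter⁺ fixed? (∈-allFin _) f)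
  ... | v , ls , _ , all , _ , v-inj , out , same , new =
    contains-expansion {T = T} {H = H} g v g-inj (λ eq → v-inj (all (∈-allFin _)) (all (∈-allFin _)) eq)
      (λ u e eq → out (all (∈-allFin e)) (subst (_∈ map g (allFin m)) eq (∈-map⁺ g (∈-allFin u))))
      (λ e → inner e , outer e , ends-pair e , Edge-swapˡ {H = H} (edge′ e (fixed? e)))
    where
    edge′ : ∀ e → Dec (Fixed e) → Edge H (g (outer e)) (g (inner e)) (v e)
    edge′ e (yes f) = subst (Edge H _ _) (sym (same (∈-filter⁺ fixed? (∈-allFin e) f))) (edge f)
    edge′ e (no ¬f) = proj₂ (∈-filter⁻ (Edge? H (g (outer e)) (g (inner e))) {xs = allFin n}
      (new (all (∈-allFin e)) (λ p → ¬f (proj₂ (∈-filter⁻ fixed? {xs = allFin (size T)} p)))))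

  module _ {t : ℕ} (∣S∣ : ∣ S ∣ ≡ suc t) where

    private
      in? : ∀ u → Dec (u ∈ elements S)
      in? u = any? (u ≟_) (elements S)

      index : ∀ {u} → Dec (u ∈ elements S) → Fin (suc t)
      index (yes p) = Fin.cast (trans (length-elements S) ∣S∣) (Any.index p)
      index (no _)  = zero

    -- Meaningful only on S; zero elsewhere.
    rank : Fin m → Fin (suc t)
    rank u = index (in? u)

    rank-injective : ∀ {u v} → u ∈ₛ S → v ∈ₛ S → rank u ≡ rank v → u ≡ v
    rank-injective {u} {v} u∈ v∈ eq with in? u | in? v
    ... | no u∉ | _     = contradiction (∈-elements⁺ u∈) u∉
    ... | yes _ | no v∉ = contradiction (∈-elements⁺ v∈) v∉
    ... | yes p | yes q = trans (lookup-index p) (trans (cong (lookup (elements S)) (cast-injective {e = trans (length-elements S) ∣S∣} eq)) (sym (lookup-index q)))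
      where
      open import Data.List.Relation.Unary.Any.Properties using (lookup-index)
      cast-injective : ∀ {k l} {e : k ≡ l} {i j : Fin k} → Fin.cast e i ≡ Fin.cast e j → i ≡ j
      cast-injective {e = refl} {i} {j} eq = trans (sym (cast-is-id refl i)) (trans eq (cast-is-id refl j))
        where open import Data.Fin.Properties using (cast-is-id)

    -- S goes to the constant coordinates and to common neighbours y of the
    -- others; the other side of the tree goes to the first coordinates.
    module Fan (P : Fin m → Fin (suc (suc t)) → Fin n) (petals : Petals P)
             (zero-inj : Petals.const petals zero ≡ false)
             (y : Fin (suc t) → Fin n) (y-inj : ∀ {i j} → y i ≡ y j → i ≡ j) (y∉P : ∀ {i a j} → y i ≢ P a j)
             (edge : ∀ {a i} → Edge H (P a zero) (P a (suc i)) (y i))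
             (thick : ∀ {a i} → m + size T ≤ codegree H (P a zero) (P a (suc i))) where

      open Petals petals

      data Place (u : Fin m) : Fin n → Set where
        outside : u ∉ₛ S → Place u (P u zero)
        kernel  : u ∈ₛ S → const (suc (rank u)) ≡ true → Place u (P u (suc (rank u)))
        common  : u ∈ₛ S → const (suc (rank u)) ≡ false → Place u (y (rank u))

      place : ∀ u → ∃[ x ] Place u x
      place u with u ∈ₛ? S | const (suc (rank u)) in eq
      ... | no u∉  | _     = _ , outside u∉
      ... | yes u∈ | true  = _ , kernel u∈ eq
      ... | yes u∈ | false = _ , common u∈ eq

      g : Fin m → Fin n
      g u = proj₁ (place u)

      g-inj : ∀ {u v} → g u ≡ g v → u ≡ v
      g-inj {u} {v} eq = go (proj₂ (place u)) (proj₂ (place v)) eq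
        where
        go : ∀ {u v a b} → Place u a → Place v b → a ≡ b → u ≡ v
        go (outside _)   (outside _)   e with meet e
        ... | _ , inj₁ u≡v = u≡v
        ... | _ , inj₂ c   = case trans (sym c) zero-inj of λ ()
        go (outside _)   (kernel _ _)  e with () ← proj₁ (meet e)
        go (kernel _ _)  (outside _)   e with () ← proj₁ (meet e)
        go (outside _)   (common _ _)  e = contradiction (sym e) y∉P
        go (kernel _ _)  (common _ _)  e = contradiction (sym e) y∉P
        go (common _ _)  (outside _)   e = contradiction e y∉P
        go (common _ _)  (kernel _ _)  e = contradiction e y∉P
        go (kernel u∈ _) (kernel v∈ _) e = rank-injective u∈ v∈ (suc-injectiveᶠ (proj₁ (meet e)))
          where open import Data.Fin.Properties using () renaming (suc-injective to suc-injectiveᶠ)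
        go (common u∈ _) (common v∈ _) e = rank-injective u∈ v∈ (y-inj e)

      Fixed : Fin (size T) → Set
      Fixed e = const (suc (rank (inner e))) ≡ false

      -- For a fixed edge, the member of `S` has moved from coordinate `suc (rank (inner e))` to the
      -- common neighbour, so the entry that it leaves in the tuple of `outer e` is free to be the
      -- expansion vertex.
      w : Fin (size T) → Fin n
      w e = P (outer e) (suc (rank (inner e)))

      contained : Contains H (expansion T)
      contained = contains-by-completion g g-inj {Fixed} (λ e → _ Bool.≟ _) w w-inj w≢g edge′ thick′
        where
        open import Data.Fin.Properties using () renaming (suc-injective to suc-injectiveᶠ)
        w-inj : ∀ {d e} → Fixed d → Fixed e → w d ≡ w e → d ≡ e
        w-inj {d} {e} fd fe eq with meet eq
        ... | p , inj₁ q = ends-injective (rank-injective (inner∈ d) (inner∈ e) (suc-injectiveᶠ p)) q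
        ... | p , inj₂ c = case trans (sym c) fd of λ ()
        w≢g : ∀ {e} → Fixed e → ∀ u → w e ≢ g u
        w≢g fe u eq with place u
        ... | _ , outside _  with () ← proj₁ (meet eq)
        ... | _ , common _ _ = y∉P (sym eq)
        ... | _ , kernel _ c = case trans (sym c) (subst (λ i → const i ≡ false) (proj₁ (meet eq)) fe) of λ ()
        edge′ : ∀ {e} → Fixed e → Edge H (g (outer e)) (g (inner e)) (w e)
        edge′ {e} fe with place (outer e) | place (inner e)
        ... | _ , kernel o∈ _ | _             = contradiction o∈ (outer∉ e)
        ... | _ , common o∈ _ | _             = contradiction o∈ (outer∉ e)
        ... | _ , outside _   | _ , outside i∉  = contradiction (inner∈ e) i∉
        ... | _ , outside _   | _ , kernel _ c  = case trans (sym c) fe of λ ()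
        ... | _ , outside _   | _ , common _ _  = Edge-swapʳ {H = H} edge
        thick′ : ∀ {e} → ¬ Fixed e → m + size T ≤ codegree H (g (outer e)) (g (inner e))
        thick′ {e} ¬f with place (outer e) | place (inner e)
        ... | _ , kernel o∈ _ | _             = contradiction o∈ (outer∉ e)
        ... | _ , common o∈ _ | _             = contradiction o∈ (outer∉ e)
        ... | _ , outside _   | _ , outside i∉  = contradiction (inner∈ e) i∉
        ... | _ , outside _   | _ , common _ c  = contradiction c ¬f
        ... | _ , outside _   | _ , kernel _ c  =
          subst (λ z → m + size T ≤ codegree H (P (outer e) zero) z) (const-equal c) thick

    -- Two vertices q₀, q₁ of S have the same colour.  They have at most one
    -- common neighbour, the special vertex, which goes to the last tuple.
    module Chain (tree : IsTree T) (P : Fin (m + (m + 1)) → Fin (suc t) → Fin n) (petals : Petals P)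
             (zero-inj : Petals.const petals zero ≡ false)
             (i₀ : Fin t) (i₀-inj : Petals.const petals (suc i₀) ≡ false)
             (edge : ∀ {a b i} → a Fin.< b → Edge H (P a zero) (P a (suc i)) (P b zero))
             (thick : ∀ {a i} → m + size T ≤ codegree H (P a zero) (P a (suc i))) where

      open Petals petals
      open import Data.Fin.Properties using (↑ˡ-injective; ↑ʳ-injective; toℕ-↑ˡ; toℕ-↑ʳ; toℕ<n)
        renaming (suc-injective to suc-injectiveᶠ; any? to anyᶠ?)

      -- The `suc t` ranks are squeezed into `t` colours, and the ranks `zero` and `suc i₀` collide.
      -- The colour `i₀` has to be nonconstant: members of `S` with a constant colour are placed on
      -- the kernel vertex of that colour, which can host only one.
      merge : Fin (suc t) → Fin t
      merge zero    = i₀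
      merge (suc i) = i

      merge-injective : ∀ {i j} → merge i ≡ merge j → i ≡ j ⊎ merge i ≡ i₀ × (i ≡ zero × j ≡ suc i₀ ⊎ i ≡ suc i₀ × j ≡ zero)
      merge-injective {zero}  {zero}  _    = inj₁ refl
      merge-injective {zero}  {suc j} refl = inj₂ (refl , inj₁ (refl , refl))
      merge-injective {suc i} {zero}  refl = inj₂ (refl , inj₂ (refl , refl))
      merge-injective {suc i} {suc j} refl = inj₁ refl

      colour : Fin m → Fin t
      colour u = merge (rank u)

      colour-injective : ∀ {u v} → u ∈ₛ S → v ∈ₛ S → const (suc (colour u)) ≡ true → colour u ≡ colour v → u ≡ v
      colour-injective u∈ v∈ c eq with merge-injective eq
      ... | inj₁ e       = rank-injective u∈ v∈ e
      ... | inj₂ (e , _) = case trans (sym c) (trans (cong (const ∘ suc) e) i₀-inj) of λ ()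

      -- The `m + (m + 1)` members of the chain host, in this order, the ordinary vertices outside
      -- `S`, the members of `S` with nonconstant colour, and the special vertex.
      early middle : Fin m → Fin (m + (m + 1))
      early u  = u Fin.↑ˡ (m + 1)
      middle u = m Fin.↑ʳ (u Fin.↑ˡ 1)

      last : Fin (m + (m + 1))
      last = m Fin.↑ʳ (m Fin.↑ʳ zero)

      early<middle : ∀ {u v} → early u Fin.< middle v
      early<middle {u} {v} = ≤-trans (s≤s (≤-reflexive (toℕ-↑ˡ u (m + 1))))
        (≤-trans (toℕ<n u) (≤-trans (m≤m+n m _) (≤-reflexive (sym (toℕ-↑ʳ m (v Fin.↑ˡ 1))))))

      middle<last : ∀ {u} → middle u Fin.< last
      middle<last {u} = ≤-trans (s≤s (≤-reflexive (trans (toℕ-↑ʳ m _) (cong (m +_) (toℕ-↑ˡ u 1)))))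
        (≤-trans (+-monoʳ-< m (≤-trans (toℕ<n u) (m≤m+n m 0)))
          (≤-reflexive (sym (trans (toℕ-↑ʳ m _) (cong (m +_) (toℕ-↑ʳ m (zero {0}))))) ))

      early<last : ∀ {u} → early u Fin.< last
      early<last {u} = <-trans (early<middle {u} {u}) (middle<last {u})

      <⇒≢ᶠ : ∀ {k} {a b : Fin k} → a Fin.< b → a ≢ b
      <⇒≢ᶠ lt refl = <-irrefl refl lt

      Special : Fin m → Set
      Special x = ∃[ q₀ ] ∃[ q₁ ] (q₀ ∈ₛ S × rank q₀ ≡ zero) × (q₁ ∈ₛ S × rank q₁ ≡ suc i₀) × Adjacent T q₀ x × Adjacent T q₁ x

      special? : ∀ x → Dec (Special x)
      special? x = anyᶠ? λ q₀ → anyᶠ? λ q₁ → (q₀ ∈ₛ? S ×-dec rank q₀ ≟ zero) ×-dec (q₁ ∈ₛ? S ×-dec rank q₁ ≟ suc i₀) ×-dec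
                   any? (pair q₀ x ≟ₛ_) (edges T) ×-dec any? (pair q₁ x ≟ₛ_) (edges T)

      special-unique : ∀ {x y} → Special x → Special y → x ≡ y
      special-unique (q₀ , q₁ , (q₀∈ , r₀) , (q₁∈ , r₁) , a , b) (q₂ , q₃ , (q₂∈ , r₂) , (q₃∈ , r₃) , c , d)
        with refl ← rank-injective q₀∈ q₂∈ (trans r₀ (sym r₂))
        with refl ← rank-injective q₁∈ q₃∈ (trans r₁ (sym r₃))
        = common-neighbour-unique T tree (λ { refl → case trans (sym r₀) r₁ of λ () }) a b c d

      data Place (u : Fin m) : Fin n → Set where
        ordinary : u ∉ₛ S → ¬ Special u → Place u (P (early u) zero)
        special  : u ∉ₛ S → Special u → Place u (P last zero)
        kernel   : u ∈ₛ S → const (suc (colour u)) ≡ true → Place u (P (early u) (suc (colour u)))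
        petal    : u ∈ₛ S → const (suc (colour u)) ≡ false → Place u (P (middle u) zero)

      place : ∀ u → ∃[ x ] Place u x
      place u with u ∈ₛ? S | const (suc (colour u)) in eq | special? u
      ... | no u∉  | _     | yes s = _ , special u∉ s
      ... | no u∉  | _     | no ¬s = _ , ordinary u∉ ¬s
      ... | yes u∈ | true  | _     = _ , kernel u∈ eq
      ... | yes u∈ | false | _     = _ , petal u∈ eq

      g : Fin m → Fin n
      g u = proj₁ (place u)

      first : ∀ {a b} → P a zero ≡ P b zero → a ≡ b
      first e with meet e
      ... | _ , inj₁ a≡b = a≡b
      ... | _ , inj₂ c   = case trans (sym c) zero-inj of λ ()

      g-inj : ∀ {u v} → g u ≡ g v → u ≡ v
      g-inj {u} {v} eq = go (proj₂ (place u)) (proj₂ (place v)) eq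
        where
        go : ∀ {u v a b} → Place u a → Place v b → a ≡ b → u ≡ v
        go (ordinary _ _) (ordinary _ _) e = ↑ˡ-injective _ _ _ (first e)
        go (special _ s)  (special _ s′) e = special-unique s s′
        go (petal _ _)    (petal _ _)    e = ↑ˡ-injective _ _ _ (↑ʳ-injective m _ _ (first e))
        go (kernel u∈ c)  (kernel v∈ _)  e = colour-injective u∈ v∈ c (suc-injectiveᶠ (proj₁ (meet e)))
        go (ordinary _ _) (special _ _)  e = contradiction (first e) (<⇒≢ᶠ early<last)
        go (special _ _)  (ordinary _ _) e = contradiction (sym (first e)) (<⇒≢ᶠ early<last)
        go (ordinary _ _) (petal _ _)    e = contradiction (first e) (<⇒≢ᶠ early<middle)
        go (petal _ _)    (ordinary _ _) e = contradiction (sym (first e)) (<⇒≢ᶠ early<middle)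
        go (special _ _)  (petal _ _)    e = contradiction (sym (first e)) (<⇒≢ᶠ middle<last)
        go (petal _ _)    (special _ _)  e = contradiction (first e) (<⇒≢ᶠ middle<last)
        go (kernel _ _)   (ordinary _ _) e with () ← proj₁ (meet e)
        go (kernel _ _)   (special _ _)  e with () ← proj₁ (meet e)
        go (kernel _ _)   (petal _ _)    e with () ← proj₁ (meet e)
        go (ordinary _ _) (kernel _ _)   e with () ← proj₁ (meet e)
        go (special _ _)  (kernel _ _)   e with () ← proj₁ (meet e)
        go (petal _ _)    (kernel _ _)   e with () ← proj₁ (meet e)

      Fixed : Fin (size T) → Set
      Fixed e = const (suc (colour (inner e))) ≡ false

      -- By `edge`, the entry used for an edge of `T` belongs to the tuple of the endpoint that is
      -- earlier in the chain: the vertex outside `S` in general, but the member of `S` when the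
      -- other endpoint is special.
      source : ∀ {x} → Fin m → Dec (Special x) → Fin (m + (m + 1))
      source     u (yes _) = middle u
      source {x} u (no _)  = early x

      w : Fin (size T) → Fin n
      w e = P (source (inner e) (special? (outer e))) (suc (colour (inner e)))

      adjacent : ∀ e → Adjacent T (inner e) (outer e)
      adjacent e = lookup-adjacent T (ends-pair e)

      -- Edges with the same entry have the same colour and the same earlier endpoint. If that
      -- endpoint is ordinary, different ranks of equal colour would make it adjacent to both
      -- colliding members of `S`, hence special.
      w-inj : ∀ {d e} → Fixed d → Fixed e → w d ≡ w e → d ≡ e
      w-inj {d} {e} fd fe eq with meet eq
      ... | _ , inj₂ c = case trans (sym c) fd of λ ()
      ... | p , inj₁ q with special? (outer d) | special? (outer e)
      ...   | yes s | yes s′ = ends-injective (↑ˡ-injective _ _ _ (↑ʳ-injective m _ _ q)) (special-unique s s′)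
      ...   | yes _ | no _   = contradiction (sym q) (<⇒≢ᶠ early<middle)
      ...   | no _  | yes _  = contradiction q (<⇒≢ᶠ early<middle)
      ...   | no ¬s | no _   with o≡ ← ↑ˡ-injective _ _ _ q with merge-injective (suc-injectiveᶠ p)
      ...     | inj₁ r = ends-injective (rank-injective (inner∈ d) (inner∈ e) r) o≡
      ...     | inj₂ (_ , inj₁ (r , r′)) = contradiction (inner d , inner e , (inner∈ d , r) , (inner∈ e , r′) ,
                  adjacent d , subst (Adjacent T (inner e)) (sym o≡) (adjacent e)) ¬s
      ...     | inj₂ (_ , inj₂ (r , r′)) = contradiction (inner e , inner d , (inner∈ e , r′) , (inner∈ d , r) ,
                  subst (Adjacent T (inner e)) (sym o≡) (adjacent e) , adjacent d) ¬s

      contained : Contains H (expansion T)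
      contained = contains-by-completion g g-inj {Fixed} (λ e → _ Bool.≟ _) w w-inj w≢g edge′ thick′
        where
        w≢g : ∀ {e} → Fixed e → ∀ u → w e ≢ g u
        w≢g fe u eq with place u
        ... | _ , ordinary _ _ with () ← proj₁ (meet eq)
        ... | _ , special _ _  with () ← proj₁ (meet eq)
        ... | _ , petal _ _    with () ← proj₁ (meet eq)
        ... | _ , kernel _ c   = case trans (sym c) (subst (λ i → const i ≡ false) (proj₁ (meet eq)) fe) of λ ()
        edge′ : ∀ {e} → Fixed e → Edge H (g (outer e)) (g (inner e)) (w e)
        edge′ {e} fe with special? (outer e) | place (outer e) | place (inner e)
        ... | _     | _ , kernel o∈ _   | _               = contradiction o∈ (outer∉ e)
        ... | _     | _ , petal o∈ _    | _               = contradiction o∈ (outer∉ e)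
        ... | _     | _                 | _ , ordinary i∉ _ = contradiction (inner∈ e) i∉
        ... | _     | _                 | _ , special i∉ _  = contradiction (inner∈ e) i∉
        ... | _     | _                 | _ , kernel _ c    = case trans (sym c) fe of λ ()
        ... | yes s | _ , ordinary _ ¬s | _ , petal _ _     = contradiction s ¬s
        ... | no ¬s | _ , special _ s   | _ , petal _ _     = contradiction s ¬s
        ... | no _  | _ , ordinary _ _  | _ , petal _ _     = Edge-swapʳ {H = H} (edge early<middle)
        ... | yes _ | _ , special _ _   | _ , petal _ _     = Edge-rotate {H = H} (edge middle<last)
        thick′ : ∀ {e} → ¬ Fixed e → m + size T ≤ codegree H (g (outer e)) (g (inner e))
        thick′ {e} ¬f with place (outer e) | place (inner e)
        ... | _ , kernel o∈ _  | _               = contradiction o∈ (outer∉ e)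
        ... | _ , petal o∈ _   | _               = contradiction o∈ (outer∉ e)
        ... | _                | _ , ordinary i∉ _ = contradiction (inner∈ e) i∉
        ... | _                | _ , special i∉ _  = contradiction (inner∈ e) i∉
        ... | _                | _ , petal _ c     = contradiction c ¬f
        ... | _ , ordinary _ _ | _ , kernel _ c    =
          subst (λ z → m + size T ≤ codegree H (P (early (outer e)) zero) z) (const-equal c) thick
        ... | _ , special _ _  | _ , kernel _ c    =
          subst (λ z → m + size T ≤ codegree H (P last zero) z) (const-equal c) thick

-- Vertices with many neighbours of large codegree

Sunflower-⊑ : ∀ {A : Set} {k} {fs gs : List (Fin k → A)} → fs ⊑ gs → Sunflower gs → Sunflower fs
Sunflower-⊑ s sf = record
  { const = const ; const-equal = AllPairs-⊑ s const-equal ; disjoint = AllPairs-⊑ s disjoint }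
  where open Sunflower sf

module _ {n : ℕ} {R : Set} {D : R → Fin n → Set} (D? : ∀ r y → Dec (D r y)) (g : ℕ) (0<g : 0 < g) where

  -- The removal of `us` costs at most `n / 2g`, so each row still has at least `n / 2g` of the
  -- vertices; on average, a vertex outside `us` then serves at least a fraction `1 / 2g` of the
  -- rows.
  averaging : ∀ c (rows : List R) (us : List (Fin n)) → 0 < c → 0 < n → 2 * g * c ≤ length rows →
              2 * g * length us ≤ n → (∀ {r} → r ∈ rows → n ≤ g * count (D? r) (allFin n)) →
              ∃[ y ] y ∉ us × c ≤ count (λ r → D? r y) rows
  averaging (suc c) rows us _ 0<n le us≤ thick with any? (λ y → ¬? (any? (y ≟_) us) ×-dec suc c ≤? count (λ r → D? r y) rows) (allFin n)
  ... | yes p with y , _ , y∉ , c≤ ← find p = y , y∉ , c≤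
  ... | no ¬p = contradiction main (<⇒≱ gap)
    where
    open ≤-Reasoning
    free? : ∀ y → Dec (y ∉ us)
    free? y = ¬? (any? (y ≟_) us)
    Y = filter free? (allFin n)
    ∣Y∣≤n : length Y ≤ n
    ∣Y∣≤n = Unique-Fin-length (Unique.filter⁺ free? (Unique.allFin⁺ n))
    degree-Y : ∀ {r} → r ∈ rows → n ≤ 2 * g * count (D? r) Y
    degree-Y {r} r∈ = +-cancelʳ-≤ n n _ (begin
      n + n                                             ≤⟨ +-mono-≤ (thick r∈) (thick r∈) ⟩
      g * d + g * d                                     ≡⟨ eq₁ g d ⟩
      2 * g * d                                         ≤⟨ *-monoʳ-≤ (2 * g) (≤-trans (count-∉ _≟_ us (Unique.filter⁺ (D? r) (Unique.allFin⁺ n))) (+-monoˡ-≤ (length us) sub)) ⟩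
      2 * g * (count (D? r) Y + length us)              ≡⟨ *-distribˡ-+ (2 * g) (count (D? r) Y) (length us) ⟩
      2 * g * count (D? r) Y + 2 * g * length us        ≤⟨ +-monoʳ-≤ _ us≤ ⟩
      2 * g * count (D? r) Y + n                        ∎)
      where
      d = count (D? r) (allFin n)
      eq₁ : ∀ g d → g * d + g * d ≡ 2 * g * d
      eq₁ = solve-∀
      sub : length (filter _ (filter (D? r) (allFin n))) ≤ count (D? r) Y
      sub = Unique-⊆-length (Unique.filter⁺ _ (Unique.filter⁺ (D? r) (Unique.allFin⁺ n))) λ x∈ →
        let p , q = ∈-filter⁻ _ {xs = filter (D? r) (allFin n)} x∈
            a , b = ∈-filter⁻ (D? r) {xs = allFin n} p
        in ∈-filter⁺ (D? r) (∈-filter⁺ free? a q) b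
    few : ∀ {y} → y ∈ Y → count (λ r → D? r y) rows ≤ c
    few {y} y∈ = s≤s⁻¹ (≰⇒> λ le → ¬p (lose (∈-allFin y) (proj₂ (∈-filter⁻ free? {xs = allFin n} y∈) , le)))
    main : 2 * g * suc c * n ≤ 2 * g * (n * c)
    main = begin
      2 * g * suc c * n                                      ≤⟨ *-monoˡ-≤ n le ⟩
      length rows * n                                        ≤⟨ ∑≥ rows degree-Y ⟩
      ∑ rows (λ r → 2 * g * count (D? r) Y)                  ≡⟨ ∑-* (2 * g) rows ⟩
      2 * g * ∑ rows (λ r → count (D? r) Y)                  ≡⟨ cong (2 * g *_) (double-count D? rows Y) ⟩
      2 * g * ∑ Y (λ y → count (λ r → D? r y) rows)          ≤⟨ *-monoʳ-≤ (2 * g) (∑≤ Y few) ⟩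
      2 * g * (length Y * c)                                 ≤⟨ *-monoʳ-≤ (2 * g) (*-monoˡ-≤ c ∣Y∣≤n) ⟩
      2 * g * (n * c)                                        ∎
    gap : 2 * g * (n * c) < 2 * g * suc c * n
    gap = begin-strict
      2 * g * (n * c)              <⟨ m<m+n _ (*-mono-< (*-pos {2} (s≤s z≤n) 0<g) 0<n) ⟩
      2 * g * (n * c) + 2 * g * n  ≡⟨ eq₂ g c n ⟩
      2 * g * suc c * n            ∎
      where
      eq₂ : ∀ g c n → 2 * g * (n * c) + 2 * g * n ≡ 2 * g * suc c * n
      eq₂ = solve-∀

module _ {n : ℕ} (H : 3-Graph n) (g : ℕ) where

  thick? : ∀ v a → Dec (n ≤ g * codegree H v a)
  thick? v a = n ≤? g * codegree H v a

  N : Fin n → List (Fin n)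
  N v = filter (thick? v) (allFin n)

  N-Unique : ∀ v → Unique (N v)
  N-Unique v = Unique.filter⁺ (thick? v) (Unique.allFin⁺ n)

  N-thick : ∀ {v a} → a ∈ N v → n ≤ g * codegree H v a
  N-thick {v} a∈ = proj₂ (∈-filter⁻ (thick? v) {xs = allFin n} a∈)

  v∉Nv : 0 < n → ∀ {v} → v ∉ N v
  v∉Nv 0<n {v} v∈ = contradiction (N-thick v∈) (<⇒≱ (subst (_< n) (sym (trans (cong (g *_) none) (*-zeroʳ g))) 0<n))
    where
    none : codegree H v v ≡ 0
    none = n≤0⇒n≡0 (Unique-⊆-length {ys = []} (Unique.filter⁺ _ (Unique.allFin⁺ n))
      (λ p → contradiction refl (Edge-≢ {H = H} (proj₂ (∈-filter⁻ (Edge? H v v) {xs = allFin n} p)))))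

  private
    entries : ∀ k v → Dec (k ≤ length (N v)) → Fin k → Fin n
    entries k v (yes le) i = lookup (N v) (Fin.inject≤ i le)
    entries k v (no _)   i = v

  -- Constantly v if v has fewer than k thick neighbours.
  tuple : ∀ k → Fin n → Fin (suc k) → Fin n
  tuple k v zero    = v
  tuple k v (suc i) = entries k v (k ≤? length (N v)) i

  module _ {k v} (k≤ : k ≤ length (N v)) where

    tuple-∈ : ∀ i → tuple k v (suc i) ∈ N v
    tuple-∈ i with k ≤? length (N v)
    ... | yes le = ∈-lookup (Fin.inject≤ i le)
    ... | no ¬le = contradiction k≤ ¬le

    tuple-injective : 0 < n → ∀ {i j} → tuple k v i ≡ tuple k v j → i ≡ j
    tuple-injective 0<n {zero}  {zero}  _  = refl
    tuple-injective 0<n {zero}  {suc j} eq = contradiction (subst (_∈ N v) (sym eq) (tuple-∈ j)) (v∉Nv 0<n)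
    tuple-injective 0<n {suc i} {zero}  eq = contradiction (subst (_∈ N v) eq (tuple-∈ i)) (v∉Nv 0<n)
    tuple-injective 0<n {suc i} {suc j} eq with k ≤? length (N v)
    ... | no ¬le = contradiction k≤ ¬le
    ... | yes le = cong suc (inject≤-injective le le i j (lookup-injective (N-Unique v) _ _ eq))
      where
      open import Data.Fin.Properties using (inject≤-injective)

  tuple-surjective : ∀ {k v} → length (N v) ≡ k → ∀ {a} → a ∈ N v → ∃[ i ] tuple k v (suc i) ≡ a
  tuple-surjective {k} {v} refl a∈ with k ≤? length (N v)
  ... | no ¬le = contradiction ≤-refl ¬le
  ... | yes le = Any.index a∈ , trans (cong (lookup (N v)) (inject≤-idempotent′ le (Any.index a∈))) (sym (lookup-index a∈))
    where
    open import Data.List.Relation.Unary.Any.Properties using (lookup-index)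
    open import Data.Fin.Properties using (toℕ-injective; toℕ-inject≤)
    inject≤-idempotent′ : ∀ {k} (le : k ≤ k) (i : Fin k) → Fin.inject≤ i le ≡ i
    inject≤-idempotent′ le i = toℕ-injective (toℕ-inject≤ i le)

  -- For vertices with equally many thick neighbours, the second part says that their neighbourhoods
  -- differ.
  ChainRel : Fin n → Fin n → Set
  ChainRel v u = (∀ {a} → a ∈ N v → Edge H v a u) × (∃[ a ] a ∈ N v × a ∉ N u)

-- Each of the `suc t` averaging steps keeps a fraction `1 / 2g` of the tuples, and `m` must remain,
-- one for each vertex of `T`. The additional 2 gives two tuples whose first entries can be
-- compared.
manyNumber : ℕ → ℕ → ℕ → ℕ
manyNumber m t g = sunflowerNumber (suc (suc t)) (2 + (2 * g) ^ suc t * m)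

chainNumber : ℕ → ℕ → ℕ
chainNumber m t = sunflowerNumber (suc t) (m + (m + 1))

module _ {m n : ℕ} {T : Graph m} {H : 3-Graph n} {S : Subset m}
         (transversal : ∀ {e} → e ∈ edges T → ∣ S ∩ e ∣ ≡ 1) {t : ℕ} (∣S∣ : ∣ S ∣ ≡ suc t)
         (g : ℕ) (0<g : 0 < g) (0<m : 0 < m) (0<n : 0 < n) (n-large : g * (m + size T) ≤ n) where

  thick⇒many : ∀ {v a} → a ∈ N H g v → m + size T ≤ codegree H v a
  thick⇒many {v} a∈ = *-cancelˡ-≤ g {{>-nonZero 0<g}} (≤-trans n-large (N-thick H g {v} a∈))

  -- One averaging step per coordinate; the vertex found joins the forbidden list, which makes the
  -- common neighbours distinct. The map `c` lets the induction drop a coordinate while the rows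
  -- stay whole.
  pick-common : ∀ {k s} (c : Fin k → Fin s) (rows : List (Fin (suc s) → Fin n)) (us : List (Fin n)) →
    (2 * g) ^ k * m ≤ length rows → 2 * g * (length us + k) ≤ n →
    (∀ {r} → r ∈ rows → ∀ i → n ≤ g * codegree H (r zero) (r (suc i))) →
    ∃[ ls ] ls ⊑ rows × m ≤ length ls × Σ (Fin k → Fin n) λ y → (∀ {i j} → y i ≡ y j → i ≡ j) × (∀ i → y i ∉ us) ×
      (∀ {r} → r ∈ ls → ∀ i → Edge H (r zero) (r (suc (c i))) (y i))
  pick-common {zero} c rows us le _ _ = rows , Sublist.⊆-refl , ≤-trans (≤-reflexive (sym (+-identityʳ m))) le , (λ ()) , (λ { {()} }) , (λ ()) , (λ _ ())
  pick-common {suc k} c rows us le us≤ thick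
    with averaging (λ r y → Edge? H (r zero) (r (suc (c zero))) y) g 0<g ((2 * g) ^ k * m) rows us
           (*-pos (m^n>0 (2 * g) {{>-nonZero (*-pos {2} (s≤s z≤n) 0<g)}} k) 0<m) 0<n
           (≤-trans (≤-reflexive (sym (*-assoc (2 * g) ((2 * g) ^ k) m))) le)
           (≤-trans (*-monoʳ-≤ (2 * g) (m≤m+n (length us) (suc k))) us≤) (λ r∈ → thick r∈ (c zero))
  ... | y₀ , y₀∉ , le₀ with pick-common (c ∘ suc) (filter (λ r → Edge? H (r zero) (r (suc (c zero))) y₀) rows) (y₀ ∷ us) le₀
                              (≤-trans (≤-reflexive (cong (2 * g *_) (sym (+-suc (length us) k)))) us≤)
                              (λ r∈ → thick (proj₁ (∈-filter⁻ (λ r → Edge? H (r zero) (r (suc (c zero))) y₀) {xs = rows} r∈)))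
  ...   | ls , s , m≤ , y , y-inj , y∉ , edge = ls , Sublist.⊆-trans s (Sublist.filter-⊆ _ rows) , m≤ , y′ , y′-inj , y′∉ , edge′
    where
    y′ : Fin (suc k) → Fin n
    y′ zero    = y₀
    y′ (suc i) = y i
    y′-inj : ∀ {i j} → y′ i ≡ y′ j → i ≡ j
    y′-inj {zero}  {zero}  _  = refl
    y′-inj {zero}  {suc j} eq = contradiction (here (sym eq)) (y∉ j)
    y′-inj {suc i} {zero}  eq = contradiction (here eq) (y∉ i)
    y′-inj {suc i} {suc j} eq = cong suc (y-inj eq)
    y′∉ : ∀ i → y′ i ∉ us
    y′∉ zero    = y₀∉
    y′∉ (suc i) = y∉ i ∘ there
    edge′ : ∀ {r} → r ∈ ls → ∀ i → Edge H (r zero) (r (suc (c i))) (y′ i)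
    edge′ r∈ zero    = proj₂ (∈-filter⁻ (λ r → Edge? H (r zero) (r (suc (c zero))) y₀) {xs = rows} (⊑⇒⊆ s r∈))
    edge′ r∈ (suc i) = edge r∈ i

  AllPairs-first : ∀ {A : Set} {R Q : A → A → Set} {xs} → 2 ≤ length xs → AllPairs R xs → AllPairs Q xs →
                   ∃[ x ] ∃[ y ] x ∈ xs × y ∈ xs × R x y × Q x y
  AllPairs-first {xs = x ∷ y ∷ _} _ ((r ∷ _) ∷ _) ((q ∷ _) ∷ _) = x , y , here refl , there (here refl) , r , q
  AllPairs-first {xs = _ ∷ []} (s≤s ())

  first-varies : ∀ {k} {fs : List (Fin (suc k) → Fin n)} → 2 ≤ length fs → AllPairs (λ f f′ → f zero ≢ f′ zero) fs →
                 (sf : Sunflower fs) → Sunflower.const sf zero ≡ false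
  first-varies 2≤ distinct sf with Sunflower.const sf zero in eq
  ... | false = refl
  ... | true with _ , _ , _ , _ , ne , e ← AllPairs-first 2≤ distinct (Sunflower.const-equal sf) = contradiction (e zero eq) ne

  -- All entries of the sunflower are forbidden as common neighbours. The exact length of `vs`
  -- bounds their number, and the last hypothesis on `n` leaves room for them and for the `suc t`
  -- vertices to be chosen.
  many-thick⇒contains : (vs : List (Fin n)) → Unique vs → (∀ {v} → v ∈ vs → suc t ≤ length (N H g v)) →
    manyNumber m t g ≡ length vs → 2 * g * (manyNumber m t g * suc (suc t) + suc t) ≤ n → Contains H (expansion T)
  many-thick⇒contains vs uniq rich len n≥ = bouquet (sunflower _≟_ (2 + (2 * g) ^ suc t * m) tuples
      (All.map⁺ (All.tabulate (λ v∈ → tuple-injective H g (rich v∈) 0<n)))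
      (≤-reflexive (trans len (sym (length-map _ vs)))))
    where
    Row : Set
    Row = Fin (suc (suc t)) → Fin n
    tuples : List Row
    tuples = map (tuple H g (suc t)) vs
    source : ∀ {fs} → fs ⊑ tuples → ∀ {f} → f ∈ fs → ∃[ v ] v ∈ vs × f ≡ tuple H g (suc t) v
    source fs⊑ f∈ = ∈-map⁻ (tuple H g (suc t)) (⊑⇒⊆ fs⊑ f∈)
    inj : ∀ {f} → (∃[ v ] v ∈ vs × f ≡ tuple H g (suc t) v) → ∀ {i j} → f i ≡ f j → i ≡ j
    inj (v , v∈ , refl) = tuple-injective H g (rich v∈) 0<n
    thick : ∀ {f} → (∃[ v ] v ∈ vs × f ≡ tuple H g (suc t) v) → ∀ i → n ≤ g * codegree H (f zero) (f (suc i))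
    thick (v , v∈ , refl) i = N-thick H g {v} (tuple-∈ H g (rich v∈) i)
    large : ∀ {f} → (∃[ v ] v ∈ vs × f ≡ tuple H g (suc t) v) → ∀ i → m + size T ≤ codegree H (f zero) (f (suc i))
    large (v , v∈ , refl) i = thick⇒many {v} (tuple-∈ H g (rich v∈) i)
    entries : List Row → List (Fin n)
    entries = concatMap (λ f → map f (allFin (suc (suc t))))
    used : ∀ {fs} → fs ⊑ tuples → length (entries fs) ≤ manyNumber m t g * suc (suc t)
    used {fs} fs⊑ = ≤-trans (≤-reflexive (length-concatMap _ fs))
      (≤-trans (∑≤ fs (λ {f} _ → ≤-reflexive (trans (length-map f (allFin (suc (suc t)))) (length-tabulate {n = suc (suc t)} id))))
        (*-monoˡ-≤ (suc (suc t)) (≤-trans (⊑-length fs⊑) (≤-reflexive (trans (length-map _ vs) (sym len))))))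
    Common : List Row → Set
    Common fs = ∃[ ls ] ls ⊑ fs × m ≤ length ls × Σ (Fin (suc t) → Fin n) λ y → (∀ {i j} → y i ≡ y j → i ≡ j) ×
      (∀ i → y i ∉ entries fs) × (∀ {r} → r ∈ ls → ∀ i → Edge H (r zero) (r (suc i)) (y i))
    fan : ∀ {fs} → fs ⊑ tuples → 2 ≤ length fs → Sunflower fs → Common fs → Contains H (expansion T)
    fan {fs} fs⊑ 2≤ sf (ls , ls⊑ , m≤ , y , y-inj , y∉ , edge) =
      Fan.contained {T = T} {H = H} {S = S} transversal ∣S∣ (λ a → lookup ls (at a))
        (Petals-reindex at (inject≤-injective m≤ m≤ _ _)
          (sunflower-petals (All.tabulate (λ f∈ → inj (source (Sublist.⊆-trans ls⊑ fs⊑) f∈))) (Sunflower-⊑ ls⊑ sf)))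
        (first-varies 2≤ (AllPairs-⊑ fs⊑ (AllPairsₚ.map⁺ uniq)) sf)
        y y-inj
        (λ {i} {a} {j} eq → y∉ i (subst (_∈ entries fs) (sym eq)
          (∈-concatMap⁺ _ (lose (⊑⇒⊆ ls⊑ (∈-lookup (at a))) (∈-map⁺ (lookup ls (at a)) (∈-allFin j))))))
        (λ {a} {i} → edge (∈-lookup (at a)) i)
        (λ {a} {i} → large (source (Sublist.⊆-trans ls⊑ fs⊑) (∈-lookup (at a))) i)
      where
      open import Data.Fin.Properties using (inject≤-injective)
      at : Fin m → Fin (length ls)
      at a = Fin.inject≤ a m≤
    bouquet : (∃[ fs ] fs ⊑ tuples × 2 + (2 * g) ^ suc t * m ≤ length fs × Sunflower fs) → Contains H (expansion T)
    bouquet (fs , fs⊑ , p≤ , sf) = fan fs⊑ (≤-trans (m≤m+n 2 _) p≤) sf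
      (pick-common id fs (entries fs) (≤-trans (m≤n+m _ 2) p≤)
        (≤-trans (*-monoʳ-≤ (2 * g) (+-monoˡ-≤ (suc t) (used fs⊑))) n≥) (λ r∈ → thick (source fs⊑ r∈)))

  chain⇒contains : IsTree T → (vs : List (Fin n)) → AllPairs (ChainRel H g) vs → (∀ {v} → v ∈ vs → length (N H g v) ≡ t) →
                   chainNumber m t ≤ length vs → Contains H (expansion T)
  chain⇒contains tree vs chain typical len = bouquet (sunflower _≟_ (m + (m + 1)) tuples
      (All.map⁺ (All.tabulate (λ v∈ → tuple-injective H g (rank≤ v∈) 0<n)))
      (≤-trans len (≤-reflexive (sym (length-map _ vs)))))
    where
    open import Data.Fin.Properties using (inject≤-injective; toℕ-inject≤; ¬∀⟶∃¬)
    Row : Set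
    Row = Fin (suc t) → Fin n
    tuples : List Row
    tuples = map (tuple H g t) vs
    rank≤ : ∀ {v} → v ∈ vs → t ≤ length (N H g v)
    rank≤ v∈ = ≤-reflexive (sym (typical v∈))
    inj : ∀ {f} → (∃[ v ] v ∈ vs × f ≡ tuple H g t v) → ∀ {i j} → f i ≡ f j → i ≡ j
    inj (v , v∈ , refl) = tuple-injective H g (rank≤ v∈) 0<n
    large : ∀ {f} → (∃[ v ] v ∈ vs × f ≡ tuple H g t v) → ∀ i → m + size T ≤ codegree H (f zero) (f (suc i))
    large (v , v∈ , refl) i = thick⇒many {v} (tuple-∈ H g (rank≤ v∈) i)
    chain′ : ∀ {us} → us ⊆ vs → AllPairs (ChainRel H g) us → AllPairs (λ v u → v ∈ vs × u ∈ vs × ChainRel H g v u) us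
    chain′ sub []       = []
    chain′ sub (p ∷ ps) = All.tabulate (λ u∈ → sub (here refl) , sub (there u∈) , All.lookup p u∈) ∷ chain′ (sub ∘ there) ps
    differ : ∀ {v u} → v ∈ vs × u ∈ vs × ChainRel H g v u → ∃[ i ] tuple H g t v (suc i) ≢ tuple H g t u (suc i)
    differ (v∈ , u∈ , _ , a , a∈ , a∉) = let i , eq = tuple-surjective H g (typical v∈) a∈ in
      i , λ eq′ → a∉ (subst (_∈ N H g _) (trans (sym eq′) eq) (tuple-∈ H g (rank≤ u∈) i))
    bouquet : (∃[ fs ] fs ⊑ tuples × m + (m + 1) ≤ length fs × Sunflower fs) → Contains H (expansion T)
    bouquet (fs , fs⊑ , p≤ , sf) = Chain.contained {T = T} {H = H} {S = S} transversal ∣S∣ tree (λ a → lookup fs (at a))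
      (Petals-reindex at (inject≤-injective p≤ p≤ _ _) (sunflower-petals (All.tabulate (λ f∈ → inj (source f∈))) sf))
      (first-varies 2≤ distinct sf) (proj₁ varying) (Bool.¬-not (proj₂ varying))
      (λ {a} {b} {i} a<b → AllPairs-lookup edges-of (subst₂ _<_ (sym (toℕ-inject≤ a p≤)) (sym (toℕ-inject≤ b p≤)) a<b) i)
      (λ {a} {i} → large (source (∈-lookup (at a))) i)
      where
      source : ∀ {f} → f ∈ fs → ∃[ v ] v ∈ vs × f ≡ tuple H g t v
      source f∈ = ∈-map⁻ (tuple H g t) (⊑⇒⊆ fs⊑ f∈)
      at : Fin (m + (m + 1)) → Fin (length fs)
      at a = Fin.inject≤ a p≤
      edges-of : AllPairs (λ f f′ → ∀ i → Edge H (f zero) (f (suc i)) (f′ zero)) fs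
      edges-of = AllPairs-⊑ fs⊑ (AllPairsₚ.map⁺ (AllPairs.map (λ (v∈ , _ , e , _) i → e (tuple-∈ H g (rank≤ v∈) i)) (chain′ id chain)))
      distinct : AllPairs (λ f f′ → f zero ≢ f′ zero) fs
      distinct = AllPairs-⊑ fs⊑ (AllPairsₚ.map⁺ (AllPairs.map (λ { (_ , a , a∈ , a∉) refl → a∉ a∈ }) chain))
      tails-differ : AllPairs (λ f f′ → ∃[ i ] f (suc i) ≢ f′ (suc i)) fs
      tails-differ = AllPairs-⊑ fs⊑ (AllPairsₚ.map⁺ (AllPairs.map differ (chain′ id chain)))
      2≤ : 2 ≤ length fs
      2≤ = ≤-trans (+-mono-≤ 0<m (≤-trans 0<m (m≤m+n m 1))) p≤
      open Sunflower sf
      -- If every coordinate after the first were constant, two tuples would list the same thick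
      -- neighbours, against the second part of `ChainRel`.
      varying : ∃[ i ] ¬ const (suc i) ≡ true
      varying = ¬∀⟶∃¬ t _ (λ i → const (suc i) Bool.≟ true) λ all →
        let _ , _ , _ , _ , (i , ne) , eq = AllPairs-first 2≤ tails-differ const-equal
        in ne (eq (suc i) (all i))

-- Counting edges along a peeling

tails : ∀ {A : Set} → List A → List (A × List A)
tails []       = []
tails (x ∷ xs) = (x , xs) ∷ tails xs

map-tails : ∀ {A : Set} (xs : List A) → map proj₁ (tails xs) ≡ xs
map-tails []       = refl
map-tails (x ∷ xs) = cong (x ∷_) (map-tails xs)

length-tails : ∀ {A : Set} (xs : List A) → length (tails xs) ≡ length xs
length-tails xs = trans (sym (length-map proj₁ (tails xs))) (cong length (map-tails xs))

-- The lengths add up to the number of pairs; the factor `½` of the theorem originates here.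
∑-tails : ∀ {A : Set} (xs : List A) → 2 * ∑ (tails xs) (length ∘ proj₂) + length xs ≡ length xs * length xs
∑-tails []       = refl
∑-tails (x ∷ xs) = trans (eq₁ (length xs) (∑ (tails xs) (length ∘ proj₂)))
  (trans (cong (λ k → k + 2 * length xs + 1) (∑-tails xs)) (eq₂ (length xs)))
  where
  eq₁ : ∀ l s → 2 * (l + s) + (1 + l) ≡ (2 * s + l) + 2 * l + 1
  eq₁ = solve-∀
  eq₂ : ∀ l → l * l + 2 * l + 1 ≡ (1 + l) * (1 + l)
  eq₂ = solve-∀

-- From the first short entry on there are at most `length xs + 1` entries, and `h * length xs < n`.
short-tails : ∀ {A : Set} h n (short? : ∀ (p : A × List A) → Dec (h * length (proj₂ p) < n)) (xs : List A) →
              h * count short? (tails xs) ≤ n + h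
short-tails h n short? [] = ≤-trans (≤-reflexive (*-zeroʳ h)) z≤n
short-tails h n short? (x ∷ xs) with short? (x , xs)
... | no _   = short-tails h n short? xs
... | yes lt = begin
  h * suc (count short? (tails xs))
    ≤⟨ *-monoʳ-≤ h (s≤s (≤-trans (⊑-length (Sublist.filter-⊆ short? (tails xs))) (≤-reflexive (length-tails xs)))) ⟩
  h * suc (length xs)
    ≡⟨ trans (*-suc h (length xs)) (+-comm h _) ⟩
  h * length xs + h
    ≤⟨ +-monoˡ-≤ h (<⇒≤ lt) ⟩
  n + h ∎
  where open ≤-Reasoning

module _ {n : ℕ} {H : 3-Graph n} where

  edge-at : ∀ {e x} → e ∈ edges H → x ∈ₛ e → ∃[ y ] ∃[ z ] e ≡ triple x y z
  edge-at {e} {x} e∈ x∈ with ∣e∣≡3⇒triple e (All.lookup (edges-uniform H) e∈)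
  ... | a , b , c , refl with ∈-triple⁻ {x = a} {b} {c} x∈
  ...   | here refl                 = b , c , refl
  ...   | there (here refl)         = a , c , ⊆-antisym (swap ∘ ∈-triple⁻) (swap ∘ ∈-triple⁻)
    where
    swap : ∀ {a b c u} → u ∈ a ∷ b ∷ c ∷ [] → u ∈ₛ triple b a c
    swap (here refl)                 = ∈-triple⁺ (there (here refl))
    swap (there (here refl))         = ∈-triple⁺ (here refl)
    swap (there (there (here refl))) = ∈-triple⁺ (there (there (here refl)))
  ...   | there (there (here refl)) = a , b , ⊆-antisym (rotate ∘ ∈-triple⁻) (rotate′ ∘ ∈-triple⁻)
    where
    rotate : ∀ {a b c u} → u ∈ a ∷ b ∷ c ∷ [] → u ∈ₛ triple c a b
    rotate (here refl)                 = ∈-triple⁺ (there (here refl))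
    rotate (there (here refl))         = ∈-triple⁺ (there (there (here refl)))
    rotate (there (there (here refl))) = ∈-triple⁺ (here refl)
    rotate′ : ∀ {a b c u} → u ∈ c ∷ a ∷ b ∷ [] → u ∈ₛ triple a b c
    rotate′ (here refl)                 = ∈-triple⁺ (there (there (here refl)))
    rotate′ (there (here refl))         = ∈-triple⁺ (here refl)
    rotate′ (there (there (here refl))) = ∈-triple⁺ (there (here refl))

  within? : ∀ xs (e : Subset n) → Dec (e ⊆ₛ fromList xs)
  within? xs e = e ⊆? fromList xs

  First : Fin n → List (Fin n) → Subset n → Set
  First x xs e = x ∈ₛ e × e ⊆ₛ fromList (x ∷ xs)

  first? : ∀ x xs e → Dec (First x xs e)
  first? x xs e = (x ∈ₛ? e) ×-dec within? (x ∷ xs) e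

  first-edge : ∀ {e x xs} → e ∈ edges H → First x xs e →
               ∃[ y ] ∃[ z ] y ∈ xs × z ∈ xs × e ≡ triple x y z × Edge H x y z
  first-edge {e} {x} {xs} e∈ (x∈ , sub) with edge-at e∈ x∈
  ... | y , z , refl = y , z , later (sub (∈-triple⁺ (there (here refl)))) (λ { refl → Edge-≢ {H = H} e∈ refl }) ,
    later (sub (∈-triple⁺ (there (there (here refl))))) (λ { refl → Edge-≢ {H = H} (Edge-swapʳ {H = H} e∈) refl }) , refl , e∈
    where
    later : ∀ {u} → u ∈ₛ fromList (x ∷ xs) → u ≢ x → u ∈ xs
    later u∈ u≢x with ∈-fromList⁻ (x ∷ xs) u∈
    ... | here u≡x = contradiction u≡x u≢x
    ... | there p  = p

  forward : Fin n → List (Fin n) → Fin n → ℕ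
  forward x xs a = count (Edge? H x a) xs

  module _ {es : List (Subset n)} (es⊆ : es ⊆ edges H) (es-Unique : Unique es) where

    -- An edge with first vertex `x` and another vertex `a` in `as` is among those counted by
    -- `forward x xs a`. The list `es` will be that of all edges and, later, that of the edges
    -- outside the common neighbourhood.
    count-first : ∀ x xs as → (∀ {y z} → y ∈ xs → z ∈ xs → Edge H x y z → triple x y z ∈ es → y ∈ as ⊎ z ∈ as) →
                  count (first? x xs) es ≤ ∑ as (forward x xs)
    count-first x xs as cover = begin
      count (first? x xs) es                 ≤⟨ Unique-⊆-length (Unique.filter⁺ (first? x xs) es-Unique) (λ e∈ → sub (∈-filter⁻ (first? x xs) {xs = es} e∈)) ⟩
      length (concatMap (λ a → map (triple x a) (filter (Edge? H x a) xs)) as)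
                                             ≡⟨ length-concatMap _ as ⟩
      ∑ as (λ a → length (map (triple x a) (filter (Edge? H x a) xs)))
                                             ≤⟨ ∑-mono as (λ {a} _ → ≤-reflexive (length-map (triple x a) (filter (Edge? H x a) xs))) ⟩
      ∑ as (forward x xs)                    ∎
      where
      open ≤-Reasoning
      new : ∀ {a y} → a ∈ as → y ∈ xs → Edge H x a y →
            triple x a y ∈ concatMap (λ a → map (triple x a) (filter (Edge? H x a) xs)) as
      new {a} a∈ y∈ h = ∈-concatMap⁺ _ (lose a∈ (∈-map⁺ (triple x a) (∈-filter⁺ (Edge? H x a) y∈ h)))
      sub : ∀ {e} → e ∈ es × First x xs e → e ∈ concatMap (λ a → map (triple x a) (filter (Edge? H x a) xs)) as
      sub (e∈ , f) with first-edge (es⊆ e∈) f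
      ... | y , z , y∈ , z∈ , refl , h with cover y∈ z∈ h e∈
      ...   | inj₁ y∈as = new y∈as z∈ h
      ...   | inj₂ z∈as = subst (λ p → (⁅ x ⁆ ∪ p) ∈ _) (pair-comm z y) (new z∈as y∈ (Edge-swapʳ {H = H} h))

    count-by-first : ∀ xs → count (within? xs) es ≤ ∑ (tails xs) (λ (x , ys) → count (first? x ys) es)
    count-by-first [] = Unique-⊆-length {ys = []} (Unique.filter⁺ (within? []) es-Unique) none
      where
      none : filter (within? []) es ⊆ []
      none {e} e∈ with ∈-filter⁻ (within? []) {xs = es} e∈
      ... | p , q with ∣e∣≡3⇒triple e (All.lookup (edges-uniform H) (es⊆ p))
      ...   | x , y , z , refl = contradiction (q (∈-triple⁺ (here refl))) ∉⊥
    count-by-first (x ∷ xs) = ≤-trans (count-⊎ (first? x xs) (within? xs) (within? (x ∷ xs)) es (λ _ → split))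
                                      (+-monoʳ-≤ _ (count-by-first xs))
      where
      split : ∀ {e} → e ⊆ₛ fromList (x ∷ xs) → First x xs e ⊎ e ⊆ₛ fromList xs
      split {e} sub with x ∈ₛ? e
      ... | yes x∈ = inj₁ (x∈ , sub)
      ... | no x∉  = inj₂ λ {y} y∈ → case ∈-fromList⁻ (x ∷ xs) (sub y∈) of λ where
        (here refl) → contradiction y∈ x∉
        (there p)   → ∈-fromList⁺ p

    length-by-first : ∀ xs → (∀ x → x ∈ xs) → length es ≤ ∑ (tails xs) (λ (x , ys) → count (first? x ys) es)
    length-by-first xs all = ≤-trans (≤-reflexive (sym (cong length {y = es} (Data.List.Properties.filter-all (within? xs) (All.tabulate (λ _ {x} _ → ∈-fromList⁺ (all x)))))))
      (count-by-first xs)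
      where import Data.List.Properties

  Entry : Set
  Entry = Fin n × List (Fin n)

  Sound : ℕ → Entry → Set
  Sound c (x , xs) = x ∉ xs × Unique xs × ∃[ C ] length C ≤ c × Cover (Edge H x) xs C

  tails-Sound : ∀ {c xs} → Peeled H c xs → Unique xs → All (Sound c) (tails xs)
  tails-Sound []              _        = []
  tails-Sound (peel le cov P) (x∉ ∷ u) = (Unique[x∷xs]⇒x∉xs (x∉ ∷ u) , u , _ , le , cov) ∷ tails-Sound P u

-- Typical vertices and the upper bound on the number of edges

module _ {n : ℕ} (H : 3-Graph n) (g h t c : ℕ) where

  -- The second part, stated without subtraction, lets each thick neighbour miss at most `n / h` of
  -- the later vertices.
  Typical : Fin n × List (Fin n) → Set
  Typical (x , xs) = length (N H g x) ≡ t × All (λ a → h * length xs ≤ h * forward {H = H} x xs a + n) (N H g x)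

  typical? : ∀ p → Dec (Typical p)
  typical? (x , xs) = (length (N H g x) ℕ.≟ t) ×-dec All.all? (λ a → h * length xs ≤? h * forward {H = H} x xs a + n) (N H g x)

  rich? : ∀ (p : Fin n × List (Fin n)) → Dec (t < length (N H g (proj₁ p)))
  rich? (x , _) = t <? length (N H g x)

  short? : ∀ (p : Fin n × List (Fin n)) → Dec (h * length (proj₂ p) < n)
  short? (_ , xs) = h * length xs <? n

  thin : List (Fin n) → Fin n → List (Fin n)
  thin C x = filter (λ a → ¬? (thick? H g x a)) C

  -- Each of the at most `c` thin vertices of the cover has codegree below `n / g` with `x`.
  thin-sum : ∀ {C x xs} → length C ≤ c → Unique xs → g * ∑ (thin C x) (forward {H = H} x xs) ≤ c * n
  thin-sum {C} {x} {xs} le u = begin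
    g * ∑ (thin C x) (forward {H = H} x xs)              ≡⟨ ∑-* g (thin C x) ⟨
    ∑ (thin C x) (λ a → g * forward {H = H} x xs a)      ≤⟨ ∑≤ (thin C x) (λ {a} a∈ → ≤-trans (*-monoʳ-≤ g (count-⊆ (Edge? H x a) u (λ _ → ∈-allFin _))) (<⇒≤ (≰⇒> (proj₂ (∈-filter⁻ (λ a → ¬? (thick? H g x a)) {xs = C} a∈))))) ⟩
    length (thin C x) * n                        ≤⟨ *-monoˡ-≤ n (≤-trans (⊑-length (Sublist.filter-⊆ _ C)) le) ⟩
    c * n                                        ∎
    where open ≤-Reasoning

  forward≤ : ∀ {x xs a} → forward {H = H} x xs a ≤ length xs
  forward≤ {xs = xs} = ⊑-length (Sublist.filter-⊆ _ xs)

  deficient-sum : ∀ {as : List (Fin n)} {f : Fin n → ℕ} {l a₀} → (∀ a → f a ≤ l) → a₀ ∈ as → h * f a₀ + n ≤ h * l →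
                  h * ∑ as f + n ≤ h * (length as * l)
  deficient-sum {a ∷ as} {f} {l} f≤ (here refl) le = begin
    h * (f a + ∑ as f) + n             ≡⟨ eq h (f a) (∑ as f) n ⟩
    (h * f a + n) + h * ∑ as f         ≤⟨ +-mono-≤ le (*-monoʳ-≤ h (∑≤ as (λ _ → f≤ _))) ⟩
    h * l + h * (length as * l)        ≡⟨ *-distribˡ-+ h l _ ⟨
    h * (l + length as * l)            ∎
    where
    open ≤-Reasoning
    eq : ∀ h a s n → h * (a + s) + n ≡ (h * a + n) + h * s
    eq = solve-∀
  deficient-sum {a ∷ as} {f} {l} f≤ (there a∈) le = begin
    h * (f a + ∑ as f) + n             ≡⟨ eq h (f a) (∑ as f) n ⟩
    h * f a + (h * ∑ as f + n)         ≤⟨ +-mono-≤ (*-monoʳ-≤ h (f≤ a)) (deficient-sum f≤ a∈ le) ⟩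
    h * l + h * (length as * l)        ≡⟨ *-distribˡ-+ h l _ ⟨
    h * (l + length as * l)            ∎
    where
    open ≤-Reasoning
    eq : ∀ h a s n → h * (a + s) + n ≡ h * a + (h * s + n)
    eq = solve-∀

  -- The loss of `n / h` comes either from a missing thick neighbour, which costs the whole of
  -- `length xs`, or from one that misses more than `n / h` of the later vertices.
  atypical-sum : ∀ {x xs} → length (N H g x) ≤ t → n ≤ h * length xs → ¬ Typical (x , xs) →
                 h * ∑ (N H g x) (forward {H = H} x xs) + n ≤ h * (t * length xs)
  atypical-sum {x} {xs} ≤t long ¬typ with length (N H g x) ℕ.≟ t
  ... | no ≢t = begin
    h * ∑ (N H g x) (forward {H = H} x xs) + n     ≤⟨ +-mono-≤ (*-monoʳ-≤ h (∑≤ (N H g x) (λ {a} _ → forward≤ {x} {xs} {a}))) long ⟩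
    h * (length (N H g x) * length xs) + h * length xs ≡⟨ eq h (length (N H g x)) (length xs) ⟩
    h * (suc (length (N H g x)) * length xs)     ≤⟨ *-monoʳ-≤ h (*-monoˡ-≤ (length xs) (≤∧≢⇒< ≤t ≢t)) ⟩
    h * (t * length xs)                          ∎
    where
    open ≤-Reasoning
    eq : ∀ h k l → h * (k * l) + h * l ≡ h * ((1 + k) * l)
    eq = solve-∀
  ... | yes refl with any? (λ a → ¬? (h * length xs ≤? h * forward {H = H} x xs a + n)) (N H g x)
  ...   | yes p with a , a∈ , ¬le ← find p =
    deficient-sum (λ a → forward≤ {x} {xs} {a}) a∈ (<⇒≤ (≰⇒> ¬le))
  ...   | no ¬p = contradiction (refl , All.tabulate (λ {a} a∈ → dec a (λ ¬q → ¬p (lose a∈ ¬q)))) ¬typ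
    where
    dec : ∀ a → ¬ ¬ (h * length xs ≤ h * forward {H = H} x xs a + n) → h * length xs ≤ h * forward {H = H} x xs a + n
    dec a = Dec.decidable-stable (h * length xs ≤? h * forward {H = H} x xs a + n)

  -- The weights of one entry of a peeling; summing gives the upper bound on
  -- the number of edges with a gain for every atypical entry.
  entry-bound : ∀ {x xs} → Sound {H = H} c (x , xs) →
    g * h * count (first? {H = H} x xs) (edges H) + g * n * 𝟙 (¬? (typical? (x , xs))) ≤
    g * h * t * length xs + h * c * n + g * n * 𝟙 (short? (x , xs)) + g * (h * c + 1) * n * 𝟙 (rich? (x , xs))
  entry-bound {x} {xs} (x∉ , u , C , C≤ , cov) with t <? length (N H g x)
  -- The cover alone bounds such an entry by `c * n`; the coefficient of the last term pays for this
  -- and for the gain.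
  ... | yes rich = begin
    g * h * F + g * n * 𝟙 (¬? (typical? (x , xs)))    ≤⟨ +-mono-≤ (*-monoʳ-≤ (g * h) F≤) (≤-trans (*-monoʳ-≤ (g * n) 𝟙≤1) (≤-reflexive (*-identityʳ (g * n)))) ⟩
    g * h * (c * n) + g * n                           ≡⟨ eq g h c n ⟩
    g * (h * c + 1) * n * 1                           ≤⟨ m≤n+m _ _ ⟩
    _                                                 ∎
    where
    open ≤-Reasoning
    F = count (first? {H = H} x xs) (edges H)
    𝟙≤1 : ∀ {P : Set} {d : Dec P} → 𝟙 d ≤ 1
    𝟙≤1 {d = yes _} = ≤-refl
    𝟙≤1 {d = no _}  = z≤n
    F≤ : F ≤ c * n
    F≤ = ≤-trans (count-first {H = H} id (edges-unique H) x xs C (λ y∈ z∈ e _ → cov y∈ z∈ e))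
      (≤-trans (∑≤ C {n} (λ {a} _ → ≤-trans (forward≤ {x} {xs} {a}) (Unique-Fin-length u))) (*-monoˡ-≤ n C≤))
    eq : ∀ g h c n → g * h * (c * n) + g * n ≡ g * (h * c + 1) * n * 1
    eq = solve-∀
  ... | no ¬rich = begin
    g * h * F + g * n * ν                             ≤⟨ +-monoˡ-≤ (g * n * ν) (*-monoʳ-≤ (g * h) F≤) ⟩
    g * h * (D + D′) + g * n * ν                      ≡⟨ eq₁ g h D D′ n ν ⟩
    g * (h * D + n * ν) + h * (g * D′)                ≤⟨ +-mono-≤ (*-monoʳ-≤ g (gain (typical? (x , xs)) (h * length xs <? n))) (*-monoʳ-≤ h (thin-sum {C} {x} {xs} C≤ u)) ⟩
    g * (h * (t * length xs) + n * σ) + h * (c * n)   ≡⟨ eq₂ g h t (length xs) n σ c ⟩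
    g * h * t * length xs + h * c * n + g * n * σ + g * (h * c + 1) * n * 0 ∎
    where
    open ≤-Reasoning
    F = count (first? {H = H} x xs) (edges H)
    D = ∑ (N H g x) (forward {H = H} x xs)
    D′ = ∑ (thin C x) (forward {H = H} x xs)
    ν = 𝟙 (¬? (typical? (x , xs)))
    σ = 𝟙 (h * length xs <? n)
    eq₁ : ∀ g h D D′ n ν → g * h * (D + D′) + g * n * ν ≡ g * (h * D + n * ν) + h * (g * D′)
    eq₁ = solve-∀
    eq₂ : ∀ g h t l n σ c → g * (h * (t * l) + n * σ) + h * (c * n) ≡ g * h * t * l + h * c * n + g * n * σ + g * (h * c + 1) * n * 0
    eq₂ = solve-∀
    N≤t : length (N H g x) ≤ t
    N≤t = ≮⇒≥ ¬rich
    D≤ : h * D ≤ h * (t * length xs)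
    D≤ = *-monoʳ-≤ h (≤-trans (∑≤ (N H g x) (λ {a} _ → forward≤ {x} {xs} {a})) (*-monoˡ-≤ (length xs) N≤t))
    gain : ∀ (d : Dec (Typical (x , xs))) (s : Dec (h * length xs < n)) → h * D + n * 𝟙 (¬? d) ≤ h * (t * length xs) + n * 𝟙 s
    gain (yes _)   s       = +-mono-≤ D≤ (≤-trans (≤-reflexive (*-zeroʳ n)) z≤n)
    -- With a short tail there is no loss to exploit, so the term for short tails itself supplies
    -- the gain.
    gain (no _)    (yes _) = +-monoˡ-≤ (n * 1) D≤
    gain (no ¬typ) (no ¬s) = ≤-trans (≤-reflexive (cong (h * D +_) (*-identityʳ n)))
      (≤-trans (atypical-sum {x} {xs} N≤t (≮⇒≥ ¬s) ¬typ) (m≤m+n _ _))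
    F≤ : F ≤ D + D′
    F≤ = ≤-trans (count-first {H = H} id (edges-unique H) x xs (N H g x ++ thin C x) cover) (≤-reflexive (∑-++ (N H g x)))
      where
      ∑-++ : ∀ (as : List (Fin n)) → ∑ (as ++ thin C x) (forward {H = H} x xs) ≡ ∑ as (forward {H = H} x xs) + D′
      ∑-++ []       = refl
      ∑-++ (a ∷ as) = trans (cong (forward {H = H} x xs a +_) (∑-++ as)) (sym (+-assoc (forward {H = H} x xs a) _ _))
      place : ∀ {a} → a ∈ C → a ∈ N H g x ++ thin C x
      place {a} a∈ with thick? H g x a
      ... | yes th = ∈-++⁺ˡ (∈-filter⁺ (thick? H g x) (∈-allFin a) th)
      ... | no ¬th = ∈-++⁺ʳ (N H g x) (∈-filter⁺ (λ a → ¬? (thick? H g x a)) a∈ ¬th)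
      cover : ∀ {y z} → y ∈ xs → z ∈ xs → Edge H x y z → triple x y z ∈ edges H → y ∈ N H g x ++ thin C x ⊎ z ∈ N H g x ++ thin C x
      cover y∈ z∈ e _ = [ inj₁ ∘ place , inj₂ ∘ place ]′ (cov y∈ z∈ e)

  total-bound : ∀ {xs} → Peeled H c xs → Unique xs → (∀ x → x ∈ xs) →
    g * h * size H + g * n * count (¬? ∘ typical?) (tails xs) ≤
    g * h * t * ∑ (tails xs) (length ∘ proj₂) + h * c * n * n + g * n * count short? (tails xs) + g * (h * c + 1) * n * count rich? (tails xs)
  total-bound {xs} P u all = begin
    g * h * size H + g * n * count (¬? ∘ typical?) ps
      ≤⟨ +-mono-≤ (*-monoʳ-≤ (g * h) (length-by-first {H = H} id (edges-unique H) xs all)) (*-monoʳ-≤ (g * n) (≤-reflexive (count≡∑ (¬? ∘ typical?) ps))) ⟩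
    g * h * ∑ ps F + g * n * ∑ ps (𝟙 ∘ ¬? ∘ typical?)
      ≡⟨ cong₂ _+_ (∑-* (g * h) ps) (∑-* (g * n) ps) ⟨
    ∑ ps (λ p → g * h * F p) + ∑ ps (λ p → g * n * 𝟙 (¬? (typical? p)))
      ≡⟨ ∑-+ ps ⟨
    ∑ ps (λ p → g * h * F p + g * n * 𝟙 (¬? (typical? p)))
      ≤⟨ ∑-mono ps (λ p∈ → entry-bound (All.lookup (tails-Sound P u) p∈)) ⟩
    ∑ ps (λ p → g * h * t * length (proj₂ p) + h * c * n + g * n * 𝟙 (short? p) + g * (h * c + 1) * n * 𝟙 (rich? p))
      ≡⟨ trans (∑-+ ps) (cong₂ _+_ (trans (∑-+ ps) (cong₂ _+_ (trans (∑-+ ps) (cong₂ _+_ (∑-* (g * h * t) ps) (∑-const ps (h * c * n)))) (∑-* (g * n) ps))) (∑-* (g * (h * c + 1) * n) ps)) ⟩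
    g * h * t * ∑ ps (length ∘ proj₂) + length ps * (h * c * n) + g * n * ∑ ps (𝟙 ∘ short?) + g * (h * c + 1) * n * ∑ ps (𝟙 ∘ rich?)
      ≤⟨ +-mono-≤ (+-mono-≤ (+-monoʳ-≤ (g * h * t * ∑ ps (length ∘ proj₂)) len) (*-monoʳ-≤ (g * n) (≤-reflexive (sym (count≡∑ short? ps))))) (*-monoʳ-≤ (g * (h * c + 1) * n) (≤-reflexive (sym (count≡∑ rich? ps)))) ⟩
    _ ∎
    where
    open ≤-Reasoning
    ps = tails xs
    F : Fin n × List (Fin n) → ℕ
    F (x , ys) = count (first? {H = H} x ys) (edges H)
    len : length ps * (h * c * n) ≤ h * c * n * n
    len = ≤-trans (*-monoˡ-≤ (h * c * n) (≤-trans (≤-reflexive (length-tails xs)) (Unique-Fin-length u))) (≤-reflexive (*-comm n (h * c * n)))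

-- The common neighbourhood of almost all vertices

-- After multiplication by `2 * q`, the four errors (thin pairs, short tails, rich vertices and the
-- slack in the density) are at most `2 * g * n * n` each, which together make the `4 * n`. The
-- choice `g ≡ h * c * q` is what balances the first of them.
atypical-arithmetic : ∀ {g h t c q n E b Λ σ r J} → 0 < g → 0 < n →
  g * h * E + g * n * b ≤ g * h * t * Λ + h * c * n * n + g * n * σ + g * (h * c + 1) * n * r →
  2 * Λ + n ≡ n * n → h * q * (t * (n * n)) ≤ 2 * (h * q) * E + 2 * (n * n) → g ≡ h * c * q →
  h * σ ≤ n + h → 2 * q ≤ h → h ≤ n → r ≤ J → q * (h * c + 1) * J ≤ n → q * b ≤ 4 * n
atypical-arithmetic {g} {h} {t} {c} {q} {n} {E} {b} {Λ} {σ} {r} {J} 0<g 0<n total Λ≡ dense g≡ σ≤ q≤ h≤ r≤ J≤ =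
  *-cancelˡ-≤ (2 * g * n) {{>-nonZero (*-pos (*-pos {2} (s≤s z≤n) 0<g) 0<n)}}
    (+-cancelˡ-≤ (2 * g * h * q * E) _ _ main)
  where
  open ≤-Reasoning
  Λ≤ : 2 * Λ ≤ n * n
  Λ≤ = ≤-trans (m≤m+n (2 * Λ) n) (≤-reflexive Λ≡)
  σ≤′ : 2 * q * σ ≤ 2 * n
  σ≤′ = ≤-trans (*-monoˡ-≤ σ q≤) (≤-trans σ≤ (≤-trans (+-monoʳ-≤ n h≤) (≤-reflexive (cong (n +_) (sym (+-identityʳ n))))))
  r≤′ : q * (h * c + 1) * r ≤ n
  r≤′ = ≤-trans (*-monoʳ-≤ (q * (h * c + 1)) r≤) J≤
  main : 2 * g * h * q * E + 2 * g * n * (q * b) ≤ 2 * g * h * q * E + 2 * g * n * (4 * n)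
  main = begin
    2 * g * h * q * E + 2 * g * n * (q * b)              ≡⟨ eq₁ g h q E n b ⟩
    2 * q * (g * h * E + g * n * b)                      ≤⟨ *-monoʳ-≤ (2 * q) total ⟩
    2 * q * (g * h * t * Λ + h * c * n * n + g * n * σ + g * (h * c + 1) * n * r)
                                                         ≡⟨ eq₂ g h t c q n Λ σ r ⟩
    g * (h * q) * t * (2 * Λ) + 2 * (h * c * q) * (n * n) + g * n * (2 * q * σ) + 2 * g * n * (q * (h * c + 1) * r)
      ≡⟨ cong (λ z → g * (h * q) * t * (2 * Λ) + 2 * z * (n * n) + g * n * (2 * q * σ) + 2 * g * n * (q * (h * c + 1) * r)) g≡ ⟨
    g * (h * q) * t * (2 * Λ) + 2 * g * (n * n) + g * n * (2 * q * σ) + 2 * g * n * (q * (h * c + 1) * r)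
      ≤⟨ +-mono-≤ (+-mono-≤ (+-monoˡ-≤ (2 * g * (n * n)) (*-monoʳ-≤ (g * (h * q) * t) Λ≤)) (*-monoʳ-≤ (g * n) σ≤′)) (*-monoʳ-≤ (2 * g * n) r≤′) ⟩
    g * (h * q) * t * (n * n) + 2 * g * (n * n) + g * n * (2 * n) + 2 * g * n * n
      ≡⟨ eq₃ g h q t n ⟩
    g * (h * q * (t * (n * n))) + 6 * (g * (n * n))
      ≤⟨ +-monoˡ-≤ (6 * (g * (n * n))) (*-monoʳ-≤ g dense) ⟩
    g * (2 * (h * q) * E + 2 * (n * n)) + 6 * (g * (n * n))
      ≡⟨ eq₄ g h q E n ⟩
    2 * g * h * q * E + 2 * g * n * (4 * n) ∎
    where
    eq₁ : ∀ g h q E n b → 2 * g * h * q * E + 2 * g * n * (q * b) ≡ 2 * q * (g * h * E + g * n * b)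
    eq₁ = solve-∀
    eq₂ : ∀ g h t c q n Λ σ r → 2 * q * (g * h * t * Λ + h * c * n * n + g * n * σ + g * (h * c + 1) * n * r) ≡
          g * (h * q) * t * (2 * Λ) + 2 * (h * c * q) * (n * n) + g * n * (2 * q * σ) + 2 * g * n * (q * (h * c + 1) * r)
    eq₂ = solve-∀
    eq₃ : ∀ g h q t n → g * (h * q) * t * (n * n) + 2 * g * (n * n) + g * n * (2 * n) + 2 * g * n * n ≡
          g * (h * q * (t * (n * n))) + 6 * (g * (n * n))
    eq₃ = solve-∀
    eq₄ : ∀ g h q E n → g * (2 * (h * q) * E + 2 * (n * n)) + 6 * (g * (n * n)) ≡ 2 * g * h * q * E + 2 * g * n * (4 * n)
    eq₄ = solve-∀

tails-AllPairs : ∀ {A : Set} (xs : List A) → AllPairs (λ p q → proj₁ q ∈ proj₂ p) (tails xs)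
tails-AllPairs []       = []
tails-AllPairs (x ∷ xs) = All.tabulate (λ {p} p∈ → subst (proj₁ p ∈_) (map-tails xs) (∈-map⁺ proj₁ p∈)) ∷ tails-AllPairs xs

module Neighbourhood {n : ℕ} (H : 3-Graph n) (g h t c : ℕ) where

  -- Only an inclusion is recorded; between typical entries it is an equality by cardinality.
  Same : Fin n × List (Fin n) → Fin n × List (Fin n) → Set
  Same p q = All (λ a → n ≤ g * codegree H (proj₁ q) a) (N H g (proj₁ p))

  same? : ∀ p q → Dec (Same p q)
  same? p q = All.all? (thick? H g (proj₁ q)) (N H g (proj₁ p))

  Good : Fin n × List (Fin n) → Fin n × List (Fin n) → Set
  Good p q = Typical H g h t c q × Same p q

  good? : ∀ p q → Dec (Good p q)
  good? p q = typical? H g h t c q ×-dec same? p q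

module _ {m n : ℕ} {T : Graph m} {H : 3-Graph n} {S : Subset m}
         (tree : IsTree T) (T⊄H : ¬ Contains H (expansion T))
         (transversal : ∀ {e} → e ∈ edges T → ∣ S ∩ e ∣ ≡ 1) {t : ℕ} (∣S∣ : ∣ S ∣ ≡ suc t)
         (g h c : ℕ) (0<g : 0 < g) (0<m : 0 < m) (0<n : 0 < n) (n-large : g * (m + size T) ≤ n) where

  open Neighbourhood H g h t c

  private
    E′ : Set
    E′ = Entry {H = H}

    Typ : E′ → Set
    Typ = Typical H g h t c

    typ? : ∀ p → Dec (Typ p)
    typ? = typical? H g h t c

    Nb : E′ → List (Fin n)
    Nb p = N H g (proj₁ p)

  Later : E′ → E′ → Set
  Later p q = proj₁ q ∈ proj₂ p

  missed? : ∀ (p : E′) a (q : E′) → Dec (¬ Edge H (proj₁ p) a (proj₁ q))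
  missed? p a q = ¬? (Edge? H (proj₁ p) a (proj₁ q))

  missed-few : ∀ {p a} (W : List E′) → Typ p → a ∈ Nb p → Unique (map proj₁ W) → All (Later p) W →
               h * count (missed? p a) W ≤ n
  missed-few {p@(x , xs)} {a} W (_ , typ) a∈ u later = +-cancelˡ-≤ (h * forward {H = H} x xs a) _ _ (begin
    h * forward {H = H} x xs a + h * count (missed? p a) W    ≡⟨ *-distribˡ-+ h (forward {H = H} x xs a) _ ⟨
    h * (forward {H = H} x xs a + count (missed? p a) W)      ≤⟨ *-monoʳ-≤ h (≤-trans (+-monoʳ-≤ (forward {H = H} x xs a) sub) (≤-reflexive (count-¬ (Edge? H x a) xs))) ⟩
    h * length xs                                     ≤⟨ All.lookup typ a∈ ⟩
    h * forward {H = H} x xs a + n                    ∎)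
    where
    open ≤-Reasoning
    sub : count (missed? p a) W ≤ count (¬? ∘ Edge? H x a) xs
    sub = ≤-trans (≤-reflexive (sym (length-map proj₁ (filter (missed? p a) W)))) (Unique-⊆-length (AllPairs-⊑ (Sublist.map⁺ proj₁ (Sublist.filter-⊆ (missed? p a) W)) u) within)
      where
      within : map proj₁ (filter (missed? p a) W) ⊆ filter (¬? ∘ Edge? H x a) xs
      within y∈ with ∈-map⁻ proj₁ y∈
      ... | q , q∈ , refl with ∈-filter⁻ (missed? p a) {xs = W} q∈
      ...   | q∈W , ¬e = ∈-filter⁺ (¬? ∘ Edge? H x a) (All.lookup later q∈W) ¬e

  any-missed? : ∀ p q → Dec (Any (λ a → ¬ Edge H (proj₁ p) a (proj₁ q)) (Nb p))
  any-missed? p q = any? (λ a → missed? p a q) (Nb p)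

  count-any : ∀ {A B : Set} {R : A → B → Set} (R? : ∀ a b → Dec (R a b)) (as : List A) (bs : List B) →
              count (λ b → any? (λ a → R? a b) as) bs ≤ ∑ as (λ a → count (R? a) bs)
  count-any R? []       bs = Unique-free bs
    where
    Unique-free : ∀ bs → count (λ b → any? (λ a → R? a b) []) bs ≤ 0
    Unique-free []       = z≤n
    Unique-free (b ∷ bs) = Unique-free bs
  count-any R? (a ∷ as) bs = ≤-trans (count-⊎ (R? a) (λ b → any? (λ a → R? a b) as) (λ b → any? (λ a → R? a b) (a ∷ as)) bs
    (λ _ → λ { (here r) → inj₁ r ; (there p) → inj₂ p })) (+-monoʳ-≤ (count (R? a) bs) (count-any R? as bs))

  -- A union bound over the thick neighbours of `p`. The factor is `suc t` rather than `t`, so that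
  -- it can be cancelled even when `t` is zero.
  any-missed-few : ∀ ρ {p} (W : List E′) → ρ * suc t ≤ h → Typ p → Unique (map proj₁ W) → All (Later p) W →
                   ρ * count (any-missed? p) W ≤ n
  any-missed-few ρ {p} W ρ≤ typ u later = *-cancelʳ-≤ _ _ (suc t) (begin
    ρ * count (any-missed? p) W * suc t          ≡⟨ eq ρ _ (suc t) ⟩
    ρ * suc t * count (any-missed? p) W          ≤⟨ *-mono-≤ ρ≤ (count-any (missed? p) (Nb p) W) ⟩
    h * ∑ (Nb p) (λ a → count (missed? p a) W)   ≡⟨ ∑-* h (Nb p) ⟨
    ∑ (Nb p) (λ a → h * count (missed? p a) W)   ≤⟨ ∑≤ (Nb p) (λ {a} a∈ → missed-few {p} {a} W typ a∈ u later) ⟩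
    length (Nb p) * n                            ≤⟨ *-monoˡ-≤ n (≤-trans (≤-reflexive (proj₁ typ)) (n≤1+n t)) ⟩
    suc t * n                                    ≡⟨ *-comm (suc t) n ⟩
    n * suc t                                    ∎)
    where
    open ≤-Reasoning
    eq : ∀ a b c → a * b * c ≡ a * c * b
    eq = solve-∀

  Dropped : E′ → E′ → Set
  Dropped p q = Same p q ⊎ Any (λ a → ¬ Edge H (proj₁ p) a (proj₁ q)) (Nb p)

  dropped? : ∀ p q → Dec (Dropped p q)
  dropped? p q = same? p q Dec.⊎-dec any-missed? p q

  keep : E′ → List E′ → List E′
  keep p = filter (¬? ∘ dropped? p)

  keep-⊑ : ∀ p W → keep p W ⊑ W
  keep-⊑ p = Sublist.filter-⊆ (¬? ∘ dropped? p)

  kept⇒ChainRel : ∀ {p q} → ¬ Dropped p q → ChainRel H g (proj₁ p) (proj₁ q)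
  kept⇒ChainRel {p} {q} ¬drop =
    (λ {a} a∈ → Dec.decidable-stable (Edge? H (proj₁ p) a (proj₁ q)) (λ ¬e → ¬drop (inj₂ (lose a∈ ¬e)))) , different
    where
    different : ∃[ a ] a ∈ Nb p × a ∉ Nb q
    different with any? (λ a → ¬? (thick? H g (proj₁ q) a)) (Nb p)
    ... | yes r = let a , a∈ , ¬th = find r in a , a∈ , ¬th ∘ N-thick H g {proj₁ q} {a}
    ... | no ¬r = contradiction (inj₁ (All.tabulate (λ {a} a∈ → Dec.decidable-stable (thick? H g (proj₁ q) a) (λ ¬th → ¬r (lose a∈ ¬th))))) ¬drop

  -- The cost `3 * n` consists of `p` itself, covered by `ρ ≤ n`, of the entries `Same` as `p`, and
  -- of those that miss an edge with it.
  keep-many : ∀ ρ j p W → ρ * suc t ≤ h → ρ ≤ n → Typ p → Unique (map proj₁ W) → All (Later p) W →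
              ρ * count (same? p) W ≤ n → 3 * n * suc j ≤ ρ * suc (length W) → 3 * n * j ≤ ρ * length (keep p W)
  keep-many ρ j p W ρ≤ ρ≤n typ u later sparse le = +-cancelˡ-≤ (3 * n) _ _ (begin
    3 * n + 3 * n * j                               ≡⟨ *-suc (3 * n) j ⟨
    3 * n * suc j                                   ≤⟨ le ⟩
    ρ * suc (length W)                              ≡⟨ cong (λ z → ρ * suc z) (count-¬ (dropped? p) W) ⟨
    ρ * suc (count (dropped? p) W + κ)              ≤⟨ *-monoʳ-≤ ρ (s≤s (+-monoˡ-≤ κ (count-⊎ (same? p) (any-missed? p) (dropped? p) W (λ _ → id)))) ⟩
    ρ * suc (count (same? p) W + count (any-missed? p) W + κ)
                                                    ≡⟨ eq ρ (count (same? p) W) (count (any-missed? p) W) κ ⟩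
    ρ + ρ * count (same? p) W + ρ * count (any-missed? p) W + ρ * κ
                                                    ≤⟨ +-monoˡ-≤ (ρ * κ) (+-mono-≤ (+-mono-≤ ρ≤n sparse) (any-missed-few ρ {p} W ρ≤ typ u later)) ⟩
    n + n + n + ρ * κ                               ≡⟨ cong (_+ ρ * κ) (eq′ n) ⟩
    3 * n + ρ * κ                                   ∎)
    where
    open ≤-Reasoning
    κ = length (keep p W)
    eq : ∀ ρ a b k → ρ * (1 + (a + b + k)) ≡ ρ + ρ * a + ρ * b + ρ * k
    eq = solve-∀
    eq′ : ∀ n → n + n + n ≡ 3 * n
    eq′ = solve-∀

  Chain-in : List E′ → ℕ → Set
  Chain-in W j = ∃[ V ] V ⊑ W × j ≤ length V × AllPairs (ChainRel H g) (map proj₁ V)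

  -- Each new member of the chain excludes at most 3n/ρ of the remaining entries.
  greedy : ∀ ρ j (W : List E′) → ρ * suc t ≤ h → ρ ≤ n → All Typ W → Unique (map proj₁ W) → AllPairs Later W →
           (∀ {p} → p ∈ W → ρ * count (same? p) W ≤ n) → 3 * n * j ≤ ρ * length W → Chain-in W j
  greedy ρ zero    W       _  _  _          _       _            _      _  = [] , Sublist.minimum W , z≤n , []
  greedy ρ (suc j) []      _  _  _          _       _            _      le =
    contradiction (≤-trans le (≤-reflexive (*-zeroʳ ρ))) (<⇒≱ (*-pos (*-pos {3} (s≤s z≤n) 0<n) (s≤s z≤n)))
  greedy ρ (suc j) (p ∷ W) ρ≤ ρ≤n (typ ∷ typs) (_ ∷ u) (later ∷ ap) sparse le =
    add-first (greedy ρ j (keep p W) ρ≤ ρ≤n (Sublist.All-resp-⊆ (keep-⊑ p W) typs)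
      (AllPairs-⊑ (Sublist.map⁺ proj₁ (keep-⊑ p W)) u) (AllPairs-⊑ (keep-⊑ p W) ap)
      (λ {q} q∈ → ≤-trans (*-monoʳ-≤ ρ (count-⊑ (same? q) (p ∷ʳˢ keep-⊑ p W))) (sparse (there (⊑⇒⊆ (keep-⊑ p W) q∈))))
      (keep-many ρ j p W ρ≤ ρ≤n typ u later
        (≤-trans (*-monoʳ-≤ ρ (count-⊑ (same? p) (p ∷ʳˢ Sublist.⊆-refl))) (sparse (here refl))) le))
    where
    add-first : Chain-in (keep p W) j → Chain-in (p ∷ W) (suc j)
    add-first (V , V⊑ , j≤ , chain) = p ∷ V , refl ∷ˢ Sublist.⊆-trans V⊑ (keep-⊑ p W) , s≤s j≤ ,
      All.map⁺ (All.tabulate (λ {q} q∈ → kept⇒ChainRel {p} {q} (proj₂ (∈-filter⁻ (¬? ∘ dropped? p) {xs = W} (⊑⇒⊆ V⊑ q∈))))) ∷ chain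

  typical-chain⇒contains : (V : List E′) → All Typ V → AllPairs (ChainRel H g) (map proj₁ V) → chainNumber m t ≤ length V →
                           Contains H (expansion T)
  typical-chain⇒contains V typs chain le = chain⇒contains {T = T} {H = H} {S = S} transversal ∣S∣ g 0<g 0<m 0<n n-large tree (map proj₁ V) chain
    typical (≤-trans le (≤-reflexive (sym (length-map proj₁ V))))
    where
    typical : ∀ {v} → v ∈ map proj₁ V → length (N H g v) ≡ t
    typical v∈ with p , p∈ , refl ← ∈-map⁻ proj₁ v∈ = proj₁ (All.lookup typs p∈)

  popular : ∀ ρ (W : List E′) → ρ * suc t ≤ h → ρ ≤ n → All Typ W → Unique (map proj₁ W) → AllPairs Later W →
            3 * n * chainNumber m t ≤ ρ * length W → ∃[ p ] p ∈ W × n ≤ ρ * count (same? p) W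
  popular ρ W ρ≤ ρ≤n typs u ap le with any? (λ p → n ≤? ρ * count (same? p) W) W
  ... | yes r = find r
  ... | no ¬r = contradiction (contained (greedy ρ (chainNumber m t) W ρ≤ ρ≤n typs u ap
                  (λ p∈ → <⇒≤ (≰⇒> (λ n≤ → ¬r (lose p∈ n≤)))) le)) T⊄H
    where
    contained : Chain-in W (chainNumber m t) → Contains H (expansion T)
    contained (V , V⊑ , j≤ , chain) = typical-chain⇒contains V (Sublist.All-resp-⊆ V⊑ typs) chain j≤

  unthick? : ∀ a (p : E′) → Dec (¬ n ≤ g * codegree H (proj₁ p) a)
  unthick? a p = ¬? (thick? H g (proj₁ p) a)

  -- If `a` is not a thick neighbour of `u`, their codegree is below `n / g`, which is at most half
  -- of `length Z`, so at least half of `Z` misses the edge with `a` and `u`. But each `z` misses at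
  -- most `n / h` of `U`, and double counting leaves at most `2n / h` such `u`.
  unthick-few : ∀ ρ a (Z U : List E′) → All Typ Z → (∀ {z} → z ∈ Z → a ∈ Nb z) → Unique (map proj₁ Z) → Unique (map proj₁ U) →
                (∀ {z u} → z ∈ Z → u ∈ U → Later z u) → n ≤ ρ * length Z → 2 * ρ ≤ g → h * count (unthick? a) U ≤ 2 * n
  unthick-few ρ a Z U typs a∈ uZ uU later n≤ ρ≤ = *-cancelʳ-≤ _ _ (length Z) {{>-nonZero 0<Z}} (begin
    h * length bad * length Z                           ≡⟨ *-assoc h (length bad) (length Z) ⟩
    h * (length bad * length Z)                         ≤⟨ *-monoʳ-≤ h (∑≥ bad (λ {u} → many {u})) ⟩
    h * ∑ bad (λ u → 2 * count (λ z → missed? z a u) Z) ≡⟨ cong (h *_) (∑-* 2 bad) ⟩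
    h * (2 * ∑ bad (λ u → count (λ z → missed? z a u) Z))
                                                      ≡⟨ cong (λ s → h * (2 * s)) (double-count (λ z u → missed? z a u) Z bad) ⟨
    h * (2 * ∑ Z (λ z → count (missed? z a) bad))       ≡⟨ eq h _ ⟩
    2 * (h * ∑ Z (λ z → count (missed? z a) bad))       ≡⟨ cong (2 *_) (∑-* h Z) ⟨
    2 * ∑ Z (λ z → h * count (missed? z a) bad)         ≤⟨ *-monoʳ-≤ 2 (∑≤ Z (λ {z} z∈ → few {z} z∈)) ⟩
    2 * (length Z * n)                                ≡⟨ eq′ (length Z) n ⟩
    2 * n * length Z                                  ∎)
    where
    open ≤-Reasoning
    bad : List E′
    bad = filter (unthick? a) U
    eq : ∀ h s → h * (2 * s) ≡ 2 * (h * s)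
    eq = solve-∀
    eq′ : ∀ z n → 2 * (z * n) ≡ 2 * n * z
    eq′ = solve-∀
    0<Z : 0 < length Z
    0<Z = n≢0⇒n>0 λ Z≡0 → contradiction (≤-trans n≤ (≤-reflexive (trans (cong (ρ *_) Z≡0) (*-zeroʳ ρ)))) (<⇒≱ 0<n)
    few : ∀ {z} → z ∈ Z → h * count (missed? z a) bad ≤ n
    few {z} z∈ = missed-few {z} {a} bad (All.lookup typs z∈) (a∈ z∈) (AllPairs-⊑ (Sublist.map⁺ proj₁ (Sublist.filter-⊆ (unthick? a) U)) uU)
      (All.tabulate (λ u∈ → later z∈ (proj₁ (∈-filter⁻ (unthick? a) {xs = U} u∈))))
    many : ∀ {u} → u ∈ bad → length Z ≤ 2 * count (λ z → missed? z a u) Z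
    many {u} u∈ = +-cancelˡ-≤ (length Z) _ _ (begin
      length Z + length Z                        ≡⟨ cong₂ _+_ (count-¬ seen? Z) (count-¬ seen? Z) ⟨
      (seen + unseen) + (seen + unseen)          ≡⟨ eq″ seen unseen ⟩
      2 * seen + 2 * unseen                      ≤⟨ +-monoˡ-≤ (2 * unseen) (<⇒≤ (*-cancelˡ-< g (2 * seen) (length Z) small)) ⟩
      length Z + 2 * unseen                      ∎)
      where
      seen? : ∀ z → Dec (Edge H (proj₁ z) a (proj₁ u))
      seen? z = Edge? H (proj₁ z) a (proj₁ u)
      seen unseen : ℕ
      seen = count seen? Z
      unseen = count (λ z → missed? z a u) Z
      eq″ : ∀ s r → (s + r) + (s + r) ≡ 2 * s + 2 * r
      eq″ = solve-∀
      eq‴ : ∀ g s → g * (2 * s) ≡ 2 * (g * s)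
      eq‴ = solve-∀
      seen≤ : seen ≤ codegree H (proj₁ u) a
      seen≤ = ≤-trans (≤-reflexive (sym (length-map proj₁ (filter seen? Z))))
        (Unique-⊆-length (AllPairs-⊑ (Sublist.map⁺ proj₁ (Sublist.filter-⊆ seen? Z)) uZ) sub)
        where
        sub : map proj₁ (filter seen? Z) ⊆ filter (Edge? H (proj₁ u) a) (allFin n)
        sub v∈ with ∈-map⁻ proj₁ v∈
        ... | z , z∈ , refl = ∈-filter⁺ (Edge? H (proj₁ u) a) (∈-allFin (proj₁ z))
          (Edge-swapʳ {H = H} (Edge-rotate {H = H} (proj₂ (∈-filter⁻ seen? {xs = Z} z∈))))
      small : g * (2 * seen) < g * length Z
      small = begin-strict
        g * (2 * seen)                           ≡⟨ eq‴ g seen ⟩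
        2 * (g * seen)                           ≤⟨ *-monoʳ-≤ 2 (*-monoʳ-≤ g seen≤) ⟩
        2 * (g * codegree H (proj₁ u) a)         <⟨ *-monoʳ-< 2 (≰⇒> (proj₂ (∈-filter⁻ (unthick? a) {xs = U} u∈))) ⟩
        2 * n                                    ≤⟨ *-monoʳ-≤ 2 n≤ ⟩
        2 * (ρ * length Z)                       ≡⟨ *-assoc 2 ρ (length Z) ⟨
        2 * ρ * length Z                         ≤⟨ *-monoˡ-≤ (length Z) ρ≤ ⟩
        g * length Z                             ∎

  unsame-few : ∀ ρ w (Z U : List E′) → Typ w → All Typ Z → (∀ {z} → z ∈ Z → Same w z) → Unique (map proj₁ Z) → Unique (map proj₁ U) →
               (∀ {z u} → z ∈ Z → u ∈ U → Later z u) → n ≤ ρ * length Z → 2 * ρ ≤ g → h * count (¬? ∘ same? w) U ≤ 2 * n * suc t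
  unsame-few ρ w Z U typ typs same uZ uU later n≤ ρ≤ = begin
    h * count (¬? ∘ same? w) U                        ≤⟨ *-monoʳ-≤ h (≤-trans (count-mono (¬? ∘ same? w) (λ u → any? (λ a → unthick? a u) (Nb w)) U (λ {u} _ → some {u})) (count-any unthick? (Nb w) U)) ⟩
    h * ∑ (Nb w) (λ a → count (unthick? a) U)         ≡⟨ ∑-* h (Nb w) ⟨
    ∑ (Nb w) (λ a → h * count (unthick? a) U)         ≤⟨ ∑≤ (Nb w) (λ {a} a∈ → unthick-few ρ a Z U typs (λ {z} z∈ → ∈-filter⁺ (thick? H g (proj₁ z)) (∈-allFin a) (All.lookup (same z∈) a∈)) uZ uU later n≤ ρ≤) ⟩
    length (Nb w) * (2 * n)                           ≤⟨ *-monoˡ-≤ (2 * n) (≤-trans (≤-reflexive (proj₁ typ)) (n≤1+n t)) ⟩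
    suc t * (2 * n)                                   ≡⟨ *-comm (suc t) (2 * n) ⟩
    2 * n * suc t                                     ∎
    where
    open ≤-Reasoning
    some : ∀ {u} → ¬ Same w u → Any (λ a → ¬ n ≤ g * codegree H (proj₁ u) a) (Nb w)
    some {u} ¬same with any? (λ a → unthick? a u) (Nb w)
    ... | yes r = r
    ... | no ¬r = contradiction (All.tabulate (λ {a} a∈ → Dec.decidable-stable (thick? H g (proj₁ u) a) (λ ¬th → ¬r (lose a∈ ¬th)))) ¬same

  -- Take a popular entry among the typical ones in the first `k`, about `n / β`. The entries that
  -- are not good with respect to it lie in this initial segment, are atypical, or lack one of its
  -- thick neighbours. Each kind has at most `n / β` members, and `β ≡ 4 * X` suffices for all
  -- three.
  common-neighbourhood : ∀ {X β q ρ k xs} → Unique xs → length xs ≡ n → k ≤ n → β * k ≤ n → n ≤ β * k + β → 4 * β ≤ n →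
    16 * β ≤ q → q * count (¬? ∘ typ?) (tails xs) ≤ 4 * n → ρ ≡ 6 * β * chainNumber m t → ρ * suc t ≤ h → ρ ≤ n → 2 * ρ ≤ g →
    β ≡ 4 * X → 8 * X * suc t ≤ h →
    ∃[ w ] Typ w × X * count (¬? ∘ good? w) (tails xs) ≤ n
  common-neighbourhood {X} {β} {q} {ρ} {k} {xs} u len k≤ βk≤ ≤βk β≤ q≥ b≤ ρ≡ ρt≤ ρ≤n ρ≤g β≡ X≤ =
    conclude (popular ρ W ρt≤ ρ≤n typsW uW apW W-large)
    where
    open ≤-Reasoning
    J = chainNumber m t
    ps = tails xs
    b = count (¬? ∘ typ?) ps
    W = filter typ? (take k ps)
    take⊑ : ∀ {A : Set} k (xs : List A) → take k xs ⊑ xs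
    take⊑ zero    xs       = Sublist.minimum xs
    take⊑ (suc k) []       = []ˢ
    take⊑ (suc k) (x ∷ xs) = refl ∷ˢ take⊑ k xs
    drop⊑ : ∀ {A : Set} k (xs : List A) → drop k xs ⊑ xs
    drop⊑ zero    xs       = Sublist.⊆-refl
    drop⊑ (suc k) []       = []ˢ
    drop⊑ (suc k) (x ∷ xs) = x ∷ʳˢ drop⊑ k xs
    take-drop : ∀ {A : Set} {R : A → A → Set} k {xs : List A} → AllPairs R xs → ∀ {x y} → x ∈ take k xs → y ∈ drop k xs → R x y
    take-drop (suc k) {x ∷ xs} (p ∷ _)  (here refl) y∈ = All.lookup p (⊑⇒⊆ (drop⊑ k xs) y∈)
    take-drop (suc k)          (_ ∷ ap) (there x∈)  y∈ = take-drop k ap x∈ y∈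
    W⊑take : W ⊑ take k ps
    W⊑take = Sublist.filter-⊆ typ? (take k ps)
    W⊑ : W ⊑ ps
    W⊑ = Sublist.⊆-trans W⊑take (take⊑ k ps)
    u-ps : Unique (map proj₁ ps)
    u-ps = subst Unique (sym (map-tails xs)) u
    typsW : All Typ W
    typsW = All.tabulate (λ p∈ → proj₂ (∈-filter⁻ typ? {xs = take k ps} p∈))
    uW : Unique (map proj₁ W)
    uW = AllPairs-⊑ (Sublist.map⁺ proj₁ W⊑) u-ps
    apW : AllPairs Later W
    apW = AllPairs-⊑ W⊑ (tails-AllPairs xs)
    take-length : length (take k ps) ≡ k
    take-length = trans (length-take k ps) (m≤n⇒m⊓n≡m (≤-trans k≤ (≤-reflexive (trans (sym len) (sym (length-tails xs))))))
    k≤W+b : k ≤ length W + b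
    k≤W+b = begin
      k                                          ≡⟨ take-length ⟨
      length (take k ps)                         ≡⟨ count-¬ typ? (take k ps) ⟨
      length W + count (¬? ∘ typ?) (take k ps)   ≤⟨ +-monoʳ-≤ (length W) (count-⊑ (¬? ∘ typ?) (take⊑ k ps)) ⟩
      length W + b                               ∎
    4βb≤n : 4 * (β * b) ≤ n
    4βb≤n = *-cancelˡ-≤ 4 (≤-trans (≤-reflexive (eq β b)) (≤-trans (*-monoˡ-≤ b q≥) b≤))
      where
      eq : ∀ β b → 4 * (4 * (β * b)) ≡ 16 * β * b
      eq = solve-∀
    -- Atypical entries cost at most a quarter of `n / β` and the rounding of `k` another quarter,
    -- so half of the segment remains.
    n≤2βW : n ≤ 2 * β * length W
    n≤2βW = *-cancelˡ-≤ 2 (+-cancelˡ-≤ (2 * n) _ _ (begin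
      2 * n + 2 * n                              ≡⟨ eq₁ n ⟩
      4 * n                                      ≤⟨ *-monoʳ-≤ 4 (≤-trans ≤βk (+-monoˡ-≤ β (*-monoʳ-≤ β k≤W+b))) ⟩
      4 * (β * (length W + b) + β)               ≡⟨ eq₂ β (length W) b ⟩
      4 * (β * b) + 4 * β + 2 * (2 * β * length W) ≤⟨ +-monoˡ-≤ _ (+-mono-≤ 4βb≤n β≤) ⟩
      n + n + 2 * (2 * β * length W)             ≡⟨ cong (λ z → n + z + 2 * (2 * β * length W)) (+-identityʳ n) ⟨
      2 * n + 2 * (2 * β * length W)             ∎))
      where
      eq₁ : ∀ n → 2 * n + 2 * n ≡ 4 * n
      eq₁ = solve-∀
      eq₂ : ∀ β w b → 4 * (β * (w + b) + β) ≡ 4 * (β * b) + 4 * β + 2 * (2 * β * w)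
      eq₂ = solve-∀
    -- The 6 in `ρ` is the 3 of `greedy` times the 2 of `n≤2βW`.
    W-large : 3 * n * J ≤ ρ * length W
    W-large = begin
      3 * n * J                        ≤⟨ *-monoˡ-≤ J (*-monoʳ-≤ 3 n≤2βW) ⟩
      3 * (2 * β * length W) * J       ≡⟨ eq β (length W) J ⟩
      6 * β * J * length W             ≡⟨ cong (_* length W) ρ≡ ⟨
      ρ * length W                     ∎
      where
      eq : ∀ β w J → 3 * (2 * β * w) * J ≡ 6 * β * J * w
      eq = solve-∀
    conclude : (∃[ w ] w ∈ W × n ≤ ρ * count (same? w) W) → ∃[ w ] Typ w × X * count (¬? ∘ good? w) ps ≤ n
    conclude (w , w∈ , n≤) = w , All.lookup typsW w∈ , *-cancelˡ-≤ 4 (begin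
      4 * (X * count (¬? ∘ good? w) ps)          ≡⟨ *-assoc 4 X _ ⟨
      4 * X * count (¬? ∘ good? w) ps            ≡⟨ cong (_* count (¬? ∘ good? w) ps) β≡ ⟨
      β * count (¬? ∘ good? w) ps                ≤⟨ *-monoʳ-≤ β bad≤ ⟩
      β * (k + (b + σ))                          ≡⟨ eq₁ β k b σ ⟩
      β * k + β * b + β * σ                      ≤⟨ +-mono-≤ (+-mono-≤ βk≤ (≤-trans (m≤n*m (β * b) 4) 4βb≤n)) βσ≤n ⟩
      n + n + n                                  ≤⟨ m≤m+n (n + n + n) n ⟩
      n + n + n + n                              ≡⟨ eq₂ n ⟩
      4 * n                                      ∎)
      where
      eq₁ : ∀ β k b σ → β * (k + (b + σ)) ≡ β * k + β * b + β * σ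
      eq₁ = solve-∀
      eq₂ : ∀ n → n + n + n + n ≡ 4 * n
      eq₂ = solve-∀
      Z = filter (same? w) W
      U = drop k ps
      σ = count (¬? ∘ same? w) U
      typw : Typ w
      typw = All.lookup typsW w∈
      Z⊑ : Z ⊑ W
      Z⊑ = Sublist.filter-⊆ (same? w) W
      hσ≤ : h * σ ≤ 2 * n * suc t
      hσ≤ = unsame-few ρ w Z U typw (Sublist.All-resp-⊆ Z⊑ typsW) (λ z∈ → proj₂ (∈-filter⁻ (same? w) {xs = W} z∈))
        (AllPairs-⊑ (Sublist.map⁺ proj₁ Z⊑) uW) (AllPairs-⊑ (Sublist.map⁺ proj₁ (drop⊑ k ps)) u-ps)
        (λ z∈ u∈ → take-drop k (tails-AllPairs xs) (⊑⇒⊆ W⊑take (⊑⇒⊆ Z⊑ z∈)) u∈) n≤ ρ≤g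
      βσ≤n : β * σ ≤ n
      βσ≤n = *-cancelʳ-≤ _ _ (2 * suc t) (begin
        β * σ * (2 * suc t)              ≡⟨ cong (λ z → z * σ * (2 * suc t)) β≡ ⟩
        4 * X * σ * (2 * suc t)          ≡⟨ eq X σ (suc t) ⟩
        8 * X * suc t * σ                ≤⟨ *-monoˡ-≤ σ X≤ ⟩
        h * σ                            ≤⟨ hσ≤ ⟩
        2 * n * suc t                    ≡⟨ eq′ n (suc t) ⟩
        n * (2 * suc t)                  ∎)
        where
        eq : ∀ X σ s → 4 * X * σ * (2 * s) ≡ 8 * X * s * σ
        eq = solve-∀
        eq′ : ∀ n s → 2 * n * s ≡ n * (2 * s)
        eq′ = solve-∀
      bad≤ : count (¬? ∘ good? w) ps ≤ k + (b + σ)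
      bad≤ = begin
        count (¬? ∘ good? w) ps                                ≡⟨ cong (count (¬? ∘ good? w)) (take++drop≡id k ps) ⟨
        count (¬? ∘ good? w) (take k ps ++ U)                  ≡⟨ count-++ (¬? ∘ good? w) (take k ps) U ⟩
        count (¬? ∘ good? w) (take k ps) + count (¬? ∘ good? w) U
          ≤⟨ +-mono-≤ (≤-trans (⊑-length (Sublist.filter-⊆ (¬? ∘ good? w) (take k ps))) (≤-reflexive take-length))
               (≤-trans (count-⊎ (¬? ∘ typ?) (¬? ∘ same? w) (¬? ∘ good? w) U (λ {p} _ → split {p})) (+-monoˡ-≤ σ (count-⊑ (¬? ∘ typ?) (drop⊑ k ps)))) ⟩
        k + (b + σ)                                            ∎
        where
        split : ∀ {p} → ¬ Good w p → ¬ Typ p ⊎ ¬ Same w p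
        split {p} ¬good with typ? p
        ... | no ¬typ = inj₁ ¬typ
        ... | yes typ = inj₂ (λ same → ¬good (typ , same))

-- Edges outside the common neighbourhood, and degrees inside it

module _ {n : ℕ} {H : 3-Graph n} where

  -- An edge through `a` is counted only at the earlier of its other two vertices. The restriction
  -- to `a ∷ xs` drives the induction: the edges counted at the head contain it, those counted later
  -- do not. The vertex `a` may occur among the entries, and its own entry contributes nothing.
  degree-by-first : ∀ a xs → Unique xs →
    ∑ (tails xs) (λ (x , ys) → forward {H = H} x ys a) ≤ count (λ e → (a ∈ₛ? e) ×-dec within? {H = H} (a ∷ xs) e) (edges H)
  degree-by-first a [] _ = z≤n
  degree-by-first a (x ∷ xs) (x∉ ∷ u) = ≤-trans (+-monoʳ-≤ (forward {H = H} x xs a) (degree-by-first a xs u)) (step (x ≟ a))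
    where
    open ≤-Reasoning
    inside? : ∀ zs e → Dec (a ∈ₛ e × e ⊆ₛ fromList (a ∷ zs))
    inside? zs e = (a ∈ₛ? e) ×-dec within? {H = H} (a ∷ zs) e
    wider : ∀ {e} → a ∈ₛ e × e ⊆ₛ fromList (a ∷ xs) → a ∈ₛ e × e ⊆ₛ fromList (a ∷ x ∷ xs)
    wider (a∈ , sub) = a∈ , λ y∈ → case ∈-fromList⁻ (a ∷ xs) (sub y∈) of λ where
      (here refl) → ∈-fromList⁺ {xs = a ∷ x ∷ xs} (here refl)
      (there p)   → ∈-fromList⁺ {xs = a ∷ x ∷ xs} (there (there p))
    step : Dec (x ≡ a) → forward {H = H} x xs a + count (inside? xs) (edges H) ≤ count (inside? (x ∷ xs)) (edges H)
    step (yes refl) = ≤-trans (+-monoˡ-≤ _ (Unique-⊆-length {ys = []} (Unique.filter⁺ (Edge? H x x) u) none))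
                              (count-mono (inside? xs) (inside? (x ∷ xs)) (edges H) (λ _ → wider))
      where
      none : filter (Edge? H x x) xs ⊆ []
      none y∈ = contradiction refl (Edge-≢ {H = H} (proj₂ (∈-filter⁻ (Edge? H x x) {xs = xs} y∈)))
    step (no x≢a) = begin
      forward {H = H} x xs a + count (inside? xs) (edges H)        ≡⟨ cong (_+ count (inside? xs) (edges H)) (length-map (triple x a) (filter (Edge? H x a) xs)) ⟨
      length new + length old                                      ≡⟨ length-++ new ⟨
      length (new ++ old)                                          ≤⟨ Unique-⊆-length (Unique.++⁺ new-Unique (Unique.filter⁺ (inside? xs) (edges-unique H)) (λ (p , q) → disjoint (∈-map⁻ (triple x a) p) q)) sub ⟩
      count (inside? (x ∷ xs)) (edges H)                           ∎
      where
      new = map (triple x a) (filter (Edge? H x a) xs)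
      old = filter (inside? xs) (edges H)
      x∉xs : x ∉ xs
      x∉xs = Unique[x∷xs]⇒x∉xs (x∉ ∷ u)
      disjoint : ∀ {e} → (∃[ y ] y ∈ filter (Edge? H x a) xs × e ≡ triple x a y) → e ∉ old
      disjoint (y , _ , refl) e∈ with ∈-filter⁻ (inside? xs) {xs = edges H} e∈
      ... | _ , _ , sub with ∈-fromList⁻ (a ∷ xs) (sub (∈-triple⁺ {x = x} {a} {y} (here refl)))
      ...   | here x≡a = x≢a x≡a
      ...   | there p  = x∉xs p
      third-injective : ∀ {y z} → y ∈ xs → a ≢ y → triple x a y ≡ triple x a z → y ≡ z
      third-injective {y} {z} y∈ a≢y eq with ∈-triple⁻ {x = x} {a} {z} (subst (y ∈ₛ_) eq (∈-triple⁺ {x = x} {a} {y} (there (there (here refl)))))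
      ... | here refl                 = contradiction y∈ x∉xs
      ... | there (here refl)         = contradiction refl a≢y
      ... | there (there (here y≡z))  = y≡z
      a≢ : ∀ {y} → Edge H x a y → a ≢ y
      a≢ e = Edge-≢ {H = H} (Edge-swapʳ {H = H} (Edge-swapˡ {H = H} e))
      map-Unique : ∀ {ys} → (∀ {y} → y ∈ ys → y ∈ xs × Edge H x a y) → Unique ys → Unique (map (triple x a) ys)
      map-Unique h [] = []
      map-Unique h (y∉ ∷ uy) = All.map⁺ (All.tabulate (λ z∈ eq → All.lookup y∉ z∈
        (third-injective (proj₁ (h (here refl))) (a≢ (proj₂ (h (here refl)))) eq))) ∷ map-Unique (h ∘ there) uy
      new-Unique : Unique new
      new-Unique = map-Unique (∈-filter⁻ (Edge? H x a) {xs = xs}) (Unique.filter⁺ (Edge? H x a) u)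
      inside-new : ∀ {y} → y ∈ xs → triple x a y ⊆ₛ fromList (a ∷ x ∷ xs)
      inside-new {y} y∈ z∈ with ∈-triple⁻ {x = x} {a} {y} z∈
      ... | here refl                 = ∈-fromList⁺ {xs = a ∷ x ∷ xs} (there (here refl))
      ... | there (here refl)         = ∈-fromList⁺ {xs = a ∷ x ∷ xs} (here refl)
      ... | there (there (here refl)) = ∈-fromList⁺ {xs = a ∷ x ∷ xs} (there (there y∈))
      sub : new ++ old ⊆ filter (inside? (x ∷ xs)) (edges H)
      sub e∈ with ∈-++⁻ new e∈
      ... | inj₁ p with ∈-map⁻ (triple x a) p
      ...   | y , y∈ , refl with ∈-filter⁻ (Edge? H x a) {xs = xs} y∈
      ...     | y∈xs , e = ∈-filter⁺ (inside? (x ∷ xs)) e (∈-triple⁺ {x = x} {a} {y} (there (here refl)) , inside-new y∈xs)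
      sub e∈ | inj₂ q with ∈-filter⁻ (inside? xs) {xs = edges H} q
      ...   | e∈H , r = ∈-filter⁺ (inside? (x ∷ xs)) e∈H (wider r)

  degree≥ : ∀ a {xs} → Unique xs → ∑ (tails xs) (λ (x , ys) → forward {H = H} x ys a) ≤ degree H a
  degree≥ a {xs} u = ≤-trans (degree-by-first a xs u)
    (count-mono (λ e → (a ∈ₛ? e) ×-dec within? {H = H} (a ∷ xs) e) (a ∈ₛ?_) (edges H) (λ _ → proj₁))

module _ {m n : ℕ} {T : Graph m} {H : 3-Graph n} {S : Subset m}
         (tree : IsTree T) (T⊄H : ¬ Contains H (expansion T))
         (transversal : ∀ {e} → e ∈ edges T → ∣ S ∩ e ∣ ≡ 1) {t : ℕ} (∣S∣ : ∣ S ∣ ≡ suc t)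
         (g h c : ℕ) (0<g : 0 < g) (0<m : 0 < m) (0<n : 0 < n) (n-large : g * (m + size T) ≤ n) where

  rich-few : ∀ {xs} → Unique xs → 2 * g * (manyNumber m t g * suc (suc t) + suc t) ≤ n →
             count (rich? H g h t c) (tails xs) ≤ manyNumber m t g
  rich-few {xs} u n≥ with count (rich? H g h t c) (tails xs) ≤? manyNumber m t g
  ... | yes le = le
  ... | no ¬le = contradiction (many-thick⇒contains {T = T} {H = H} {S = S} transversal ∣S∣ g 0<g 0<m 0<n n-large (take J vs) (Unique.take⁺ J u-vs)
                   rich (sym (trans (length-take J vs) (m≤n⇒m⊓n≡m J≤))) n≥) T⊄H
    where
    J = manyNumber m t g
    vs = map proj₁ (filter (rich? H g h t c) (tails xs))
    u-vs : Unique vs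
    u-vs = AllPairs-⊑ (Sublist.map⁺ proj₁ (Sublist.filter-⊆ (rich? H g h t c) (tails xs))) (subst Unique (sym (map-tails xs)) u)
    J≤ : J ≤ length vs
    J≤ = ≤-trans (<⇒≤ (≰⇒> ¬le)) (≤-reflexive (sym (length-map proj₁ (filter (rich? H g h t c) (tails xs)))))
    rich : ∀ {v} → v ∈ take J vs → suc t ≤ length (N H g v)
    rich {v} v∈ = from (∈-map⁻ proj₁ (subst (v ∈_) (take++drop≡id J vs) (∈-++⁺ˡ v∈)))
      where
      from : (∃[ p ] p ∈ filter (rich? H g h t c) (tails xs) × v ≡ proj₁ p) → suc t ≤ length (N H g v)
      from (p , p∈ , refl) = proj₂ (∈-filter⁻ (rich? H g h t c) {xs = tails xs} p∈)

module _ {n : ℕ} {H : 3-Graph n} (g h t c : ℕ) where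

  open Neighbourhood H g h t c

  module _ {xs : List (Fin n)} (P : Peeled H c xs) (u : Unique xs) (all : ∀ x → x ∈ xs) (len : length xs ≡ n)
           {w : Fin n × List (Fin n)} (typ : Typical H g h t c w) where

    private
      L : List (Fin n)
      L = N H g (proj₁ w)
      ps = tails xs
      bad? : ∀ p → Dec (¬ Good w p)
      bad? p = ¬? (good? w p)
      es = H ∖ fromList L

      es⊆ : es ⊆ edges H
      es⊆ e∈ = proj₁ (∈-filter⁻ (λ e → ¬? (nonempty? (e ∩ fromList L))) {xs = edges H} e∈)

      avoid : ∀ {e a} → e ∈ es → a ∈ₛ e → a ∉ L
      avoid e∈ a∈e a∈L = proj₂ (∈-filter⁻ (λ e → ¬? (nonempty? (e ∩ fromList L))) {xs = edges H} e∈) (_ , x∈p∩q⁺ (a∈e , ∈-fromList⁺ a∈L))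

      es-Unique : Unique es
      es-Unique = Unique.filter⁺ (λ e → ¬? (nonempty? (e ∩ fromList L))) (edges-unique H)

    -- Both sets have `t` elements, and `Same` gives the opposite inclusion.
    good⇒⊆ : ∀ {p} → Good w p → N H g (proj₁ p) ⊆ L
    good⇒⊆ {p} ((N≡t , _) , same) {a} a∈ with any? (a ≟_) L
    ... | yes a∈L = a∈L
    ... | no a∉L  = contradiction (Unique-⊆-length (∉⇒Unique-∷ a∉L (N-Unique H g (proj₁ w)))
            (λ { (here refl) → a∈ ; (there b∈) → ∈-filter⁺ (thick? H g (proj₁ p)) (∈-allFin _) (All.lookup same b∈) }))
            (<⇒≱ (s≤s (≤-reflexive (trans N≡t (sym (proj₁ typ))))))

    -- For a good entry, an edge that avoids `L` contains no thick neighbour of its first vertex, so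
    -- it is caught by a thin member of the cover. For a bad entry the whole cover is used, at a
    -- cost of `c * n`.
    first-outside : ∀ {p} → p ∈ ps → g * count (first? {H = H} (proj₁ p) (proj₂ p)) es ≤ c * n + g * c * n * 𝟙 (bad? p)
    first-outside {p@(x , ys)} p∈ with All.lookup (tails-Sound P u) p∈ | good? w p
    ... | _ , uy , C , C≤ , cov | yes good = ≤-trans (*-monoʳ-≤ g (count-first {H = H} es⊆ es-Unique x ys (thin H g h t c C x) cover))
            (≤-trans (thin-sum H g h t c {C} {x} {ys} C≤ uy) (m≤m+n (c * n) _))
      where
      cover : ∀ {y z} → y ∈ ys → z ∈ ys → Edge H x y z → triple x y z ∈ es → y ∈ thin H g h t c C x ⊎ z ∈ thin H g h t c C x
      cover {y} {z} y∈ z∈ e e∈ with cov y∈ z∈ e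
      ... | inj₁ y∈C = inj₁ (∈-filter⁺ (λ a → ¬? (thick? H g x a)) y∈C (λ th → avoid e∈ (∈-triple⁺ {x = x} {y} {z} (there (here refl))) (good⇒⊆ {p} good (∈-filter⁺ (thick? H g x) (∈-allFin y) th))))
      ... | inj₂ z∈C = inj₂ (∈-filter⁺ (λ a → ¬? (thick? H g x a)) z∈C (λ th → avoid e∈ (∈-triple⁺ {x = x} {y} {z} (there (there (here refl)))) (good⇒⊆ {p} good (∈-filter⁺ (thick? H g x) (∈-allFin z) th))))
    ... | _ , uy , C , C≤ , cov | no _ = ≤-trans (*-monoʳ-≤ g F≤) (≤-trans (≤-reflexive (eq g c n)) (m≤n+m _ (c * n)))
      where
      eq : ∀ g c n → g * (c * n) ≡ g * c * n * 1
      eq = solve-∀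
      F≤ : count (first? {H = H} x ys) es ≤ c * n
      F≤ = ≤-trans (count-first {H = H} es⊆ es-Unique x ys C (λ y∈ z∈ e _ → cov y∈ z∈ e))
        (≤-trans (∑≤ C {n} (λ {a} _ → ≤-trans (forward≤ H g h t c {x} {ys} {a}) (Unique-Fin-length uy))) (*-monoˡ-≤ n C≤))

    outside-bound : g * length es ≤ c * n * n + g * c * n * count bad? ps
    outside-bound = begin
      g * length es                                                          ≤⟨ *-monoʳ-≤ g (length-by-first {H = H} es⊆ es-Unique xs all) ⟩
      g * ∑ ps (λ p → count (first? {H = H} (proj₁ p) (proj₂ p)) es)         ≡⟨ ∑-* g ps ⟨
      ∑ ps (λ p → g * count (first? {H = H} (proj₁ p) (proj₂ p)) es)         ≤⟨ ∑-mono ps first-outside ⟩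
      ∑ ps (λ p → c * n + g * c * n * 𝟙 (bad? p))                            ≡⟨ trans (∑-+ ps) (cong₂ _+_ (∑-const ps (c * n)) (∑-* (g * c * n) ps)) ⟩
      length ps * (c * n) + g * c * n * ∑ ps (𝟙 ∘ bad?)                      ≡⟨ cong₂ (λ a b → a * (c * n) + g * c * n * b) (trans (length-tails xs) len) (sym (count≡∑ bad? ps)) ⟩
      n * (c * n) + g * c * n * count bad? ps                                ≡⟨ cong (_+ g * c * n * count bad? ps) (*-comm n (c * n)) ⟩
      c * n * n + g * c * n * count bad? ps                                  ∎
      where open ≤-Reasoning

    -- A good entry contributes to the degree of `a` all but `n / h` of its later vertices, and the
    -- numbers of later vertices add up to about `n * n / 2`. A bad entry loses at most `n`.
    degree-bound : ∀ {a} → a ∈ L → h * (n * n) ≤ 2 * h * degree H a + 2 * (n * n) + 2 * h * n * count bad? ps + h * n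
    degree-bound {a} a∈ = begin
      h * (n * n)                                                ≡⟨ cong (h *_) Λ≡ ⟨
      h * (2 * ∑ ps (length ∘ proj₂) + n)                        ≡⟨ eq₁ h (∑ ps (length ∘ proj₂)) n ⟩
      2 * (h * ∑ ps (length ∘ proj₂)) + h * n                    ≡⟨ cong (λ z → 2 * z + h * n) (∑-* h ps) ⟨
      2 * ∑ ps (λ p → h * length (proj₂ p)) + h * n              ≤⟨ +-monoˡ-≤ (h * n) (*-monoʳ-≤ 2 (∑-mono ps (λ {p} p∈ → entry p p∈))) ⟩
      2 * ∑ ps (λ p → h * f p + n + h * n * 𝟙 (bad? p)) + h * n  ≡⟨ cong (λ z → 2 * z + h * n) split ⟩
      2 * (h * ∑ ps f + n * n + h * n * count bad? ps) + h * n   ≤⟨ +-monoˡ-≤ (h * n) (*-monoʳ-≤ 2 (+-monoˡ-≤ (h * n * count bad? ps) (+-monoˡ-≤ (n * n) (*-monoʳ-≤ h (degree≥ {H = H} a u))))) ⟩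
      2 * (h * degree H a + n * n + h * n * count bad? ps) + h * n ≡⟨ eq₂ h (degree H a) n (count bad? ps) ⟩
      2 * h * degree H a + 2 * (n * n) + 2 * h * n * count bad? ps + h * n ∎
      where
      open ≤-Reasoning
      f : Fin n × List (Fin n) → ℕ
      f (x , ys) = forward {H = H} x ys a
      Λ≡ : 2 * ∑ ps (length ∘ proj₂) + n ≡ n * n
      Λ≡ = subst (λ k → 2 * ∑ ps (length ∘ proj₂) + k ≡ k * k) len (∑-tails xs)
      eq₁ : ∀ h s n → h * (2 * s + n) ≡ 2 * (h * s) + h * n
      eq₁ = solve-∀
      eq₂ : ∀ h d n b → 2 * (h * d + n * n + h * n * b) + h * n ≡ 2 * h * d + 2 * (n * n) + 2 * h * n * b + h * n
      eq₂ = solve-∀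
      split : ∑ ps (λ p → h * f p + n + h * n * 𝟙 (bad? p)) ≡ h * ∑ ps f + n * n + h * n * count bad? ps
      split = trans (∑-+ ps) (cong₂ _+_ (trans (∑-+ ps) (cong₂ _+_ (∑-* h ps) (trans (∑-const ps n) (cong (_* n) (trans (length-tails xs) len)))))
        (trans (∑-* (h * n) ps) (cong (h * n *_) (sym (count≡∑ bad? ps)))))
      entry : ∀ p → p ∈ ps → h * length (proj₂ p) ≤ h * f p + n + h * n * 𝟙 (bad? p)
      entry p@(x , ys) p∈ with good? w p
      ... | yes ((_ , far) , same) = ≤-trans (All.lookup far (∈-filter⁺ (thick? H g x) (∈-allFin a) (All.lookup same a∈))) (m≤m+n _ _)
      ... | no _ = ≤-trans (*-monoʳ-≤ h (Unique-Fin-length (proj₁ (proj₂ (All.lookup (tails-Sound P u) p∈)))))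
                     (≤-trans (≤-reflexive (sym (*-identityʳ (h * n)))) (m≤n+m _ (h * f p + n)))

-- The stability theorem in integral form

-- In units of `n * n`, thin pairs contribute `c / g ≤ 1 / X` and bad entries `c * B / n ≤ c / X`;
-- hence the factor `1 + c` in the choice of `X`.
outside-arithmetic : ∀ {D X c g n E B} → 0 < g → X * B ≤ n → X * c ≤ g → D * (1 + c) ≤ X →
  g * E ≤ c * n * n + g * c * n * B → D * E ≤ n * n
outside-arithmetic {D} {X} {c} {g} {n} {E} {B} 0<g B≤ X≤ D≤ le = *-cancelˡ-≤ ((1 + c) * g) {{>-nonZero (*-pos {1 + c} (s≤s z≤n) 0<g)}} (begin
  (1 + c) * g * (D * E)                        ≡⟨ eq₁ c g D E ⟩
  D * (1 + c) * (g * E)                        ≤⟨ *-mono-≤ D≤ le ⟩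
  X * (c * n * n + g * c * n * B)              ≡⟨ eq₂ X c n g B ⟩
  X * c * (n * n) + g * c * n * (X * B)        ≤⟨ +-mono-≤ (*-monoˡ-≤ (n * n) X≤) (*-monoʳ-≤ (g * c * n) B≤) ⟩
  g * (n * n) + g * c * n * n                  ≡⟨ eq₃ c g n ⟩
  (1 + c) * g * (n * n)                        ∎)
  where
  open ≤-Reasoning
  eq₁ : ∀ c g D E → (1 + c) * g * (D * E) ≡ D * (1 + c) * (g * E)
  eq₁ = solve-∀
  eq₂ : ∀ X c n g B → X * (c * n * n + g * c * n * B) ≡ X * c * (n * n) + g * c * n * (X * B)
  eq₂ = solve-∀
  eq₃ : ∀ c g n → g * (n * n) + g * c * n * n ≡ (1 + c) * g * (n * n)
  eq₃ = solve-∀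

-- Of the allowed slack `2 * (n * n)`, the missed later vertices take one half, the bad entries and
-- the diagonal term `h * n` a quarter each.
degree-arithmetic : ∀ {D X h n d B} → 0 < h → X * B ≤ n → 4 * D ≤ X → 2 * D ≤ h → 2 * D ≤ n →
  h * (n * n) ≤ 2 * h * d + 2 * (n * n) + 2 * h * n * B + h * n → D * (n * n) ≤ 2 * D * d + 2 * (n * n)
degree-arithmetic {D} {X} {h} {n} {d} {B} 0<h B≤ D≤X D≤h D≤n le = *-cancelˡ-≤ (2 * h) {{>-nonZero (*-pos {2} (s≤s z≤n) 0<h)}} (begin
  2 * h * (D * (n * n))                                               ≡⟨ eq₁ h D n ⟩
  2 * D * (h * (n * n))                                               ≤⟨ *-monoʳ-≤ (2 * D) le ⟩
  2 * D * (2 * h * d + 2 * (n * n) + 2 * h * n * B + h * n)           ≡⟨ eq₂ D h d n B ⟩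
  2 * h * (2 * D * d) + 2 * (n * n) * (2 * D) + h * n * (4 * D * B) + h * n * (2 * D)
    ≤⟨ +-mono-≤ (+-mono-≤ (+-monoʳ-≤ (2 * h * (2 * D * d)) (*-monoʳ-≤ (2 * (n * n)) D≤h)) (*-monoʳ-≤ (h * n) (≤-trans (*-monoˡ-≤ B D≤X) B≤))) (*-monoʳ-≤ (h * n) D≤n) ⟩
  2 * h * (2 * D * d) + 2 * (n * n) * h + h * n * n + h * n * n       ≡⟨ eq₃ h D d n ⟩
  2 * h * (2 * D * d + 2 * (n * n))                                   ∎)
  where
  open ≤-Reasoning
  eq₁ : ∀ h D n → 2 * h * (D * (n * n)) ≡ 2 * D * (h * (n * n))
  eq₁ = solve-∀
  eq₂ : ∀ D h d n B → 2 * D * (2 * h * d + 2 * (n * n) + 2 * h * n * B + h * n) ≡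
        2 * h * (2 * D * d) + 2 * (n * n) * (2 * D) + h * n * (4 * D * B) + h * n * (2 * D)
  eq₂ = solve-∀
  eq₃ : ∀ h D d n → 2 * h * (2 * D * d) + 2 * (n * n) * h + h * n * n + h * n * n ≡ 2 * h * (2 * D * d + 2 * (n * n))
  eq₃ = solve-∀

-- Up to constant factors, 1/X bounds the fraction of vertices outside the common
-- pattern, 1/β is the length of the initial segment, 1/ρ the popularity threshold,
-- 1/q the fraction of atypical vertices, 1/h the fraction of later vertices that
-- a typical vertex misses and 1/g the thickness threshold.
record Constants (m s t D : ℕ) : Set where
  field
    X β ρ q h g : ℕ
  c : ℕ
  c = 2 * suc (m + s)
  field
    X≥      : D * (1 + c) ≤ X
    X≥4D    : 4 * D ≤ X
    β≡      : β ≡ 4 * X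
    ρ≡      : ρ ≡ 6 * β * chainNumber m t
    q≥      : 16 * β ≤ q
    h≥q     : 2 * q ≤ h
    h≥ρ     : ρ * suc t ≤ h
    h≥X     : 8 * X * suc t ≤ h
    h≥D     : 2 * D ≤ h
    g≡      : g ≡ h * c * q
    g≥ρ     : 2 * ρ ≤ g
    g≥X     : X * c ≤ g
    0<β     : 0 < β
    0<q     : 0 < q
    0<h     : 0 < h
    0<g     : 0 < g

summands : ∀ a b c d → a ≤ a + b + c + d × b ≤ a + b + c + d × c ≤ a + b + c + d × d ≤ a + b + c + d
summands a b c d =
  ≤-trans (m≤m+n a b) (≤-trans (m≤m+n (a + b) c) (m≤m+n (a + b + c) d)) ,
  ≤-trans (m≤n+m b a) (≤-trans (m≤m+n (a + b) c) (m≤m+n (a + b + c) d)) ,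
  ≤-trans (m≤n+m c (a + b)) (m≤m+n (a + b + c) d) ,
  m≤n+m d (a + b + c)

module _ {m s t D X β ρ q h : ℕ} (0<D : 0 < D)
         -- The factor 4 makes `X` at least `4 * D` as well as `D * (1 + c)`, and `h` is the sum of
         -- its four lower bounds.
         (X≡ : X ≡ 4 * (D * (1 + 2 * suc (m + s)))) (β≡ : β ≡ 4 * X) (ρ≡ : ρ ≡ 6 * β * chainNumber m t) (q≡ : q ≡ 16 * β)
         (h≡ : h ≡ 2 * q + ρ * suc t + 8 * X * suc t + 2 * D) where

  private
    c : ℕ
    c = 2 * suc (m + s)

    0<c : 0 < c
    0<c = s≤s z≤n

    0<X : 0 < X
    0<X = subst (0 <_) (sym X≡) (*-pos {4} (s≤s z≤n) (*-pos 0<D (s≤s z≤n)))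

    0<β : 0 < β
    0<β = subst (0 <_) (sym β≡) (*-pos {4} (s≤s z≤n) 0<X)

    0<q : 0 < q
    0<q = subst (0 <_) (sym q≡) (*-pos {16} (s≤s z≤n) 0<β)

    parts : 2 * q ≤ h × ρ * suc t ≤ h × 8 * X * suc t ≤ h × 2 * D ≤ h
    parts = subst (λ h → 2 * q ≤ h × ρ * suc t ≤ h × 8 * X * suc t ≤ h × 2 * D ≤ h) (sym h≡)
      (summands (2 * q) (ρ * suc t) (8 * X * suc t) (2 * D))

    h≥ρ : ρ * suc t ≤ h
    h≥ρ = proj₁ (proj₂ parts)

    h≥X : 8 * X * suc t ≤ h
    h≥X = proj₁ (proj₂ (proj₂ parts))

    h≥D : 2 * D ≤ h
    h≥D = proj₂ (proj₂ (proj₂ parts))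

    0<h : 0 < h
    0<h = ≤-trans (*-pos {2} (s≤s z≤n) 0<D) h≥D

    instance
      q≢0 : NonZero q
      q≢0 = >-nonZero 0<q

    X≤h : X ≤ h
    X≤h = ≤-trans (≤-trans (m≤n*m X 8) (m≤m*n (8 * X) (suc t))) h≥X

    ρ≤h : ρ ≤ h
    ρ≤h = ≤-trans (m≤m*n ρ (suc t)) h≥ρ

    2≤c : 2 ≤ c
    2≤c = m≤m*n 2 (suc (m + s))

  build-constants : Constants m s t D
  build-constants = record
    { X = X ; β = β ; ρ = ρ ; q = q ; h = h ; g = h * c * q
    ; X≥ = ≤-trans (m≤n*m (D * (1 + c)) 4) (≤-reflexive (sym X≡))
    ; X≥4D = ≤-trans (*-monoʳ-≤ 4 (m≤m*n D (1 + c))) (≤-reflexive (sym X≡))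
    ; β≡ = β≡ ; ρ≡ = ρ≡ ; q≥ = ≤-reflexive (sym q≡)
    ; h≥q = proj₁ parts ; h≥ρ = h≥ρ ; h≥X = h≥X ; h≥D = h≥D
    ; g≡ = refl
    ; g≥ρ = ≤-trans (*-mono-≤ 2≤c ρ≤h) (≤-trans (≤-reflexive (*-comm c h)) (m≤m*n (h * c) q))
    ; g≥X = ≤-trans (*-monoˡ-≤ c X≤h) (m≤m*n (h * c) q)
    ; 0<β = 0<β ; 0<q = 0<q ; 0<h = 0<h
    ; 0<g = *-pos (*-pos 0<h 0<c) 0<q
    }

constants : ∀ m s t D → 0 < D → Constants m s t D
constants m s t D 0<D = build-constants 0<D refl refl refl refl refl

-- A sum in place of a maximum. After the 1, the summands serve, in this order: short tails, rich
-- vertices, the rounding of `n / β`, the entry itself in `keep-many`, the diagonal term of the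
-- degrees, the greedy choice for thick pairs, and averaging.
threshold : ∀ {m s t D} → Constants m s t D → ℕ
threshold {m} {s} {t} {D} C = sum (1 ∷ h ∷ q * (h * c + 1) * M ∷ 4 * β ∷ ρ ∷ 2 * D ∷ g * (m + s) ∷ 2 * g * (M * suc (suc t) + suc t) ∷ [])
  where
  open Constants C
  M = manyNumber m t g

∈⇒≤sum : ∀ {x xs} → x ∈ xs → x ≤ sum xs
∈⇒≤sum {xs = y ∷ xs} (here refl) = m≤m+n y (sum xs)
∈⇒≤sum {xs = y ∷ xs} (there x∈)  = ≤-trans (∈⇒≤sum x∈) (m≤n+m (sum xs) y)

-- Closeness with `δ` equal to `1 / D`, cleared of denominators.
IntegralClose : ∀ {n} → ℕ → ℕ → 3-Graph n → Set
IntegralClose {n} D t H = ∃[ L ] ∣ L ∣ ≡ t × D * length (H ∖ L) ≤ n * n × (∀ {v} → v ∈ₛ L → D * (n * n) ≤ 2 * D * degree H v + 2 * (n * n))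

-- The density hypothesis is that of the theorem with `ε` equal to `1 / (h * q)`, cleared of
-- denominators.
stability : ∀ {m n t D} {T : Graph m} {S : Subset m} → IsTree T → (∀ {e} → e ∈ edges T → ∣ S ∩ e ∣ ≡ 1) → ∣ S ∣ ≡ suc t →
  (C : Constants m (size T) t D) → threshold C ≤ n → (H : 3-Graph n) → ¬ Contains H (expansion T) →
  let open Constants C in h * q * (t * (n * n)) ≤ 2 * (h * q) * size H + 2 * (n * n) → IntegralClose D t H
stability {m} {n} {t} {D} {T} {S} tree transversal ∣S∣ C n≥ H T⊄H dense = along (peeling tree {H = H} T⊄H n (allFin n) (Unique.allFin⁺ n) (≤-reflexive (length-tabulate id)))
  where
  open Constants C
  M = manyNumber m t g
  0<m : 0 < m
  0<m = >-nonZero⁻¹ m {{IsTree.nonempty tree}}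
  bound : ∀ {x} → x ∈ 1 ∷ h ∷ q * (h * c + 1) * M ∷ 4 * β ∷ ρ ∷ 2 * D ∷ g * (m + size T) ∷ 2 * g * (M * suc (suc t) + suc t) ∷ [] → x ≤ n
  bound x∈ = ≤-trans (∈⇒≤sum x∈) n≥
  0<n : 0 < n
  0<n = bound (here refl)
  h≤n : h ≤ n
  h≤n = bound (there (here refl))
  M≤n : q * (h * c + 1) * M ≤ n
  M≤n = bound (there (there (here refl)))
  4β≤n : 4 * β ≤ n
  4β≤n = bound (there (there (there (here refl))))
  ρ≤n : ρ ≤ n
  ρ≤n = bound (there (there (there (there (here refl)))))
  D≤n : 2 * D ≤ n
  D≤n = bound (there (there (there (there (there (here refl))))))
  n-large : g * (m + size T) ≤ n
  n-large = bound (there (there (there (there (there (there (here refl)))))))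
  n-large′ : 2 * g * (M * suc (suc t) + suc t) ≤ n
  n-large′ = bound (there (there (there (there (there (there (there (here refl))))))))
  instance
    _ : NonZero β
    _ = >-nonZero 0<β
  open import Data.Nat.DivMod using (_/_; _%_; m≡m%n+[m/n]*n; m%n<n; m/n≤m; m/n*n≤m)
  ℓ : ℕ
  ℓ = n / β
  n≤βℓ+β : n ≤ β * ℓ + β
  n≤βℓ+β = begin
    n                  ≡⟨ m≡m%n+[m/n]*n n β ⟩
    n % β + ℓ * β      ≤⟨ +-monoˡ-≤ (ℓ * β) (<⇒≤ (m%n<n n β)) ⟩
    β + ℓ * β          ≡⟨ trans (+-comm β (ℓ * β)) (cong (_+ β) (*-comm ℓ β)) ⟩
    β * ℓ + β          ∎
    where open ≤-Reasoning
  along : (∃[ xs ] Peeled H c xs × Unique xs × xs ⊆ allFin n × allFin n ⊆ xs) → IntegralClose D t H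
  along (xs , P , u , _ , sup) = finish (common-neighbourhood {T = T} {H = H} {S = S} tree T⊄H transversal ∣S∣ g h c 0<g 0<m 0<n n-large
      {X} {β} {q} {ρ} {ℓ} u len (m/n≤m n β) (≤-trans (≤-reflexive (*-comm β ℓ)) (m/n*n≤m n β)) n≤βℓ+β 4β≤n q≥ few ρ≡ h≥ρ ρ≤n g≥ρ β≡ h≥X)
    where
    open Neighbourhood H g h t c
    all : ∀ x → x ∈ xs
    all x = sup (∈-allFin x)
    len : length xs ≡ n
    len = ≤-antisym (Unique-Fin-length u) (≤-trans (≤-reflexive (sym (length-tabulate id))) (Unique-⊆-length (Unique.allFin⁺ n) sup))
    few : q * count (¬? ∘ typical? H g h t c) (tails xs) ≤ 4 * n
    few = atypical-arithmetic {g} {h} {t} {c} {q} {n} {size H} 0<g 0<n (total-bound H g h t c P u all)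
      (subst (λ k → 2 * ∑ (tails xs) (length ∘ proj₂) + k ≡ k * k) len (∑-tails xs)) dense g≡
      (short-tails h n (short? H g h t c) xs) h≥q h≤n
      (rich-few {T = T} {H = H} {S = S} tree T⊄H transversal ∣S∣ g h c 0<g 0<m 0<n n-large u n-large′) M≤n
    finish : (∃[ w ] Typical H g h t c w × X * count (¬? ∘ good? w) (tails xs) ≤ n) → IntegralClose D t H
    finish (w , typ , B≤) = fromList (N H g (proj₁ w)) ,
      trans (∣fromList∣ (N-Unique H g (proj₁ w))) (proj₁ typ) ,
      outside-arithmetic {D} {X} {c} {g} {n} 0<g B≤ g≥X X≥ (outside-bound {H = H} g h t c P u all len {w} typ) ,
      λ v∈ → degree-arithmetic {D} {X} {h} {n} 0<h B≤ X≥4D h≥D D≤n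
        (degree-bound {H = H} g h t c P u all len {w} typ (∈-fromList⁻ (N H g (proj₁ w)) v∈))

-- Passage to rational numbers

-- The quotient `+ a / 1` is normalised through a gcd, which is stuck on a variable; `fromℤ` is
-- already a reduced fraction.
fromℕ≡fromℤ : ∀ a → fromℕ a ≡ fromℤ (ℤ.+ a)
fromℕ≡fromℤ a = ℚ.normalize-coprime (Coprimality.sym (Coprimality.1-coprimeTo a))

fromℕ-+ : ∀ a b → fromℕ (a + b) ≡ fromℕ a ℚ.+ fromℕ b
fromℕ-+ a b = sym (trans (cong₂ ℚ._+_ (fromℕ≡fromℤ a) (fromℕ≡fromℤ b))
  (cong (ℚ._/ 1) (cong₂ ℤ._+_ (ℤ.*-identityʳ (ℤ.+ a)) (ℤ.*-identityʳ (ℤ.+ b)))))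

fromℕ-* : ∀ a b → fromℕ (a * b) ≡ fromℕ a ℚ.* fromℕ b
fromℕ-* a b = sym (trans (cong₂ ℚ._*_ (fromℕ≡fromℤ a) (fromℕ≡fromℤ b)) (cong (ℚ._/ 1) (sym (ℤ.pos-* a b))))

fromℕ-mono : ∀ {a b} → a ≤ b → fromℕ a ℚ.≤ fromℕ b
fromℕ-mono {a} {b} le = subst₂ ℚ._≤_ (sym (fromℕ≡fromℤ a)) (sym (fromℕ≡fromℤ b))
  (*≤* (subst₂ ℤ._≤_ (sym (ℤ.*-identityʳ (ℤ.+ a))) (sym (ℤ.*-identityʳ (ℤ.+ b))) (ℤ.+≤+ le)))

fromℕ-cancel : ∀ {a b} → fromℕ a ℚ.≤ fromℕ b → a ≤ b
fromℕ-cancel {a} {b} le = ℤ.drop‿+≤+ (subst₂ ℤ._≤_ (ℤ.*-identityʳ (ℤ.+ a)) (ℤ.*-identityʳ (ℤ.+ b))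
  (ℚ.drop-*≤* (subst₂ ℚ._≤_ (fromℕ≡fromℤ a) (fromℕ≡fromℤ b) le)))

fromℕ-positive : ∀ {a} → 0 < a → ℚ.Positive (fromℕ a)
fromℕ-positive {suc a} _ = subst ℚ.Positive (sym (fromℕ≡fromℤ (suc a))) _

-- The denominator of `δ` will do, since the numerator is at least 1.
archimedean : ∀ δ → 0ℚ ℚ.< δ → ∃[ D ] 0 < D × 1ℚ ℚ.≤ fromℕ D ℚ.* δ
archimedean (mkℚ +[1+ p ] d-1 c) _ = suc d-1 , s≤s z≤n , subst (λ z → 1ℚ ℚ.≤ z ℚ.* mkℚ +[1+ p ] d-1 c) (sym (fromℕ≡fromℤ (suc d-1)))
  (ℚ.toℚᵘ-cancel-≤ (ℚᵘ.≤-trans (ℚᵘ.*≤* (ℤ.+≤+ le)) (ℚᵘ.≤-reflexive (ℚᵘ.≃-sym (ℚ.toℚᵘ-homo-* (fromℤ (ℤ.+ suc d-1)) (mkℚ +[1+ p ] d-1 c))))))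
  where
  le : 1 * (1 * suc d-1) ≤ suc d-1 * suc p * 1
  le = begin
    1 * (1 * suc d-1)      ≡⟨ trans (*-identityˡ (1 * suc d-1)) (*-identityˡ (suc d-1)) ⟩
    suc d-1                ≤⟨ m≤m*n (suc d-1) (suc p) ⟩
    suc d-1 * suc p        ≡⟨ *-identityʳ (suc d-1 * suc p) ⟨
    suc d-1 * suc p * 1    ∎
    where open ≤-Reasoning
archimedean (mkℚ (ℤ.+ 0) d-1 c) (ℚ.*<* (ℤ.+<+ ()))
archimedean (mkℚ ℤ.-[1+ _ ] d-1 c) (ℚ.*<* ())

fromℕ-nonNegative : ∀ a → ℚ.NonNegative (fromℕ a)
fromℕ-nonNegative a = ℚ.nonNegative (fromℕ-mono {0} {a} z≤n)

-- Multiplication by `2 * e` turns the term with `ε` into `2 * N`, because `e * ε` is 1.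
dense⇒ : ∀ {e ε N t E} → fromℕ e ℚ.* ε ≡ 1ℚ →
         (½ ℚ.* (fromℕ (suc t) ℚ.- 1ℚ) ℚ.- ε) ℚ.* fromℕ N ℚ.≤ fromℕ E → e * (t * N) ≤ 2 * e * E + 2 * N
dense⇒ {e} {ε} {N} {t} {E} eε le = fromℕ-cancel (begin
  fromℕ (e * (t * N))
    ≡⟨ trans (fromℕ-* e (t * N)) (cong (fromℕ e ℚ.*_) (fromℕ-* t N)) ⟩
  fromℕ e ℚ.* (fromℕ t ℚ.* fromℕ N)
    ≡⟨ eq₁ (fromℕ e) ε (fromℕ t) (fromℕ N) ⟩
  fromℕ 2 ℚ.* fromℕ e ℚ.* ((½ ℚ.* ((1ℚ ℚ.+ fromℕ t) ℚ.- 1ℚ) ℚ.- ε) ℚ.* fromℕ N) ℚ.+ fromℕ 2 ℚ.* (fromℕ e ℚ.* ε) ℚ.* fromℕ N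
    ≡⟨ cong₂ (λ s z → fromℕ 2 ℚ.* fromℕ e ℚ.* ((½ ℚ.* (s ℚ.- 1ℚ) ℚ.- ε) ℚ.* fromℕ N) ℚ.+ fromℕ 2 ℚ.* z ℚ.* fromℕ N) (sym (fromℕ-+ 1 t)) eε ⟩
  fromℕ 2 ℚ.* fromℕ e ℚ.* ((½ ℚ.* (fromℕ (suc t) ℚ.- 1ℚ) ℚ.- ε) ℚ.* fromℕ N) ℚ.+ fromℕ 2 ℚ.* 1ℚ ℚ.* fromℕ N
    ≤⟨ ℚ.+-monoˡ-≤ (fromℕ 2 ℚ.* 1ℚ ℚ.* fromℕ N) (ℚ.*-monoˡ-≤-nonNeg (fromℕ 2 ℚ.* fromℕ e) {{e≥0}} le) ⟩
  fromℕ 2 ℚ.* fromℕ e ℚ.* fromℕ E ℚ.+ fromℕ 2 ℚ.* 1ℚ ℚ.* fromℕ N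
    ≡⟨ cong₂ ℚ._+_ (trans (fromℕ-* (2 * e) E) (cong (ℚ._* fromℕ E) (fromℕ-* 2 e))) (trans (fromℕ-* 2 N) (cong (ℚ._* fromℕ N) (sym (ℚ.*-identityʳ (fromℕ 2))))) ⟨
  fromℕ (2 * e * E) ℚ.+ fromℕ (2 * N)
    ≡⟨ fromℕ-+ (2 * e * E) (2 * N) ⟨
  fromℕ (2 * e * E + 2 * N) ∎)
  where
  open ℚ.≤-Reasoning
  e≥0 : ℚ.NonNegative (fromℕ 2 ℚ.* fromℕ e)
  e≥0 = subst ℚ.NonNegative (fromℕ-* 2 e) (fromℕ-nonNegative (2 * e))
  open ℚ.+-*-Solver
  eq₁ : ∀ e ε t N → e ℚ.* (t ℚ.* N) ≡ fromℕ 2 ℚ.* e ℚ.* ((½ ℚ.* ((1ℚ ℚ.+ t) ℚ.- 1ℚ) ℚ.- ε) ℚ.* N) ℚ.+ fromℕ 2 ℚ.* (e ℚ.* ε) ℚ.* N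
  eq₁ = solve 4 (λ e ε t N → e :* (t :* N) := con (fromℕ 2) :* e :* ((con ½ :* ((con 1ℚ :+ t) :- con 1ℚ) :- ε) :* N) :+ con (fromℕ 2) :* (e :* ε) :* N) refl

module _ {D δ} (0<D : 0 < D) (1≤Dδ : 1ℚ ℚ.≤ fromℕ D ℚ.* δ) where

  ≤δ : ∀ {E N} → D * E ≤ N → fromℕ E ℚ.≤ δ ℚ.* fromℕ N
  ≤δ {E} {N} le = ℚ.*-cancelˡ-≤-pos (fromℕ D) {{fromℕ-positive 0<D}} (begin
    fromℕ D ℚ.* fromℕ E            ≡⟨ fromℕ-* D E ⟨
    fromℕ (D * E)                  ≤⟨ fromℕ-mono le ⟩
    fromℕ N                        ≡⟨ ℚ.*-identityˡ (fromℕ N) ⟨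
    1ℚ ℚ.* fromℕ N                 ≤⟨ ℚ.*-monoʳ-≤-nonNeg (fromℕ N) {{fromℕ-nonNegative N}} 1≤Dδ ⟩
    fromℕ D ℚ.* δ ℚ.* fromℕ N      ≡⟨ ℚ.*-assoc (fromℕ D) δ (fromℕ N) ⟩
    fromℕ D ℚ.* (δ ℚ.* fromℕ N)    ∎)
    where open ℚ.≤-Reasoning

  ½-δ≤ : ∀ {d N} → D * N ≤ 2 * D * d + 2 * N → (½ ℚ.- δ) ℚ.* fromℕ N ℚ.≤ fromℕ d
  ½-δ≤ {d} {N} le = ℚ.*-cancelˡ-≤-pos (fromℕ (2 * D)) {{fromℕ-positive (*-pos {2} (s≤s z≤n) 0<D)}} (begin
    fromℕ (2 * D) ℚ.* ((½ ℚ.- δ) ℚ.* fromℕ N)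
      ≡⟨ cong (ℚ._* ((½ ℚ.- δ) ℚ.* fromℕ N)) (fromℕ-* 2 D) ⟩
    fromℕ 2 ℚ.* fromℕ D ℚ.* ((½ ℚ.- δ) ℚ.* fromℕ N)
      ≡⟨ eq₁ (fromℕ D) δ (fromℕ N) ⟩
    fromℕ D ℚ.* fromℕ N ℚ.- fromℕ 2 ℚ.* (fromℕ D ℚ.* δ ℚ.* fromℕ N)
      ≤⟨ ℚ.+-mono-≤ (subst (ℚ._≤ fromℕ (2 * D * d + 2 * N)) (fromℕ-* D N) (fromℕ-mono le)) (ℚ.neg-antimono-≤ (ℚ.*-monoˡ-≤-nonNeg (fromℕ 2) {{fromℕ-nonNegative 2}} (ℚ.*-monoʳ-≤-nonNeg (fromℕ N) {{fromℕ-nonNegative N}} 1≤Dδ))) ⟩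
    fromℕ (2 * D * d + 2 * N) ℚ.- fromℕ 2 ℚ.* (1ℚ ℚ.* fromℕ N)
      ≡⟨ cong (ℚ._- fromℕ 2 ℚ.* (1ℚ ℚ.* fromℕ N)) (trans (fromℕ-+ (2 * D * d) (2 * N)) (cong₂ ℚ._+_ (fromℕ-* (2 * D) d) (fromℕ-* 2 N))) ⟩
    fromℕ (2 * D) ℚ.* fromℕ d ℚ.+ fromℕ 2 ℚ.* fromℕ N ℚ.- fromℕ 2 ℚ.* (1ℚ ℚ.* fromℕ N)
      ≡⟨ eq₂ (fromℕ (2 * D)) (fromℕ d) (fromℕ N) ⟩
    fromℕ (2 * D) ℚ.* fromℕ d ∎)
    where
    open ℚ.≤-Reasoning
    open ℚ.+-*-Solver
    eq₁ : ∀ D δ N → fromℕ 2 ℚ.* D ℚ.* ((½ ℚ.- δ) ℚ.* N) ≡ D ℚ.* N ℚ.- fromℕ 2 ℚ.* (D ℚ.* δ ℚ.* N)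
    eq₁ = solve 3 (λ D δ N → con (fromℕ 2) :* D :* ((con ½ :- δ) :* N) := D :* N :- con (fromℕ 2) :* (D :* δ :* N)) refl
    eq₂ : ∀ D d N → D ℚ.* d ℚ.+ fromℕ 2 ℚ.* N ℚ.- fromℕ 2 ℚ.* (1ℚ ℚ.* N) ≡ D ℚ.* d
    eq₂ = solve 3 (λ D d N → D :* d :+ con (fromℕ 2) :* N :- con (fromℕ 2) :* (con 1ℚ :* N) := D :* d) refl

n^2≡ : ∀ n → n ^ 2 ≡ n * n
n^2≡ n = cong (n *_) (*-identityʳ n)

contains-edgeless : ∀ {m n} {T : Graph m} {H : 3-Graph n} → m ≤ n → (Fin (size T) → ⊥) → Contains H (expansion T)
contains-edgeless {T = T} {H} m≤n none = contains-expansion {T = T} {H = H} (λ u → Fin.inject≤ u m≤n) (⊥-elim ∘ none)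
  (inject≤-injective m≤n m≤n _ _) (λ {d} → ⊥-elim (none d)) (λ _ e → ⊥-elim (none e)) (λ e → ⊥-elim (none e))
  where open import Data.Fin.Properties using (inject≤-injective)

module _ {m} {T : Graph m} (tree : IsTree T) {S : Subset m} (transversal : ∀ {e} → e ∈ edges T → ∣ S ∩ e ∣ ≡ 1)
         (δ : ℚ) (0<δ : 0ℚ ℚ.< δ) where

  Conclusion : ℕ → Set
  Conclusion s = ∃[ ε ] (0ℚ ℚ.< ε × (∃[ n₀ ]
    (∀ n → n₀ ℕ.≤ n → (H : 3-Graph n) →
     ¬ Contains H (expansion T) →
     (½ ℚ.* (fromℕ s ℚ.- 1ℚ) ℚ.- ε) ℚ.* fromℕ (n ℕ.^ 2) ℚ.≤ fromℕ (size H) →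
     Close δ (s ∸ 1) H)))

  conclusion : ∀ s → ∣ S ∣ ≡ s → Conclusion s
  -- An empty transversal means that `T` has no edges, so every `H` with at least `m` vertices
  -- contains its expansion and the claim is vacuous; the value of `ε` is arbitrary. In the other
  -- case `s ∸ 1` is a true subtraction.
  conclusion zero ∣S∣ = 1ℚ , ℚ.positive⁻¹ 1ℚ , m , λ n m≤n H T⊄H _ →
    contradiction (contains-edgeless {T = T} {H = H} m≤n edgeless) T⊄H
    where
    edgeless : Fin (size T) → ⊥
    edgeless e = contradiction (subst (∣ S ∩ lookup (edges T) e ∣ ≤_) ∣S∣ (∣p∩q∣≤∣p∣ S (lookup (edges T) e)))
                   (<⇒≱ (≤-reflexive (sym (transversal (∈-lookup e)))))
      where open import Data.Fin.Subset.Properties using (∣p∩q∣≤∣p∣)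
  conclusion (suc t) ∣S∣ = choose (archimedean δ 0<δ)
    where
    choose : (∃[ D ] 0 < D × 1ℚ ℚ.≤ fromℕ D ℚ.* δ) → Conclusion (suc t)
    choose (D , 0<D , 1≤Dδ) = ε , ε>0 , threshold C , main
      where
      C = constants m (size T) t D 0<D
      open Constants C
      e = h * q
      0<e : 0 < e
      0<e = *-pos 0<h 0<q
      instance
        e>0 : ℚ.Positive (fromℕ e)
        e>0 = fromℕ-positive 0<e
        e≢0 : ℚ.NonZero (fromℕ e)
        e≢0 = ℚ.pos⇒nonZero (fromℕ e)
      ε = ℚ.1/ fromℕ e
      ε>0 : 0ℚ ℚ.< ε
      ε>0 = ℚ.positive⁻¹ ε {{ℚ.1/pos⇒pos (fromℕ e)}}
      main : ∀ n → threshold C ≤ n → (H : 3-Graph n) → ¬ Contains H (expansion T) →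
             (½ ℚ.* (fromℕ (suc t) ℚ.- 1ℚ) ℚ.- ε) ℚ.* fromℕ (n ℕ.^ 2) ℚ.≤ fromℕ (size H) → Close δ t H
      main n n≥ H T⊄H dense = close (stability {T = T} {S = S} tree transversal ∣S∣ C n≥ H T⊄H
          (dense⇒ {e} {ε} {n * n} {t} {size H} (ℚ.*-inverseʳ (fromℕ e)) (subst (λ N → (½ ℚ.* (fromℕ (suc t) ℚ.- 1ℚ) ℚ.- ε) ℚ.* fromℕ N ℚ.≤ fromℕ (size H)) (n^2≡ n) dense)))
        where
        close : IntegralClose D t H → Close δ t H
        close (L , ∣L∣ , out , deg) = L , ∣L∣ ,
          subst (λ N → fromℕ (length (H ∖ L)) ℚ.≤ δ ℚ.* fromℕ N) (sym (n^2≡ n)) (≤δ {D} {δ} 0<D 1≤Dδ out) ,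
          λ {v} v∈ → subst (λ N → (½ ℚ.- δ) ℚ.* fromℕ N ℚ.≤ fromℕ (degree H v)) (sym (n^2≡ n)) (½-δ≤ {D} {δ} 0<D 1≤Dδ (deg v∈))

theorem1p3 : ∀ {m} (T : Graph m) → IsTree T →
    ∀ {σ} → IsCrosscutNumber T σ → IsTauInd T σ →
    ∀ (δ : ℚ) → 0ℚ ℚ.< δ →
    ∃[ ε ] (0ℚ ℚ.< ε × (∃[ n₀ ]
    (∀ n → n₀ ℕ.≤ n → (H : 3-Graph n) →
    ¬ Contains H (expansion T) →
    (½ ℚ.* (fromℕ σ ℚ.- 1ℚ) ℚ.- ε) ℚ.* fromℕ (n ℕ.^ 2) ℚ.≤ fromℕ (size H) →
    Close δ (σ ∸ 1) H)))
theorem1p3 T tree {σ} _ ((S , transversal , σ≡) , _) δ 0<δ = conclusion tree {S} transversal δ 0<δ σ (sym σ≡)
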